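{- The contextual preorders of the call-by-name calculus $L_{name}$ and the call-by-need calculus $L_{LR}$ coincide: $\le_{name}\;=\;\le_{LR}$ as binary relations on $\mathbb{E}_{\mathcal L}$.
   Context: **Syntax.** Fix a set of data constructors partitioned into types; each constructor $c$ has an arity $\mathrm{ar}(c)\ge 0$; the constructors of type $T$ are enumerated as $c_{T,1},\dots,c_{T,|T|}$; there is a type Bool with nullary constructors True, False. Constructors occur only fully saturated. Expressions $\mathbb{E}_{\mathcal L}$: $s,t ::= x \mid (s\ t)\mid (\lambda x.s)\mid (\mathtt{letrec}\ x_1=s_1,\dots,x_n=s_n\ \mathtt{in}\ t)\mid (c\ s_1\dots s_{\mathrm{ar}(c)})\mid(\mathtt{seq}\ s\ t)\mid(\mathtt{case}_T\ s\ \mathtt{of}\ alts)$, where $alts$ has exactly one alternative $((c\ y_1\dots y_{\mathrm{ar}(c)})\to r)$ for each constructor $c$ of type $T$ (the $y_i$ are distinct variables bound in $r$). In letrec, $n\ge1$, the $x_i$ are distinct, the bindings are recursive (the scope of each $x_j$ is $s_1,\dots,s_n,t$) and are identified up to reordering. Expressions are taken up to $\alpha$-equivalence; bound variables are assumed distinct from each other and from free variables, and reductions rename implicitly if necessary. $Env$ denotes a group of letrec-bindings (possibly empty if other bindings are displayed). Contexts $C$ are expressions with one hole $[\cdot]$ in place of a subexpression; $\mathbb{C}_{\mathcal L}$ is the set of all of them. A value $v$ is an abstraction or a constructor application. **The calculus $L_{LR}$.** A normal-order step $\xrightarrow{LR}$ on $\mathbb{E}_{\mathcal L}$ is defined in two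 stages. *Stage 1 (labelling)* with labels $S,T,V,W$: start with $s^T$ and no other labels, and exhaustively apply (subterms may carry more labels than displayed; $a^{S\vee T}$ means label $S$ or $T$; the fail rules take precedence): - $(\mathtt{letrec}\ Env\ \mathtt{in}\ s)^T\leadsto(\mathtt{letrec}\ Env\ \mathtt{in}\ s^S)^V$; - $(s\ t)^{S\vee T}\leadsto(s^S\ t)^V$; $(\mathtt{seq}\ s\ t)^{S\vee T}\leadsto(\mathtt{seq}\ s^S\ t)^V$; $(\mathtt{case}_T\ s\ \mathtt{of}\ alts)^{S\vee T}\leadsto(\mathtt{case}_T\ s^S\ \mathtt{of}\ alts)^V$; - $\mathtt{letrec}\ x=s,Env\ \mathtt{in}\ C[x^S]\leadsto\mathtt{letrec}\ x=s^S,Env\ \mathtt{in}\ C[x^V]$; - $\mathtt{letrec}\ x=s^{V\vee W},y=C[x^S],Env\ \mathtt{in}\ t\leadsto$ fail; $\mathtt{letrec}\ x=C[x^S],Env\ \mathtt{in}\ s\leadsto$ fail; - $\mathtt{letrec}\ x=s,y=C[x^S],Env\ \mathtt{in}\ t\leadsto\mathtt{letrec}\ x=s^S,y=C[x^V],Env\ \mathtt{in}\ t$ if $C[x]\neq x$; - $\mathtt{letrec}\ x=s,y=x^S,Env\ \mathtt{in}\ t\leadsto\mathtt{letrec}\ x=s^S,y=x^W,Env\ \mathtt{in}\ t$. *Stage 2*: if labelling does not fail, apply one of the following rules, if possible, where the displayed labels $S,V$ must match. $Ch$ denotes a chain $x_2=x_1,\dots,x_m=x_{m-1}$ (empty if $m=1$).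 - (lbeta) $C[((\lambda x.s)^S\ t)]\to C[\mathtt{letrec}\ x=t\ \mathtt{in}\ s]$. - (cp-in) $\mathtt{letrec}\ x_1=(\lambda x.s)^S,Ch,Env\ \mathtt{in}\ C[x_m^V]\to\mathtt{letrec}\ x_1=\lambda x.s,Ch,Env\ \mathtt{in}\ C[\lambda x.s]$. - (cp-e) $\mathtt{letrec}\ x_1=(\lambda x.s)^S,Ch,Env,y=C[x_m^V]\ \mathtt{in}\ t\to\mathtt{letrec}\ x_1=\lambda x.s,Ch,Env,y=C[\lambda x.s]\ \mathtt{in}\ t$. - (lapp) $C[((\mathtt{letrec}\ Env\ \mathtt{in}\ s)^S\ t)]\to C[\mathtt{letrec}\ Env\ \mathtt{in}\ (s\ t)]$; (lcase) $C[\mathtt{case}_T\ (\mathtt{letrec}\ Env\ \mathtt{in}\ s)^S\ \mathtt{of}\ alts]\to C[\mathtt{letrec}\ Env\ \mathtt{in}\ (\mathtt{case}_T\ s\ \mathtt{of}\ alts)]$; (lseq) $C[\mathtt{seq}\ (\mathtt{letrec}\ Env\ \mathtt{in}\ s)^S\ t]\to C[\mathtt{letrec}\ Env\ \mathtt{in}\ (\mathtt{seq}\ s\ t)]$. - (llet-in) $\mathtt{letrec}\ Env_1\ \mathtt{in}\ (\mathtt{letrec}\ Env_2\ \mathtt{in}\ s)^S\to\mathtt{letrec}\ Env_1,Env_2\ \mathtt{in}\ s$; (llet-e) $\mathtt{letrec}\ Env_1,x=(\mathtt{letrec}\ Env_2\ \mathtt{in}\ s)^S\ \mathtt{in}\ t\to\mathtt{letrec}\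 Env_1,Env_2,x=s\ \mathtt{in}\ t$. - (seq-c) $C[(\mathtt{seq}\ v^S\ s)]\to C[s]$ for a value $v$; (seq-in) $\mathtt{letrec}\ x_1=v^S,Ch,Env\ \mathtt{in}\ C[(\mathtt{seq}\ x_m^V\ s)]\to\mathtt{letrec}\ x_1=v,Ch,Env\ \mathtt{in}\ C[s]$ and (seq-e) $\mathtt{letrec}\ x_1=v^S,Ch,Env,y=C[(\mathtt{seq}\ x_m^V\ s)]\ \mathtt{in}\ t\to\mathtt{letrec}\ x_1=v,Ch,Env,y=C[s]\ \mathtt{in}\ t$, both for a constructor application $v$. - (case-c) $C[\mathtt{case}_T\ (c\ s_1\dots s_k)^S\ \mathtt{of}\dots((c\ y_1\dots y_k)\to t)\dots]\to C[\mathtt{letrec}\ y_1=s_1,\dots,y_k=s_k\ \mathtt{in}\ t]$ if $k=\mathrm{ar}(c)\ge1$, and $\to C[t]$ if $k=0$. - (case-in) $\mathtt{letrec}\ x_1=(c\ s_1\dots s_k)^S,Ch,Env\ \mathtt{in}\ C[\mathtt{case}_T\ x_m^V\ \mathtt{of}\dots((c\ z_1\dots z_k)\to t)\dots]\to\mathtt{letrec}\ x_1=(c\ y_1\dots y_k),y_1=s_1,\dots,y_k=s_k,Ch,Env\ \mathtt{in}\ C[\mathtt{letrec}\ z_1=y_1,\dots,z_k=y_k\ \mathtt{in}\ t]$ with fresh $y_i$ if $k=\mathrm{ar}(c)\ge1$; if $k=0$ the result is $\mathtt{letrec}\ x_1=c,Ch,Env\ \mathtt{in}\ C[t]$. - (case-e)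 the same with the case-expression inside a binding: $\mathtt{letrec}\ x_1=(c\ s_1\dots s_k)^S,Ch,u=C[\mathtt{case}_T\ x_m^V\ \mathtt{of}\dots((c\ z_1\dots z_k)\to t)\dots],Env\ \mathtt{in}\ r\to\mathtt{letrec}\ x_1=(c\ y_1\dots y_k),y_1=s_1,\dots,y_k=s_k,Ch,u=C[\mathtt{letrec}\ z_1=y_1,\dots,z_k=y_k\ \mathtt{in}\ t],Env\ \mathtt{in}\ r$ with fresh $y_i$ if $k\ge1$; if $k=0$ the result is $\mathtt{letrec}\ x_1=c,Ch,u=C[t],Env\ \mathtt{in}\ r$. The $L_{LR}$-WHNFs (answers) are: abstractions; constructor applications; $\mathtt{letrec}\ Env\ \mathtt{in}\ v$ with $v$ a value; and $\mathtt{letrec}\ x_1=v,Ch,Env\ \mathtt{in}\ x_m$ with $v$ a constructor application. **The calculus $L_{name}$** on $\mathbb{E}_{\mathcal L}$: let $L::=[\cdot]\mid\mathtt{letrec}\ Env\ \mathtt{in}\ L$ and $A::=[\cdot]\mid(A\ s)\mid(\mathtt{case}_T\ A\ \mathtt{of}\ alts)\mid(\mathtt{seq}\ A\ s)$; reduction contexts are $R=L[A]$. $\xrightarrow{name}$ is given by: (beta) $R[(\lambda x.s)\ t]\to R[s[t/x]]$; (gcp) $L[\mathtt{letrec}\ Env,x=s\ \mathtt{in}\ R[x]]\to L[\mathtt{letrec}\ Env,x=s\ \mathtt{in}\ R[s]]$ (with $x$ the displayed bound variable); (lapp) $R[((\mathtt{letrec}\ Env\ \mathtt{in}\ s)\ t)]\to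 R[\mathtt{letrec}\ Env\ \mathtt{in}\ (s\ t)]$; (lcase) $R[\mathtt{case}_T\ (\mathtt{letrec}\ Env\ \mathtt{in}\ s)\ \mathtt{of}\ alts]\to R[\mathtt{letrec}\ Env\ \mathtt{in}\ (\mathtt{case}_T\ s\ \mathtt{of}\ alts)]$; (lseq) $R[\mathtt{seq}\ (\mathtt{letrec}\ Env\ \mathtt{in}\ s)\ t]\to R[\mathtt{letrec}\ Env\ \mathtt{in}\ (\mathtt{seq}\ s\ t)]$; (seq) $R[\mathtt{seq}\ v\ s]\to R[s]$ for a value $v$; (case) $R[\mathtt{case}_T\ (c\ s_1\dots s_k)\ \mathtt{of}\dots((c\ x_1\dots x_k)\to t)\dots]\to R[t[s_1/x_1,\dots,s_k/x_k]]$. The $L_{name}$-WHNFs (answers) are the expressions $L[v]$ with $v$ a value. **Contextual preorders.** For $D\in\{LR,name\}$, $s\downarrow_D$ means $s\xrightarrow{D,*}v$ for some answer $v$ of the calculus, and $s\le_Dt$ iff for all $C\in\mathbb{C}_{\mathcal L}$: $C[s]\downarrow_D\Rightarrow C[t]\downarrow_D$. -}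

module Defs where

open import Data.Fin.Base using (Fin; _↑ˡ_; _↑ʳ_; cast)
open import Data.Fin.Substitution using (Sub; Lift; TermSubst; module VarSubst)
open import Data.List.Base using (List; []; _∷_)
open import Data.List.Membership.Propositional using (_∈_)
open import Data.List.Relation.Unary.All as All using (All; []; _∷_)
open import Data.Nat.Base using (ℕ; zero; suc; _+_)
open import Data.Nat.Properties using (+-assoc)
open import Data.Product.Base using (∃; _×_)
open import Data.Unit.Base using (⊤; tt)
open import Data.Vec.Base as Vec
  using (Vec; []; _∷_; _++_; lookup; map; tabulate; _[_]≔_; _[_]%=_)
open import Function.Definitions using (Injective)
open import Relation.Binary.Construct.Closure.ReflexiveTransitive using (Star)
open import Relation.Binary.PropositionalEquality using (_≡_; _≢_; sym)
open import Relation.Nullary using (¬_)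

-- The data constructors of a type K are the positions of the list arities K,
-- which holds their arities: c : a ∈ arities K is a constructor of K with
-- arity a.

record Signature : Set₁ where
  field
    Type         : Set
    arities      : Type → List ℕ
    nonempty     : ∀ K → arities K ≢ []
    Bool         : Type
    Bool-arities : arities Bool ≡ 0 ∷ 0 ∷ []

module Calculus (𝕊 : Signature) where
  open Signature 𝕊

  -- Well-scoped de Bruijn terms, so that α-equivalence is equality.  Every
  -- node carries an annotation from A; it is used for the labels of the
  -- call-by-need strategy and is trivial in plain expressions (Exp below).
  --
  -- letrec binds suc k variables; variable i ↑ˡ n is the one bound by entry i
  -- of the vector.  Bindings are stored in some order, but every rule below
  -- addresses them by an arbitrary index and treats the rest as Env, so the
  -- order plays no role.

  data Tm (A : Set) (n : ℕ) : Set where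
    var    : A → Fin n → Tm A n
    app    : A → Tm A n → Tm A n → Tm A n
    lam    : A → Tm A (suc n) → Tm A n
    letrec : ∀ {k} → A → Vec (Tm A (suc k + n)) (suc k) → Tm A (suc k + n) → Tm A n
    con    : ∀ {a} → A → (K : Type) → a ∈ arities K → Vec (Tm A n) a → Tm A n
    seq    : A → Tm A n → Tm A n → Tm A n
    case   : A → (K : Type) → Tm A n → All (λ a → Tm A (a + n)) (arities K) → Tm A n

  Alts : Set → ℕ → List ℕ → Set
  Alts A n as = All (λ a → Tm A (a + n)) as

  Exp : ℕ → Set
  Exp = Tm ⊤

  data Value {A : Set} {n : ℕ} : Tm A n → Set where
    lam : ∀ {a s} → Value (lam a s)
    con : ∀ {l a K} {c : a ∈ arities K} {ss} → Value (con l K c ss)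

  -- A context in Ctx A ds n has n free variables; ds lists, from the outside
  -- in, the numbers of variables bound by the binders passed on the way to
  -- the hole, so that the hole is in scope of ds ▷ n variables.

  infixr 5 _▷_

  _▷_ : List ℕ → ℕ → ℕ
  []       ▷ n = n
  (d ∷ ds) ▷ n = ds ▷ (d + n)

  data Ctx     (A : Set) : List ℕ → ℕ → Set
  data CtxVec  (A : Set) : List ℕ → ℕ → ℕ → Set
  data CtxAlts (A : Set) : List ℕ → ℕ → List ℕ → Set

  data Ctx A where
    hole    : ∀ {n} → Ctx A [] n
    appˡ    : ∀ {ds n} → A → Ctx A ds n → Tm A n → Ctx A ds n
    appʳ    : ∀ {ds n} → A → Tm A n → Ctx A ds n → Ctx A ds n
    lam     : ∀ {ds n} → A → Ctx A ds (suc n) → Ctx A (1 ∷ ds) n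
    letrecᵉ : ∀ {ds n k} → A → CtxVec A ds (suc k + n) (suc k) → Tm A (suc k + n) →
              Ctx A (suc k ∷ ds) n
    letrecᵇ : ∀ {ds n k} → A → Vec (Tm A (suc k + n)) (suc k) → Ctx A ds (suc k + n) →
              Ctx A (suc k ∷ ds) n
    con     : ∀ {ds n a} → A → (K : Type) → a ∈ arities K → CtxVec A ds n a → Ctx A ds n
    seqˡ    : ∀ {ds n} → A → Ctx A ds n → Tm A n → Ctx A ds n
    seqʳ    : ∀ {ds n} → A → Tm A n → Ctx A ds n → Ctx A ds n
    caseˢ   : ∀ {ds n} → A → (K : Type) → Ctx A ds n → Alts A n (arities K) → Ctx A ds n
    caseᵃ   : ∀ {ds n} → A → (K : Type) → Tm A n → CtxAlts A ds n (arities K) → Ctx A ds n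

  data CtxVec A where
    here  : ∀ {ds n k} → Ctx A ds n → Vec (Tm A n) k → CtxVec A ds n (suc k)
    there : ∀ {ds n k} → Tm A n → CtxVec A ds n k → CtxVec A ds n (suc k)

  data CtxAlts A where
    here  : ∀ {ds n a as} → Ctx A ds (a + n) → Alts A n as → CtxAlts A (a ∷ ds) n (a ∷ as)
    there : ∀ {ds n a as} → Tm A (a + n) → CtxAlts A ds n as → CtxAlts A ds n (a ∷ as)

  -- plug C s is C[s]: variables of s may be captured.

  plug     : ∀ {A ds n} → Ctx A ds n → Tm A (ds ▷ n) → Tm A n
  plugVec  : ∀ {A ds n k} → CtxVec A ds n k → Tm A (ds ▷ n) → Vec (Tm A n) k
  plugAlts : ∀ {A ds n as} → CtxAlts A ds n as → Tm A (ds ▷ n) → Alts A n as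

  plug hole             u = u
  plug (appˡ a C t)     u = app a (plug C u) t
  plug (appʳ a s C)     u = app a s (plug C u)
  plug (lam a C)        u = lam a (plug C u)
  plug (letrecᵉ a E t)  u = letrec a (plugVec E u) t
  plug (letrecᵇ a bs C) u = letrec a bs (plug C u)
  plug (con a K c E)    u = con a K c (plugVec E u)
  plug (seqˡ a C t)     u = seq a (plug C u) t
  plug (seqʳ a s C)     u = seq a s (plug C u)
  plug (caseˢ a K C alts) u = case a K (plug C u) alts
  plug (caseᵃ a K s E)  u = case a K s (plugAlts E u)

  plugVec (here C ss) u = plug C u ∷ ss
  plugVec (there s E) u = s ∷ plugVec E u

  plugAlts (here C alts) u = plug C u ∷ alts
  plugAlts (there s E)   u = s ∷ plugAlts E u

  relabel     : ∀ {A B n} → (A → B) → Tm A n → Tm B n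
  relabelVec  : ∀ {A B n k} → (A → B) → Vec (Tm A n) k → Vec (Tm B n) k
  relabelAlts : ∀ {A B n as} → (A → B) → Alts A n as → Alts B n as

  relabel f (var a x)       = var (f a) x
  relabel f (app a s t)     = app (f a) (relabel f s) (relabel f t)
  relabel f (lam a s)       = lam (f a) (relabel f s)
  relabel f (letrec a bs t) = letrec (f a) (relabelVec f bs) (relabel f t)
  relabel f (con a K c ss)  = con (f a) K c (relabelVec f ss)
  relabel f (seq a s t)     = seq (f a) (relabel f s) (relabel f t)
  relabel f (case a K s alts) = case (f a) K (relabel f s) (relabelAlts f alts)

  relabelVec f []       = []
  relabelVec f (s ∷ ss) = relabel f s ∷ relabelVec f ss

  relabelAlts f []         = []
  relabelAlts f (s ∷ alts) = relabel f s ∷ relabelAlts f alts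

  module Traversal {A : Set} {T : ℕ → Set} (l : Lift T (Tm A)) where
    open Lift l hiding (var)

    infixl 8 _/_ _/Vec_ _/Alts_

    _/_     : ∀ {m n} → Tm A m → Sub T m n → Tm A n
    _/Vec_  : ∀ {m n k} → Vec (Tm A m) k → Sub T m n → Vec (Tm A n) k
    _/Alts_ : ∀ {m n as} → Alts A m as → Sub T m n → Alts A n as

    var a x           / ρ = lift (lookup ρ x)
    app a s t         / ρ = app a (s / ρ) (t / ρ)
    lam a s           / ρ = lam a (s / ρ ↑)
    letrec {k} a bs t / ρ = letrec a (bs /Vec (ρ ↑⋆ suc k)) (t / ρ ↑⋆ suc k)
    con a K c ss      / ρ = con a K c (ss /Vec ρ)
    seq a s t         / ρ = seq a (s / ρ) (t / ρ)
    case a K s alts   / ρ = case a K (s / ρ) (alts /Alts ρ)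

    []       /Vec ρ = []
    (s ∷ ss) /Vec ρ = s / ρ ∷ (ss /Vec ρ)

    []                    /Alts ρ = []
    (_∷_ {x = a} s alts)  /Alts ρ = s / ρ ↑⋆ a ∷ (alts /Alts ρ)

  -- Variables that are put in place by a renaming or substitution carry the
  -- annotation a₀.

  termSubst : {A : Set} → A → TermSubst (Tm A)
  termSubst a₀ = record { var = var a₀ ; app = Traversal._/_ }

  open VarSubst using (id; wk⋆; _↑⋆_; _⊙_)

  -- The renaming that moves a term from outside a context to its hole without
  -- capture.

  embed : ∀ ds {n} → Sub Fin n (ds ▷ n)
  embed []       = id
  embed (d ∷ ds) = wk⋆ d ⊙ embed ds

  infixl 10 _↑ᵈ_

  _↑ᵈ_ : ∀ {m n} → Sub Fin m n → ∀ ds → Sub Fin (ds ▷ m) (ds ▷ n)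
  ρ ↑ᵈ []       = ρ
  ρ ↑ᵈ (d ∷ ds) = (ρ ↑⋆ d) ↑ᵈ ds

  reassoc : ∀ k k′ n → Sub Fin (k + (k′ + n)) ((k + k′) + n)
  reassoc k k′ n = tabulate (cast (sym (+-assoc k k′ n)))

  -- Makes room for k more variables in a letrec that binds k′ variables.

  insert : ∀ k k′ n → Sub Fin (k′ + n) ((k + k′) + n)
  insert k k′ n = wk⋆ k ⊙ reassoc k k′ n

  -- The occurrence inside a context of the letrec-variable bound by entry x.

  occ : ∀ {A k n} → A → ∀ ds → Fin k → Tm A (ds ▷ (k + n))
  occ {n = n} a ds x = var a (lookup (embed ds) (x ↑ˡ n))

  -- Chain bs x₁ xₘ: the bindings bs contain a chain x₂ = x₁, …, xₘ = xₘ₋₁.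

  data Chain {A : Set} {k n : ℕ} (bs : Vec (Tm A (k + n)) k) (x₁ : Fin k) : Fin k → Set where
    []   : Chain bs x₁ x₁
    _∷ʳ_ : ∀ {x y a} → Chain bs x₁ x → lookup bs y ≡ var a (x ↑ˡ n) → Chain bs x₁ y

  module Name where
    open TermSubst (termSubst tt) using (_/_; _/Var_; sub; varLift) renaming (id to ids)
    open Traversal {⊤} varLift using (_/Alts_)

    data IsL : ∀ {ds n} → Ctx ⊤ ds n → Set where
      hole   : ∀ {n} → IsL (hole {n = n})
      letrec : ∀ {ds n k} {bs : Vec (Exp (suc k + n)) (suc k)} {L : Ctx ⊤ ds (suc k + n)} →
               IsL L → IsL (letrecᵇ tt bs L)

    -- A-contexts have no binder above the hole.

    data IsA : ∀ {n} → Ctx ⊤ [] n → Set where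
      hole : ∀ {n} → IsA (hole {n = n})
      app  : ∀ {n} {A : Ctx ⊤ [] n} {s} → IsA A → IsA (appˡ tt A s)
      case : ∀ {n K} {A : Ctx ⊤ [] n} {alts} → IsA A → IsA (caseˢ tt K A alts)
      seq  : ∀ {n} {A : Ctx ⊤ [] n} {s} → IsA A → IsA (seqˡ tt A s)

    -- A redex inside R = L[A] appears as plug L (plug A _).

    infix 4 _⟶_

    data _⟶_ {n : ℕ} : Exp n → Exp n → Set where
      beta  : ∀ {ds} {L : Ctx ⊤ ds n} {A : Ctx ⊤ [] (ds ▷ n)} → IsL L → IsA A → ∀ s t →
              plug L (plug A (app tt (lam tt s) t)) ⟶ plug L (plug A (s / sub t))
      gcp   : ∀ {ds ds′ k} {L : Ctx ⊤ ds n}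
              (bs : Vec (Exp (suc k + (ds ▷ n))) (suc k)) (x : Fin (suc k))
              {L′ : Ctx ⊤ ds′ (suc k + (ds ▷ n))} {A : Ctx ⊤ [] (ds′ ▷ (suc k + (ds ▷ n)))} →
              IsL L → IsL L′ → IsA A →
              plug L (letrec tt bs (plug L′ (plug A (occ tt ds′ x)))) ⟶
              plug L (letrec tt bs (plug L′ (plug A (lookup bs x /Var embed ds′))))
      lapp  : ∀ {ds k} {L : Ctx ⊤ ds n} {A : Ctx ⊤ [] (ds ▷ n)} → IsL L → IsA A →
              ∀ (bs : Vec _ (suc k)) s t →
              plug L (plug A (app tt (letrec tt bs s) t)) ⟶
              plug L (plug A (letrec tt bs (app tt s (t /Var wk⋆ (suc k)))))
      lcase : ∀ {ds k K} {L : Ctx ⊤ ds n} {A : Ctx ⊤ [] (ds ▷ n)} → IsL L → IsA A →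
              ∀ (bs : Vec _ (suc k)) s alts →
              plug L (plug A (case tt K (letrec tt bs s) alts)) ⟶
              plug L (plug A (letrec tt bs (case tt K s (alts /Alts wk⋆ (suc k)))))
      lseq  : ∀ {ds k} {L : Ctx ⊤ ds n} {A : Ctx ⊤ [] (ds ▷ n)} → IsL L → IsA A →
              ∀ (bs : Vec _ (suc k)) s t →
              plug L (plug A (seq tt (letrec tt bs s) t)) ⟶
              plug L (plug A (letrec tt bs (seq tt s (t /Var wk⋆ (suc k)))))
      seq   : ∀ {ds} {L : Ctx ⊤ ds n} {A : Ctx ⊤ [] (ds ▷ n)} → IsL L → IsA A →
              ∀ {v} → Value v → ∀ s →
              plug L (plug A (seq tt v s)) ⟶ plug L (plug A s)
      case  : ∀ {ds K a} {L : Ctx ⊤ ds n} {A : Ctx ⊤ [] (ds ▷ n)} → IsL L → IsA A →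
              ∀ (c : a ∈ arities K) ss alts →
              plug L (plug A (case tt K (con tt K c ss) alts)) ⟶
              plug L (plug A (All.lookup alts c / (ss ++ ids)))

    data Answer {n : ℕ} : Exp n → Set where
      answer : ∀ {ds} {L : Ctx ⊤ ds n} {v} → IsL L → Value v → Answer (plug L v)

  module Need where

    -- ∅ means that a node is not labelled.  A new label replaces the old one.
    -- Labels that the rules below leave unconstrained (a, the labels inside
    -- contexts, …) may be anything.

    data Label : Set where
      ∅ S T V W : Label

    LTm : ℕ → Set
    LTm = Tm Label

    LCtx : List ℕ → ℕ → Set
    LCtx = Ctx Label

    label : ∀ {n} → LTm n → Label
    label (var a x)       = a
    label (app a s t)     = a
    label (lam a s)       = a
    label (letrec a bs t) = a
    label (con a K c ss)  = a
    label (seq a s t)     = a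
    label (case a K s alts) = a

    infixl 9 _^_

    _^_ : ∀ {n} → LTm n → Label → LTm n
    var a x         ^ l = var l x
    app a s t       ^ l = app l s t
    lam a s         ^ l = lam l s
    letrec a bs t   ^ l = letrec l bs t
    con a K c ss    ^ l = con l K c ss
    seq a s t       ^ l = seq l s t
    case a K s alts ^ l = case l K s alts

    start : ∀ {n} → Exp n → LTm n
    start s = relabel (λ _ → ∅) s ^ T

    forget : ∀ {n} → LTm n → Exp n
    forget = relabel (λ _ → tt)

    data S∨T : Label → Set where
      isS : S∨T S
      isT : S∨T T

    data V∨W : Label → Set where
      isV : V∨W V
      isW : V∨W W

    data IsHole : ∀ {ds n} → LCtx ds n → Set where
      isHole : ∀ {n} → IsHole (hole {n = n})

    infix 4 _⇝₀_ _⇝_ _⇝*_ _↦_ _⟶_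

    data _⇝₀_ {n : ℕ} : LTm n → LTm n → Set where
      letrec : ∀ {k} (bs : Vec _ (suc k)) s → letrec T bs s ⇝₀ letrec V bs (s ^ S)
      app    : ∀ {a} → S∨T a → ∀ s t → app a s t ⇝₀ app V (s ^ S) t
      seq    : ∀ {a} → S∨T a → ∀ s t → seq a s t ⇝₀ seq V (s ^ S) t
      case   : ∀ {a K} → S∨T a → ∀ s alts → case a K s alts ⇝₀ case V K (s ^ S) alts
      body   : ∀ {a k ds} (bs : Vec _ (suc k)) (x : Fin (suc k)) (C : LCtx ds (suc k + n)) →
               letrec a bs (plug C (occ S ds x)) ⇝₀
               letrec a (bs [ x ]%= (_^ S)) (plug C (occ V ds x))
      bind   : ∀ {a k ds} (bs : Vec _ (suc k)) (x y : Fin (suc k)) (C : LCtx ds (suc k + n)) t →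
               x ≢ y → ¬ IsHole C → lookup bs y ≡ plug C (occ S ds x) →
               letrec a bs t ⇝₀
               letrec a (bs [ y ]≔ plug C (occ V ds x) [ x ]%= (_^ S)) t
      alias  : ∀ {a k} (bs : Vec _ (suc k)) (x y : Fin (suc k)) t →
               x ≢ y → lookup bs y ≡ var S (x ↑ˡ n) →
               letrec a bs t ⇝₀
               letrec a (bs [ y ]≔ var W (x ↑ˡ n) [ x ]%= (_^ S)) t

    data Fails₀ {n : ℕ} : LTm n → Set where
      visited : ∀ {a k ds} (bs : Vec _ (suc k)) (x y : Fin (suc k)) (C : LCtx ds (suc k + n)) t →
                x ≢ y → V∨W (label (lookup bs x)) → lookup bs y ≡ plug C (occ S ds x) →
                Fails₀ (letrec a bs t)
      self    : ∀ {a k ds} (bs : Vec _ (suc k)) (x : Fin (suc k)) (C : LCtx ds (suc k + n)) t →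
                lookup bs x ≡ plug C (occ S ds x) →
                Fails₀ (letrec a bs t)

    data Fails {n : ℕ} : LTm n → Set where
      at : ∀ {ds} (C : LCtx ds n) {s} → Fails₀ s → Fails (plug C s)

    -- The fail rules take precedence.

    data _⇝_ {n : ℕ} : LTm n → LTm n → Set where
      at : ∀ {ds} (C : LCtx ds n) {s s′} → s ⇝₀ s′ → ¬ Fails (plug C s) → plug C s ⇝ plug C s′

    _⇝*_ : ∀ {n} → LTm n → LTm n → Set
    _⇝*_ = Star _⇝_

    Labelling : ∀ {n} → Exp n → LTm n → Set
    Labelling s l = start s ⇝* l × ¬ Fails l × (∀ l′ → ¬ (l ⇝ l′))

    open TermSubst (termSubst ∅) using (_/Var_; varLift)
    open Traversal {Label} varLift using (_/Vec_; _/Alts_)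

    infixl 8 _/Ctx_ _/CtxVec_ _/CtxAlts_

    _/Ctx_     : ∀ {ds m n} → LCtx ds m → Sub Fin m n → LCtx ds n
    _/CtxVec_  : ∀ {ds m n k} → CtxVec Label ds m k → Sub Fin m n → CtxVec Label ds n k
    _/CtxAlts_ : ∀ {ds m n as} → CtxAlts Label ds m as → Sub Fin m n → CtxAlts Label ds n as

    hole                   /Ctx ρ = hole
    appˡ a C t             /Ctx ρ = appˡ a (C /Ctx ρ) (t /Var ρ)
    appʳ a s C             /Ctx ρ = appʳ a (s /Var ρ) (C /Ctx ρ)
    lam a C                /Ctx ρ = lam a (C /Ctx (ρ ↑⋆ 1))
    letrecᵉ {k = k} a E t  /Ctx ρ = letrecᵉ a (E /CtxVec (ρ ↑⋆ suc k)) (t /Var (ρ ↑⋆ suc k))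
    letrecᵇ {k = k} a bs C /Ctx ρ = letrecᵇ a (bs /Vec (ρ ↑⋆ suc k)) (C /Ctx (ρ ↑⋆ suc k))
    con a K c E            /Ctx ρ = con a K c (E /CtxVec ρ)
    seqˡ a C t             /Ctx ρ = seqˡ a (C /Ctx ρ) (t /Var ρ)
    seqʳ a s C             /Ctx ρ = seqʳ a (s /Var ρ) (C /Ctx ρ)
    caseˢ a K C alts       /Ctx ρ = caseˢ a K (C /Ctx ρ) (alts /Alts ρ)
    caseᵃ a K s E          /Ctx ρ = caseᵃ a K (s /Var ρ) (E /CtxAlts ρ)

    here C ss  /CtxVec ρ = here (C /Ctx ρ) (ss /Vec ρ)
    there s E  /CtxVec ρ = there (s /Var ρ) (E /CtxVec ρ)

    here {a = a} C alts /CtxAlts ρ = here (C /Ctx (ρ ↑⋆ a)) (alts /Alts ρ)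
    there {a = a} s E   /CtxAlts ρ = there (s /Var (ρ ↑⋆ a)) (E /CtxAlts ρ)

    -- The labels of the right-hand sides are irrelevant: they are dropped in
    -- _⟶_.  In case-in and case-e (k ≥ 1) the fresh variables y₁,…,yₖ become
    -- the first k variables of the outer letrec; everything under its binders
    -- is renamed along insert.

    ys : ∀ k {k′ n} → Vec (LTm ((k + k′) + n)) k
    ys k {k′} {n} = tabulate (λ i → var ∅ ((i ↑ˡ k′) ↑ˡ n))

    -- letrec z₁ = y₁, …, zₖ = yₖ in t, inside a context below the outer letrec.

    rebind : ∀ b k′ n ds → LTm (suc b + (ds ▷ (k′ + n))) → LTm (ds ▷ ((suc b + k′) + n))
    rebind b k′ n ds t =
      letrec ∅ (ys (suc b) /Vec (embed ds ⊙ wk⋆ (suc b)))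
               (t /Var (insert (suc b) k′ n ↑ᵈ ds ↑⋆ suc b))

    -- Env, x₁ = c s₁ … sₖ  becomes  y₁ = s₁, …, yₖ = sₖ, Env, x₁ = c y₁ … yₖ.

    split : ∀ {b k′ n K} → suc b ∈ arities K → Fin k′ → Vec (LTm (k′ + n)) (suc b) →
            Vec (LTm (k′ + n)) k′ → Vec (LTm ((suc b + k′) + n)) (suc b + k′)
    split {b} {k′} {n} {K} c x₁ ss bs =
      (ss /Vec insert (suc b) k′ n) ++
      ((bs /Vec insert (suc b) k′ n) [ x₁ ]≔ con ∅ K c (ys (suc b)))

    data _↦_ {n : ℕ} : LTm n → LTm n → Set where
      lbeta   : ∀ {ds} (C : LCtx ds n) {a} s t →
                plug C (app a (lam S s) t) ↦ plug C (letrec ∅ (t /Var wk⋆ 1 ∷ []) s)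

      cp-in   : ∀ {a k ds} (bs : Vec _ (suc k)) {x₁ xₘ : Fin (suc k)} (C : LCtx ds (suc k + n)) {s} →
                lookup bs x₁ ≡ lam S s → Chain bs x₁ xₘ →
                letrec a bs (plug C (occ V ds xₘ)) ↦
                letrec a bs (plug C (lam ∅ s /Var embed ds))
      cp-e    : ∀ {a k ds} (bs : Vec _ (suc k)) {x₁ xₘ y : Fin (suc k)} (C : LCtx ds (suc k + n)) {s} t →
                lookup bs x₁ ≡ lam S s → Chain bs x₁ xₘ →
                y ≢ x₁ → lookup bs y ≡ plug C (occ V ds xₘ) →
                letrec a bs t ↦
                letrec a (bs [ y ]≔ plug C (lam ∅ s /Var embed ds)) t

      lapp    : ∀ {ds} (C : LCtx ds n) {a k} (bs : Vec _ (suc k)) s t →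
                plug C (app a (letrec S bs s) t) ↦
                plug C (letrec ∅ bs (app ∅ s (t /Var wk⋆ (suc k))))
      lcase   : ∀ {ds} (C : LCtx ds n) {a k K} (bs : Vec _ (suc k)) s alts →
                plug C (case a K (letrec S bs s) alts) ↦
                plug C (letrec ∅ bs (case ∅ K s (alts /Alts wk⋆ (suc k))))
      lseq    : ∀ {ds} (C : LCtx ds n) {a k} (bs : Vec _ (suc k)) s t →
                plug C (seq a (letrec S bs s) t) ↦
                plug C (letrec ∅ bs (seq ∅ s (t /Var wk⋆ (suc k))))

      llet-in : ∀ {a k₁ k₂} (bs₁ : Vec _ (suc k₁)) (bs₂ : Vec _ (suc k₂)) s →
                letrec a bs₁ (letrec S bs₂ s) ↦
                letrec ∅ ((bs₂ /Vec reassoc (suc k₂) (suc k₁) n) ++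
                          (bs₁ /Vec insert (suc k₂) (suc k₁) n))
                         (s /Var reassoc (suc k₂) (suc k₁) n)
      llet-e  : ∀ {a k₁ k₂} (bs₁ : Vec _ (suc k₁)) (x : Fin (suc k₁)) (bs₂ : Vec _ (suc k₂)) s t →
                lookup bs₁ x ≡ letrec S bs₂ s →
                letrec a bs₁ t ↦
                letrec ∅ ((bs₂ /Vec reassoc (suc k₂) (suc k₁) n) ++
                          ((bs₁ /Vec insert (suc k₂) (suc k₁) n)
                             [ x ]≔ (s /Var reassoc (suc k₂) (suc k₁) n)))
                         (t /Var insert (suc k₂) (suc k₁) n)

      seq-c   : ∀ {ds} (C : LCtx ds n) {a v} s → Value v → label v ≡ S →
                plug C (seq a v s) ↦ plug C s
      seq-in  : ∀ {a k ds} (bs : Vec _ (suc k)) {x₁ xₘ : Fin (suc k)} (C : LCtx ds (suc k + n))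
                {a′ ar K} {c : ar ∈ arities K} {ss} s →
                lookup bs x₁ ≡ con S K c ss → Chain bs x₁ xₘ →
                letrec a bs (plug C (seq a′ (occ V ds xₘ) s)) ↦
                letrec a bs (plug C s)
      seq-e   : ∀ {a k ds} (bs : Vec _ (suc k)) {x₁ xₘ y : Fin (suc k)} (C : LCtx ds (suc k + n))
                {a′ ar K} {c : ar ∈ arities K} {ss} s t →
                lookup bs x₁ ≡ con S K c ss → Chain bs x₁ xₘ →
                y ≢ x₁ → lookup bs y ≡ plug C (seq a′ (occ V ds xₘ) s) →
                letrec a bs t ↦ letrec a (bs [ y ]≔ plug C s) t

      case-c₀  : ∀ {ds} (C : LCtx ds n) {a K} (c : 0 ∈ arities K) alts →
                 plug C (case a K (con S K c []) alts) ↦ plug C (All.lookup alts c)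
      case-c   : ∀ {ds} (C : LCtx ds n) {a b K} (c : suc b ∈ arities K) ss alts →
                 plug C (case a K (con S K c ss) alts) ↦
                 plug C (letrec ∅ (ss /Vec wk⋆ (suc b)) (All.lookup alts c))
      case-in₀ : ∀ {a k ds} (bs : Vec _ (suc k)) {x₁ xₘ : Fin (suc k)} (C : LCtx ds (suc k + n))
                 {a′ K} (c : 0 ∈ arities K) alts →
                 lookup bs x₁ ≡ con S K c [] → Chain bs x₁ xₘ →
                 letrec a bs (plug C (case a′ K (occ V ds xₘ) alts)) ↦
                 letrec a bs (plug C (All.lookup alts c))
      case-in  : ∀ {a k ds} (bs : Vec _ (suc k)) {x₁ xₘ : Fin (suc k)} (C : LCtx ds (suc k + n))
                 {a′ b K} (c : suc b ∈ arities K) ss alts →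
                 lookup bs x₁ ≡ con S K c ss → Chain bs x₁ xₘ →
                 letrec a bs (plug C (case a′ K (occ V ds xₘ) alts)) ↦
                 letrec ∅ (split c x₁ ss bs)
                          (plug (C /Ctx insert (suc b) (suc k) n)
                                (rebind b (suc k) n ds (All.lookup alts c)))
      case-e₀  : ∀ {a k ds} (bs : Vec _ (suc k)) {x₁ xₘ u : Fin (suc k)} (C : LCtx ds (suc k + n))
                 {a′ K} (c : 0 ∈ arities K) alts r →
                 lookup bs x₁ ≡ con S K c [] → Chain bs x₁ xₘ →
                 u ≢ x₁ → lookup bs u ≡ plug C (case a′ K (occ V ds xₘ) alts) →
                 letrec a bs r ↦ letrec a (bs [ u ]≔ plug C (All.lookup alts c)) r
      case-e   : ∀ {a k ds} (bs : Vec _ (suc k)) {x₁ xₘ u : Fin (suc k)} (C : LCtx ds (suc k + n))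
                 {a′ b K} (c : suc b ∈ arities K) ss alts r →
                 lookup bs x₁ ≡ con S K c ss → Chain bs x₁ xₘ →
                 u ≢ x₁ → lookup bs u ≡ plug C (case a′ K (occ V ds xₘ) alts) →
                 letrec a bs r ↦
                 letrec ∅ (split c x₁ ss bs [ suc b ↑ʳ u ]≔
                             plug (C /Ctx insert (suc b) (suc k) n)
                                  (rebind b (suc k) n ds (All.lookup alts c)))
                          (r /Var insert (suc b) (suc k) n)

    data _⟶_ {n : ℕ} : Exp n → Exp n → Set where
      step : ∀ {s l l′} → Labelling s l → l ↦ l′ → s ⟶ forget l′

    data Answer {n : ℕ} : Exp n → Set where
      value        : ∀ {v} → Value v → Answer v
      letrec-value : ∀ {k v} (bs : Vec _ (suc k)) → Value v → Answer (letrec tt bs v)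
      letrec-con   : ∀ {k a K} (bs : Vec _ (suc k)) {x₁ xₘ : Fin (suc k)} {c : a ∈ arities K} {ss} →
                     lookup bs x₁ ≡ con tt K c ss → Chain bs x₁ xₘ →
                     Answer (letrec tt bs (var tt (xₘ ↑ˡ n)))

  module Preorder (_⟶_ : ∀ {n} → Exp n → Exp n → Set) (Answer : ∀ {n} → Exp n → Set) where
    open TermSubst (termSubst tt) using (_/Var_)

    _↓ : ∀ {n} → Exp n → Set
    s ↓ = ∃ λ v → Star _⟶_ s v × Answer v

    -- A context with named variables may bind any of the free variables of s
    -- and t, in any order, next to others.  Here this is an injective map ρ
    -- from the variables of s and t to the variables in scope at the hole.

    _≤_ : ∀ {m} → Exp m → Exp m → Set
    _≤_ {m} s t = ∀ {ds n} (C : Ctx ⊤ ds n) (ρ : Sub Fin m (ds ▷ n)) →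
                  Injective _≡_ _≡_ (lookup ρ) →
                  plug C (s /Var ρ) ↓ → plug C (t /Var ρ) ↓

  infix 4 _≤name_ _≤LR_

  _≤name_ : ∀ {m} → Exp m → Exp m → Set
  _≤name_ = Preorder._≤_ Name._⟶_ Name.Answer

  _≤LR_ : ∀ {m} → Exp m → Exp m → Set
  _≤LR_ = Preorder._≤_ Need._⟶_ Need.Answer

module Submission where

-- Both calculi are compared with one denotational model.  A term denotes the set
-- of its finite tokens (idempotent intersection types), where a function token
-- lists the tokens that the argument must have, and letrec is interpreted by
-- Kleene iteration.  Undoing a step of either calculus, wherever it takes place,
-- loses no token, and answers have tokens; so a convergent term has a token.
-- Conversely, let tokens carry costs.  A logical relation shows that having a
-- token does not depend on how the costs are charged, and for suitable charges a
-- term with a token is an answer or has a step that strictly lowers the cost; so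
-- a term with a token converges.  For call-by-need this step is the one that the
-- labelling finds: it follows the demand from the body through the bindings.

open import Defs
open import Data.Empty using (⊥; ⊥-elim)
open import Data.Fin.Base using (Fin; zero; suc; _↑ˡ_; _↑ʳ_; cast; toℕ)
import Data.Fin.Properties as Finₚ
open import Data.Fin.Substitution using (Sub; Lift; TermSubst; module VarSubst)
open import Data.List.Base as List using (List; []; _∷_)
open import Data.List.Membership.Propositional using (_∈_)
open import Data.List.Membership.Propositional.Properties using (∈-++⁺ˡ; ∈-++⁺ʳ; ∈-++⁻)
open import Data.List.Relation.Unary.All as All using (All; []; _∷_)
open import Data.List.Relation.Unary.Any using (here; there)
open import Data.Nat.Base hiding (_/_; _^_)
open import Data.Nat.Induction using (<-rec)
open import Data.Nat.Properties
open import Data.Nat.Tactic.RingSolver using (solve-∀)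
open import Data.Product.Base using (Σ; ∃; ∃₂; _×_; _,_; proj₁; proj₂)
open import Data.Sum.Base using (_⊎_; inj₁; inj₂; [_,_]′)
open import Data.Unit.Base using (⊤; tt)
open import Data.Vec.Base as Vec using (Vec; []; _∷_; _++_; lookup; map; tabulate; _[_]≔_; _[_]%=_)
open import Data.Vec.Properties as Vecₚ using (lookup-map; lookup∘tabulate; lookup∘updateAt; lookup∘updateAt′)
open import Function.Base using (_∘_)
open import Function.Bundles using (_⇔_; mk⇔)
open import Level as Level using ()
open import Relation.Binary.Construct.Closure.ReflexiveTransitive as Star using (Star; _◅_; _◅◅_)
open import Relation.Binary.PropositionalEquality
open import Relation.Nullary using (¬_; yes; no; contradiction)

-- The cost of an argument is recorded in the list that the function token carries and is paid at
-- every use of the variable, as in call-by-name. The same measure serves call-by-need, where a step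
-- in a shared binding lowers the cost at all the places that demand it; so idempotent tokens
-- suffice. Two requirements pull apart. Undoing a step should keep every token in every position,
-- but with positive charges it raises costs, and a token that records the lower cost may be lost.
-- Termination, on the other hand, needs positive charges. Hence soundness is shown with all charges
-- zero. As costs occur inside tokens, the models do not have the same tokens, and only a logical
-- relation can carry inhabitation from one to another. Having a token also rules out stuck terms:
-- free variables have none, nor has an applied constructor or an ill-typed case. The obstacle in
-- call-by-need is that the step may take place in a binding far from the body. Its saving has to be
-- carried through a least fixed point, along the head variables that lead from the body to that
-- binding.

module Proof (𝕊 : Signature) where

  open Signature 𝕊
  open Calculus 𝕊
  open VarSubst using (wk⋆; _↑⋆_; _⊙_) renaming (id to idᵛ)

  -- Tokens and denotations

  -- fun U τ m is the token of a function whose result has token τ at cost m if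
  -- its argument has every token of U at the cost recorded there; every
  -- abstraction has lam⋆.

  data Ty : Set where
    lam⋆ : Ty
    fun  : List (Ty × ℕ) → Ty → ℕ → Ty
    con  : ∀ {a} K → a ∈ arities K → (Fin a → List (Ty × ℕ)) → Ty

  Pred : Set₁
  Pred = Ty → ℕ → Set

  Env : ℕ → Set₁
  Env n = Fin n → Pred

  infix 4 _⊆_ _≪_ _⊆ᵉ_

  _⊆_ : Pred → Pred → Set
  d ⊆ e = ∀ τ n → d τ n → e τ n

  _≪_ : Pred → Pred → Set
  d ≪ e = ∀ τ n → d τ n → ∃ λ n′ → n′ < n × e τ n′

  _⊆ᵉ_ : ∀ {k} → (Fin k → Pred) → (Fin k → Pred) → Set
  δ ⊆ᵉ ε = ∀ i → δ i ⊆ ε i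

  -- Besides starting the Kleene iteration, this is the environment in which whole programs are
  -- read: a free variable has no token, so a term that demands one has none either.
  ∅ᵉ : ∀ {k} → Fin k → Pred
  ∅ᵉ _ _ _ = ⊥

  ⟪_⟫ : List (Ty × ℕ) → Pred
  ⟪ U ⟫ τ n = (τ , n) ∈ U

  ⊆-refl : ∀ {d} → d ⊆ d
  ⊆-refl _ _ x = x

  ⊆-trans : ∀ {d e f} → d ⊆ e → e ⊆ f → d ⊆ f
  ⊆-trans p q τ n x = q τ n (p τ n x)

  ⊆-reflexive : ∀ {d e} → d ≡ e → d ⊆ e
  ⊆-reflexive refl = ⊆-refl

  ⊆ᵉ-refl : ∀ {k} {δ : Fin k → Pred} → δ ⊆ᵉ δ
  ⊆ᵉ-refl _ = ⊆-refl

  ⊆ᵉ-trans : ∀ {k} {δ ε ζ : Fin k → Pred} → δ ⊆ᵉ ε → ε ⊆ᵉ ζ → δ ⊆ᵉ ζ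
  ⊆ᵉ-trans p q i = ⊆-trans (p i) (q i)

  infixr 5 _⧺_ _▸_

  _⧺_ : ∀ {k n} → (Fin k → Pred) → Env n → Env (k + n)
  _⧺_ {zero}  δ ρ x       = ρ x
  _⧺_ {suc k} δ ρ zero    = δ zero
  _⧺_ {suc k} δ ρ (suc x) = ((δ ∘ suc) ⧺ ρ) x

  _▸_ : ∀ {n} → Pred → Env n → Env (suc n)
  d ▸ ρ = (λ (_ : Fin 1) → d) ⧺ ρ

  ⧺-mono : ∀ {k n} {δ ε : Fin k → Pred} {ρ σ : Env n} → δ ⊆ᵉ ε → ρ ⊆ᵉ σ → δ ⧺ ρ ⊆ᵉ ε ⧺ σ
  ⧺-mono {zero}  p q x       = q x
  ⧺-mono {suc k} p q zero    = p zero
  ⧺-mono {suc k} p q (suc x) = ⧺-mono (p ∘ suc) q x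

  ⧺-↑ˡ : ∀ {k n} (δ : Fin k → Pred) (ρ : Env n) i → (δ ⧺ ρ) (i ↑ˡ n) ≡ δ i
  ⧺-↑ˡ δ ρ zero    = refl
  ⧺-↑ˡ δ ρ (suc i) = ⧺-↑ˡ (δ ∘ suc) ρ i

  ⧺-↑ʳ : ∀ k {n} (δ : Fin k → Pred) (ρ : Env n) x → (δ ⧺ ρ) (k ↑ʳ x) ≡ ρ x
  ⧺-↑ʳ zero    δ ρ x = refl
  ⧺-↑ʳ (suc k) δ ρ x = ⧺-↑ʳ k (δ ∘ suc) ρ x

  -- The join `_∨_` is explicit, so that finitely many members can be merged constructively. The
  -- families of interest are the Kleene stages, the finite approximations of an environment, and
  -- what these induce under binders.
  record Directed (n : ℕ) : Set₁ where
    field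
      Ix    : Set
      base  : Ix
      _∨_   : Ix → Ix → Ix
      env   : Ix → Env n
      left  : ∀ i j → env i ⊆ᵉ env (i ∨ j)
      right : ∀ i j → env j ⊆ᵉ env (i ∨ j)

    ⋃ : Env n
    ⋃ x τ m = ∃ λ i → env i x τ m

  -- A finite list meets only finitely many members of the family; joining them gives one member
  -- that has all of its tokens.
  listJoin : ∀ {I : Set} (_∨_ : I → I → I) (P : I → Pred) → I →
             (∀ i j → P i ⊆ P (i ∨ j)) → (∀ i j → P j ⊆ P (i ∨ j)) →
             ∀ U → (∀ τ n → (τ , n) ∈ U → ∃ λ i → P i τ n) → ∃ λ i → ⟪ U ⟫ ⊆ P i
  listJoin _∨_ P b l r []       h = b , λ _ _ ()
  listJoin _∨_ P b l r ((τ , n) ∷ U) h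
    with h τ n (here refl) | listJoin _∨_ P b l r U (λ τ n x → h τ n (there x))
  ... | i , p | j , q = i ∨ j , λ where
    _ _ (here refl) → l i j τ n p
    τ n (there x)   → r i j τ n (q τ n x)

  finJoin : ∀ {I : Set} (_∨_ : I → I → I) {a} (P : Fin a → I → Set) → I →
             (∀ x i j → P x i → P x (i ∨ j)) → (∀ x i j → P x j → P x (i ∨ j)) →
             (∀ x → ∃ (P x)) → ∃ λ i → ∀ x → P x i
  finJoin _∨_ {zero}  P b l r h = b , λ ()
  finJoin _∨_ {suc a} P b l r h
    with h zero | finJoin _∨_ (P ∘ suc) b (l ∘ suc) (r ∘ suc) (h ∘ suc)
  ... | i , p | j , q = i ∨ j , λ where
    zero    → l zero i j p
    (suc x) → r (suc x) i j (q x)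

  -- ι is the charge for a language construct, v the extra charge for a variable.
  -- With ι = v = 0 costs are immaterial, so that undoing a step loses no token.
  -- Call-by-name steps get strictly cheaper for ι = v = 1; call-by-need requires
  -- v = 0, as (case-in) and (case-e) insert indirections.

  module Model (ι v : ℕ) where

    -- What a strict position pays is 2 c + weight s: the factor 2 makes (lapp),
    -- (lcase) and (lseq) decrease, the weight makes (cp) decrease, which leaves
    -- the denotation of the copied-to position unchanged.

    weight : ∀ {A n} → Tm A n → ℕ
    weight (lam _ _)     = 0
    weight (con _ _ _ _) = 0
    weight _             = ι

    weight≤ι : ∀ {A n} (s : Tm A n) → weight s ≤ ι
    weight≤ι (var _ _)      = ≤-refl
    weight≤ι (app _ _ _)    = ≤-refl
    weight≤ι (lam _ _)      = z≤n
    weight≤ι (letrec _ _ _) = ≤-refl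
    weight≤ι (con _ _ _ _)  = z≤n
    weight≤ι (seq _ _ _)    = ≤-refl
    weight≤ι (case _ _ _ _) = ≤-refl

    cost : ∀ {A n} → Tm A n → ℕ → ℕ → ℕ
    cost s c m = c + c + m + (weight s + (ι + ι))

    kleene : ∀ {k} → ((Fin k → Pred) → (Fin k → Pred)) → ℕ → Fin k → Pred
    kleene F zero    = ∅ᵉ
    kleene F (suc N) = F (kleene F N)

    fix : ∀ {k} → ((Fin k → Pred) → (Fin k → Pred)) → Fin k → Pred
    fix F i τ n = ∃ λ N → kleene F N i τ n

    -- An abstraction itself costs nothing: the cost `m` of running its body is part of the token
    -- and is paid by the application that uses it.
    lamSem : (List (Ty × ℕ) → Pred) → Pred
    lamSem f lam⋆        n = ⊤
    lamSem f (fun U τ m) n = f U τ m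
    lamSem f (con _ _ _) n = ⊥

    -- ⟦ s ⟧ ρ τ n: in environment ρ, s has token τ at cost at most n.

    ⟦_⟧  : ∀ {A n} → Tm A n → Env n → Pred
    ⟦_⟧ᵛ : ∀ {A n k} → Vec (Tm A n) k → Env n → Fin k → Pred
    ⟦_⟧ᵃ : ∀ {A n as} → Alts A n as → Env n → ∀ {a} → a ∈ as → (Fin a → Pred) → Pred

    ⟦ var a x ⟧       ρ τ n = ∃ λ m → ρ x τ m × v + m ≤ n
    ⟦ app a s t ⟧     ρ τ n = ∃ λ U → ∃ λ m → ∃ λ c →
      ⟦ s ⟧ ρ (fun U τ m) c × ⟪ U ⟫ ⊆ ⟦ t ⟧ ρ × cost s c m ≤ n
    ⟦ lam a s ⟧       ρ = lamSem (λ U → ⟦ s ⟧ (⟪ U ⟫ ▸ ρ))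
    ⟦ letrec a bs t ⟧ ρ τ n = ∃ λ m → ⟦ t ⟧ (fix (λ δ → ⟦ bs ⟧ᵛ (δ ⧺ ρ)) ⧺ ρ) τ m × ι + m ≤ n
    ⟦ con a K c ss ⟧  ρ τ n = ∃ λ Us → τ ≡ con K c Us × (∀ i → ⟪ Us i ⟫ ⊆ ⟦ ss ⟧ᵛ ρ i)
    ⟦ seq a s t ⟧     ρ τ n = ∃ λ σ → ∃ λ m → ∃ λ c → ⟦ s ⟧ ρ σ c × ⟦ t ⟧ ρ τ m × cost s c m ≤ n
    ⟦ case a K s alts ⟧ ρ τ n = ∃ λ b → ∃ λ (e : b ∈ arities K) → ∃ λ Us → ∃ λ m → ∃ λ c →
      ⟦ s ⟧ ρ (con K e Us) c × ⟦ alts ⟧ᵃ ρ e (λ i → ⟪ Us i ⟫) τ m × cost s c m ≤ n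

    ⟦ s ∷ ss ⟧ᵛ ρ zero    = ⟦ s ⟧ ρ
    ⟦ s ∷ ss ⟧ᵛ ρ (suc i) = ⟦ ss ⟧ᵛ ρ i

    ⟦ s ∷ alts ⟧ᵃ ρ (here refl) δ = ⟦ s ⟧ (δ ⧺ ρ)
    ⟦ s ∷ alts ⟧ᵃ ρ (there e)   δ = ⟦ alts ⟧ᵃ ρ e δ

    up : ∀ {A n} (s : Tm A n) {ρ τ m m′} → m ≤ m′ → ⟦ s ⟧ ρ τ m → ⟦ s ⟧ ρ τ m′
    up (var a x)       l (m , p , q) = m , p , ≤-trans q l
    up (app a s t)     l (U , m , c , p , q , r) = U , m , c , p , q , ≤-trans r l
    up (lam a s) {τ = lam⋆}      l p = tt
    up (lam a s) {τ = fun U τ m} l p = p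
    up (letrec a bs t) l (m , p , q) = m , p , ≤-trans q l
    up (con a K c ss)  l p = p
    up (seq a s t)     l (σ , m , c , p , q , r) = σ , m , c , p , q , ≤-trans r l
    up (case a K s alts) l (b , e , Us , m , c , p , q , r) = b , e , Us , m , c , p , q , ≤-trans r l

    ⟦⟧ᵛ-lookup : ∀ {A n k} (bs : Vec (Tm A n) k) ρ i → ⟦ bs ⟧ᵛ ρ i ≡ ⟦ lookup bs i ⟧ ρ
    ⟦⟧ᵛ-lookup (s ∷ bs) ρ zero    = refl
    ⟦⟧ᵛ-lookup (s ∷ bs) ρ (suc i) = ⟦⟧ᵛ-lookup bs ρ i

    ⟦⟧ᵃ-lookup : ∀ {A n as a} (alts : Alts A n as) ρ (e : a ∈ as) δ →
                 ⟦ alts ⟧ᵃ ρ e δ ≡ ⟦ All.lookup alts e ⟧ (δ ⧺ ρ)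
    ⟦⟧ᵃ-lookup (s ∷ alts) ρ (here refl) δ = refl
    ⟦⟧ᵃ-lookup (s ∷ alts) ρ (there e)   δ = ⟦⟧ᵃ-lookup alts ρ e δ

    kleene-least : ∀ {k} (F : (Fin k → Pred) → (Fin k → Pred)) →
                   (∀ {δ ε} → δ ⊆ᵉ ε → F δ ⊆ᵉ F ε) →
                   ∀ {δ} → F δ ⊆ᵉ δ → ∀ N → kleene F N ⊆ᵉ δ
    kleene-least F mono p zero    i τ n ()
    kleene-least F mono p (suc N) = ⊆ᵉ-trans (mono (kleene-least F mono p N)) p

    kleene-sim : ∀ {k} (F G : (Fin k → Pred) → (Fin k → Pred)) →
                 (∀ {δ ε} → δ ⊆ᵉ ε → F δ ⊆ᵉ G ε) → ∀ N → kleene F N ⊆ᵉ kleene G N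
    kleene-sim F G h zero    i τ n ()
    kleene-sim F G h (suc N) = h (kleene-sim F G h N)

    fix-sim : ∀ {k} (F G : (Fin k → Pred) → (Fin k → Pred)) →
              (∀ {δ ε} → δ ⊆ᵉ ε → F δ ⊆ᵉ G ε) → fix F ⊆ᵉ fix G
    fix-sim F G h i τ n (N , p) = N , kleene-sim F G h N i τ n p

    infix 4 _∣_⊑_∣_

    -- Inclusion of denotations alone is not a congruence, since a strict position also charges the
    -- weight of its term, which depends on the syntactic form. The two terms may differ in scope
    -- and annotations, so that relabelling, renaming and substitution are covered.
    record _∣_⊑_∣_ {A B m n} (s : Tm A m) (ρ : Env m) (s′ : Tm B n) (ρ′ : Env n) : Set where
      constructor ⟨_,_⟩
      field
        wt  : weight s′ ≤ weight s
        sem : ⟦ s ⟧ ρ ⊆ ⟦ s′ ⟧ ρ′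

    open _∣_⊑_∣_ public

    ⊑-trans : ∀ {A B C l m n} {s : Tm A l} {t : Tm B m} {u : Tm C n} {ρ σ κ} →
              s ∣ ρ ⊑ t ∣ σ → t ∣ σ ⊑ u ∣ κ → s ∣ ρ ⊑ u ∣ κ
    ⊑-trans p q = ⟨ ≤-trans (wt q) (wt p) , ⊆-trans (sem p) (sem q) ⟩

    cost-mono : ∀ {A B m n} {s : Tm A m} {s′ : Tm B n} → weight s′ ≤ weight s → ∀ c k → cost s′ c k ≤ cost s c k
    cost-mono p c k = +-monoʳ-≤ (c + c + k) (+-monoˡ-≤ (ι + ι) p)

    var-⊑ : ∀ {A B m n} {ρ : Env m} {ρ′ : Env n} {x x′} {a : A} {b : B} → ρ x ⊆ ρ′ x′ →
            var a x ∣ ρ ⊑ var b x′ ∣ ρ′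
    var-⊑ p = ⟨ ≤-refl , (λ τ n (m , q , r) → m , p τ m q , r) ⟩

    module _ {A B : Set} {m n} {ρ : Env m} {ρ′ : Env n} {a : A} {b : B} where

      app-⊑ : ∀ {s s′ t t′} → s ∣ ρ ⊑ s′ ∣ ρ′ → ⟦ t ⟧ ρ ⊆ ⟦ t′ ⟧ ρ′ → app a s t ∣ ρ ⊑ app b s′ t′ ∣ ρ′
      app-⊑ {s} {s′} p q = ⟨ ≤-refl , (λ τ n (U , m , c , x , y , z) →
        U , m , c , sem p _ _ x , ⊆-trans y q , ≤-trans (cost-mono {s = s} {s′} (wt p) c m) z) ⟩

      lam-⊑ : ∀ {s s′} → (∀ U → ⟦ s ⟧ (⟪ U ⟫ ▸ ρ) ⊆ ⟦ s′ ⟧ (⟪ U ⟫ ▸ ρ′)) → lam a s ∣ ρ ⊑ lam b s′ ∣ ρ′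
      lam-⊑ p = ⟨ ≤-refl , (λ where
        lam⋆        n x → tt
        (fun U τ m) n x → p U τ m x) ⟩

      letrec-⊑ : ∀ {k bs bs′ t t′} →
        (∀ {δ ε} → δ ⊆ᵉ ε → ⟦ bs ⟧ᵛ (δ ⧺ ρ) ⊆ᵉ ⟦ bs′ ⟧ᵛ (ε ⧺ ρ′)) →
        (∀ {δ ε} → δ ⊆ᵉ ε → ⟦ t ⟧ (δ ⧺ ρ) ⊆ ⟦ t′ ⟧ (ε ⧺ ρ′)) →
        letrec {k = k} a bs t ∣ ρ ⊑ letrec b bs′ t′ ∣ ρ′
      letrec-⊑ p q = ⟨ ≤-refl , (λ τ n (m , x , y) → m , q (fix-sim _ _ p) τ m x , y) ⟩

      con-⊑ : ∀ {k K} {c : k ∈ arities K} {ss ss′} → ⟦ ss ⟧ᵛ ρ ⊆ᵉ ⟦ ss′ ⟧ᵛ ρ′ →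
              con a K c ss ∣ ρ ⊑ con b K c ss′ ∣ ρ′
      con-⊑ p = ⟨ ≤-refl , (λ τ n (Us , x , y) → Us , x , λ i → ⊆-trans (y i) (p i)) ⟩

      seq-⊑ : ∀ {s s′ t t′} → s ∣ ρ ⊑ s′ ∣ ρ′ → ⟦ t ⟧ ρ ⊆ ⟦ t′ ⟧ ρ′ → seq a s t ∣ ρ ⊑ seq b s′ t′ ∣ ρ′
      seq-⊑ {s} {s′} p q = ⟨ ≤-refl , (λ τ n (σ , m , c , x , y , z) →
        σ , m , c , sem p _ _ x , q _ _ y , ≤-trans (cost-mono {s = s} {s′} (wt p) c m) z) ⟩

      case-⊑ : ∀ {K s s′ alts alts′} → s ∣ ρ ⊑ s′ ∣ ρ′ →
               (∀ {b} (e : b ∈ arities K) δ → ⟦ alts ⟧ᵃ ρ e δ ⊆ ⟦ alts′ ⟧ᵃ ρ′ e δ) →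
               case a K s alts ∣ ρ ⊑ case b K s′ alts′ ∣ ρ′
      case-⊑ {s = s} {s′} p q = ⟨ ≤-refl , (λ τ n (b , e , Us , m , c , x , y , z) →
        b , e , Us , m , c , sem p _ _ x , q e _ _ _ y , ≤-trans (cost-mono {s = s} {s′} (wt p) c m) z) ⟩

    module _ {A B : Set} (f : A → B) where

      relabel-⊑  : ∀ {n ρ ρ′} (s : Tm A n) → ρ ⊆ᵉ ρ′ → s ∣ ρ ⊑ relabel f s ∣ ρ′
      relabel-⊑ᵛ : ∀ {n k ρ ρ′} (ss : Vec (Tm A n) k) → ρ ⊆ᵉ ρ′ → ⟦ ss ⟧ᵛ ρ ⊆ᵉ ⟦ relabelVec f ss ⟧ᵛ ρ′
      relabel-⊑ᵃ : ∀ {n as ρ ρ′} (alts : Alts A n as) → ρ ⊆ᵉ ρ′ → ∀ {b} (e : b ∈ as) δ →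
                   ⟦ alts ⟧ᵃ ρ e δ ⊆ ⟦ relabelAlts f alts ⟧ᵃ ρ′ e δ
      relabel-⊑ (var a x)       p = var-⊑ (p x)
      relabel-⊑ (app a s t)     p = app-⊑ (relabel-⊑ s p) (sem (relabel-⊑ t p))
      relabel-⊑ (lam a s)       p = lam-⊑ (λ U → sem (relabel-⊑ s (⧺-mono ⊆ᵉ-refl p)))
      relabel-⊑ (letrec a bs t) p = letrec-⊑ (λ q → relabel-⊑ᵛ bs (⧺-mono q p)) (λ q → sem (relabel-⊑ t (⧺-mono q p)))
      relabel-⊑ (con a K c ss)  p = con-⊑ (relabel-⊑ᵛ ss p)
      relabel-⊑ (seq a s t)     p = seq-⊑ (relabel-⊑ s p) (sem (relabel-⊑ t p))
      relabel-⊑ (case a K s alts) p = case-⊑ (relabel-⊑ s p) (relabel-⊑ᵃ alts p)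
      relabel-⊑ᵛ (s ∷ ss) p zero    = sem (relabel-⊑ s p)
      relabel-⊑ᵛ (s ∷ ss) p (suc i) = relabel-⊑ᵛ ss p i
      relabel-⊑ᵃ (s ∷ alts) p (here refl) δ = sem (relabel-⊑ s (⧺-mono ⊆ᵉ-refl p))
      relabel-⊑ᵃ (s ∷ alts) p (there e)   δ = relabel-⊑ᵃ alts p e δ

      relabel-⊒  : ∀ {n ρ ρ′} (s : Tm A n) → ρ ⊆ᵉ ρ′ → relabel f s ∣ ρ ⊑ s ∣ ρ′
      relabel-⊒ᵛ : ∀ {n k ρ ρ′} (ss : Vec (Tm A n) k) → ρ ⊆ᵉ ρ′ → ⟦ relabelVec f ss ⟧ᵛ ρ ⊆ᵉ ⟦ ss ⟧ᵛ ρ′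
      relabel-⊒ᵃ : ∀ {n as ρ ρ′} (alts : Alts A n as) → ρ ⊆ᵉ ρ′ → ∀ {b} (e : b ∈ as) δ →
                   ⟦ relabelAlts f alts ⟧ᵃ ρ e δ ⊆ ⟦ alts ⟧ᵃ ρ′ e δ
      relabel-⊒ (var a x)       p = var-⊑ (p x)
      relabel-⊒ (app a s t)     p = app-⊑ (relabel-⊒ s p) (sem (relabel-⊒ t p))
      relabel-⊒ (lam a s)       p = lam-⊑ (λ U → sem (relabel-⊒ s (⧺-mono ⊆ᵉ-refl p)))
      relabel-⊒ (letrec a bs t) p = letrec-⊑ (λ q → relabel-⊒ᵛ bs (⧺-mono q p)) (λ q → sem (relabel-⊒ t (⧺-mono q p)))
      relabel-⊒ (con a K c ss)  p = con-⊑ (relabel-⊒ᵛ ss p)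
      relabel-⊒ (seq a s t)     p = seq-⊑ (relabel-⊒ s p) (sem (relabel-⊒ t p))
      relabel-⊒ (case a K s alts) p = case-⊑ (relabel-⊒ s p) (relabel-⊒ᵃ alts p)
      relabel-⊒ᵛ (s ∷ ss) p zero    = sem (relabel-⊒ s p)
      relabel-⊒ᵛ (s ∷ ss) p (suc i) = relabel-⊒ᵛ ss p i
      relabel-⊒ᵃ (s ∷ alts) p (here refl) δ = sem (relabel-⊒ s (⧺-mono ⊆ᵉ-refl p))
      relabel-⊒ᵃ (s ∷ alts) p (there e)   δ = relabel-⊒ᵃ alts p e δ

    ≈-⊑ : ∀ {A B n ρ ρ′} (s : Tm A n) (s′ : Tm B n) → relabel (λ _ → tt) s ≡ relabel (λ _ → tt) s′ →
          ρ ⊆ᵉ ρ′ → s ∣ ρ ⊑ s′ ∣ ρ′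
    ≈-⊑ {ρ = ρ} {ρ′} s s′ eq p = ⊑-trans (relabel-⊑ _ s p)
      (subst (λ z → z ∣ ρ′ ⊑ s′ ∣ ρ′) (sym eq) (relabel-⊒ _ s′ ⊆ᵉ-refl))

    -- The relabelling lemmas already allow the environment to grow, so monotonicity is their
    -- instance for a term compared with itself.
    ⊑-mono : ∀ {A n ρ ρ′} (s : Tm A n) → ρ ⊆ᵉ ρ′ → s ∣ ρ ⊑ s ∣ ρ′
    ⊑-mono s p = ≈-⊑ s s refl p

    mono : ∀ {A n ρ ρ′} (s : Tm A n) → ρ ⊆ᵉ ρ′ → ⟦ s ⟧ ρ ⊆ ⟦ s ⟧ ρ′
    mono s p = sem (⊑-mono s p)

    ⟦⟧-≡ : ∀ {A n ρ} {s t : Tm A n} → s ≡ t → ⟦ s ⟧ ρ ⊆ ⟦ t ⟧ ρ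
    ⟦⟧-≡ refl = ⊆-refl

    monoᵛ : ∀ {A n k ρ ρ′} (ss : Vec (Tm A n) k) → ρ ⊆ᵉ ρ′ → ⟦ ss ⟧ᵛ ρ ⊆ᵉ ⟦ ss ⟧ᵛ ρ′
    monoᵛ (s ∷ ss) p zero    = mono s p
    monoᵛ (s ∷ ss) p (suc i) = monoᵛ ss p i

    monoᵃ : ∀ {A n as ρ ρ′} (alts : Alts A n as) → ρ ⊆ᵉ ρ′ → ∀ {b} (e : b ∈ as) {δ ε} → δ ⊆ᵉ ε →
            ⟦ alts ⟧ᵃ ρ e δ ⊆ ⟦ alts ⟧ᵃ ρ′ e ε
    monoᵃ (s ∷ alts) p (here refl) q = mono s (⧺-mono q p)
    monoᵃ (s ∷ alts) p (there e)   q = monoᵃ alts p e q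

    binds : ∀ {A n k} → Vec (Tm A (k + n)) k → Env n → (Fin k → Pred) → Fin k → Pred
    binds bs ρ δ = ⟦ bs ⟧ᵛ (δ ⧺ ρ)

    rec : ∀ {A n k} → Vec (Tm A (k + n)) k → Env n → Fin k → Pred
    rec bs ρ = fix (binds bs ρ)

    binds-mono : ∀ {A n k ρ ρ′} (bs : Vec (Tm A (k + n)) k) → ρ ⊆ᵉ ρ′ →
                 ∀ {δ ε} → δ ⊆ᵉ ε → binds bs ρ δ ⊆ᵉ binds bs ρ′ ε
    binds-mono bs p q = monoᵛ bs (⧺-mono q p)

    rec-least : ∀ {A n k ρ} (bs : Vec (Tm A (k + n)) k) {δ} → binds bs ρ δ ⊆ᵉ δ → rec bs ρ ⊆ᵉ δ
    rec-least bs p i τ n (N , x) = kleene-least _ (binds-mono bs ⊆ᵉ-refl) p N i τ n x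

    open Directed

    _⧺ᵈ_ : ∀ {n k} (δ : Fin k → Pred) (D : Directed n) → Directed (k + n)
    δ ⧺ᵈ D = record { Ix = Ix D ; base = base D ; _∨_ = _∨_ D ; env = λ i → δ ⧺ env D i
                    ; left = λ i j → ⧺-mono ⊆ᵉ-refl (left D i j) ; right = λ i j → ⧺-mono ⊆ᵉ-refl (right D i j) }

    ⧺ᵈ-⋃ : ∀ {n k} (δ : Fin k → Pred) (D : Directed n) {ρ} → ρ ⊆ᵉ ⋃ D → δ ⧺ ρ ⊆ᵉ ⋃ (δ ⧺ᵈ D)
    ⧺ᵈ-⋃ {k = zero}  δ D p x       = p x
    ⧺ᵈ-⋃ {k = suc k} δ D p zero    τ n q = base D , q
    ⧺ᵈ-⋃ {k = suc k} δ D p (suc x) τ n q = ⧺ᵈ-⋃ (δ ∘ suc) D p x τ n q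

    recᵈ : ∀ {A n k} → Vec (Tm A (k + n)) k → ℕ → Directed n → Directed (k + n)
    recᵈ bs N D = record
      { Ix = Ix D ; base = base D ; _∨_ = _∨_ D ; env = λ i → kleene (binds bs (env D i)) N ⧺ env D i
      ; left  = λ i j → ⧺-mono (kleene-sim _ _ (binds-mono bs (left D i j)) N) (left D i j)
      ; right = λ i j → ⧺-mono (kleene-sim _ _ (binds-mono bs (right D i j)) N) (right D i j) }

    ⧺-⋃ : ∀ {n k} (D : Directed n) (ε : Ix D → Fin k → Pred) {δ ρ} →
          (∀ x τ m → δ x τ m → ∃ λ i → ε i x τ m) → ρ ⊆ᵉ ⋃ D →
          ∀ x τ m → (δ ⧺ ρ) x τ m → ∃ λ i → (ε i ⧺ env D i) x τ m
    ⧺-⋃ {k = zero}  D ε p q x       = q x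
    ⧺-⋃ {k = suc k} D ε p q zero    = p zero
    ⧺-⋃ {k = suc k} D ε p q (suc x) = ⧺-⋃ D (λ i → ε i ∘ suc) (p ∘ suc) q x

    ⋃-⧺ : ∀ {n k} (δ : Fin k → ℕ → Pred) (ρ : Env n) →
          (λ x τ m → ∃ λ N → δ x N τ m) ⧺ ρ ⊆ᵉ (λ x τ m → ∃ λ N → ((λ y → δ y N) ⧺ ρ) x τ m)
    ⋃-⧺ {k = zero}  δ ρ x       τ m q = 0 , q
    ⋃-⧺ {k = suc _} δ ρ zero    τ m q = q
    ⋃-⧺ {k = suc _} δ ρ (suc x) = ⋃-⧺ (δ ∘ suc) ρ x

    kleene-≤ : ∀ {A n k ρ N M} (bs : Vec (Tm A (k + n)) k) → N ≤ M →
               kleene (binds bs ρ) N ⊆ᵉ kleene (binds bs ρ) M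
    kleene-≤ bs z≤n     i τ n ()
    kleene-≤ bs (s≤s l) = binds-mono bs ⊆ᵉ-refl (kleene-≤ bs l)

    stages : ∀ {A n k} → Vec (Tm A (k + n)) k → Env n → Directed (k + n)
    stages bs ρ = record
      { Ix = ℕ ; base = 0 ; _∨_ = _⊔_ ; env = λ N → kleene (binds bs ρ) N ⧺ ρ
      ; left  = λ i j → ⧺-mono (kleene-≤ bs (m≤m⊔n i j)) ⊆ᵉ-refl
      ; right = λ i j → ⧺-mono (kleene-≤ bs (m≤n⊔m i j)) ⊆ᵉ-refl }

    stages-⋃ : ∀ {A n k ρ} (bs : Vec (Tm A (k + n)) k) → rec bs ρ ⧺ ρ ⊆ᵉ ⋃ (stages bs ρ)
    stages-⋃ {ρ = ρ} bs = ⋃-⧺ (λ x N → kleene (binds bs ρ) N x) ρ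

    -- A token depends on finitely many facts about the environment, so a token over the union of a
    -- directed family is already one over some member. Where several subterms contribute, their
    -- members are joined and monotonicity moves the tokens to the join.
    cont  : ∀ {A n} (s : Tm A n) (D : Directed n) {ρ} → ρ ⊆ᵉ ⋃ D →
            ∀ τ m → ⟦ s ⟧ ρ τ m → ∃ λ i → ⟦ s ⟧ (env D i) τ m
    contᵛ : ∀ {A n k} (ss : Vec (Tm A n) k) (D : Directed n) {ρ} → ρ ⊆ᵉ ⋃ D →
            ∀ x τ m → ⟦ ss ⟧ᵛ ρ x τ m → ∃ λ i → ⟦ ss ⟧ᵛ (env D i) x τ m
    contᵃ : ∀ {A n as} (alts : Alts A n as) (D : Directed n) {ρ} → ρ ⊆ᵉ ⋃ D →
            ∀ {b} (e : b ∈ as) δ τ m → ⟦ alts ⟧ᵃ ρ e δ τ m → ∃ λ i → ⟦ alts ⟧ᵃ (env D i) e δ τ m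
    contᵏ : ∀ {A n k} (bs : Vec (Tm A (k + n)) k) (D : Directed n) {ρ} → ρ ⊆ᵉ ⋃ D →
            ∀ N x τ m → kleene (binds bs ρ) N x τ m → ∃ λ i → kleene (binds bs (env D i)) N x τ m

    cont (var a x) D p τ m (k , q , r) with p x τ k q
    ... | i , q′ = i , k , q′ , r
    cont (app a s t) D p τ m (U , k , c , x , y , z)
      with cont s D p _ c x
         | listJoin (_∨_ D) (λ i → ⟦ t ⟧ (env D i)) (base D) (λ i j → mono t (left D i j)) (λ i j → mono t (right D i j))
                    U (λ σ l u → cont t D p σ l (y σ l u))
    ... | i , x′ | j , y′ = _∨_ D i j , U , k , c , mono s (left D i j) _ _ x′ , ⊆-trans y′ (mono t (right D i j)) , z
    cont (lam a s) D p lam⋆ m x = base D , tt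
    cont (lam a s) D p (fun U τ k) m x = cont s ((λ (_ : Fin 1) → ⟪ U ⟫) ⧺ᵈ D) (⧺ᵈ-⋃ _ D p) τ k x
    -- Continuity is used twice: in the Kleene stages, to fix a finite stage `N`, and then in `D`,
    -- for the family of the `N`-th stages.
    cont (letrec a bs t) D {ρ} p τ m (k , x , y)
      with cont t (stages bs ρ) (stages-⋃ bs) τ k x
    ... | N , x′ with cont t (recᵈ bs N D) (⧺-⋃ D (λ i → kleene (binds bs (env D i)) N) (contᵏ bs D p N) p) τ k x′
    ... | i , x″ = i , k , mono t (⧺-mono {δ = kleene (binds bs (env D i)) N} {ρ = env D i}
                                                  (λ _ _ _ q → N , q) ⊆ᵉ-refl) τ k x″ , y
    cont (con a K c ss) D p τ m (Us , x , y)
      with finJoin (_∨_ D) (λ x i → ⟪ Us x ⟫ ⊆ ⟦ ss ⟧ᵛ (env D i) x) (base D)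
             (λ x i j q → ⊆-trans q (monoᵛ ss (left D i j) x)) (λ x i j q → ⊆-trans q (monoᵛ ss (right D i j) x))
             (λ x → listJoin (_∨_ D) (λ i → ⟦ ss ⟧ᵛ (env D i) x) (base D)
               (λ i j → monoᵛ ss (left D i j) x) (λ i j → monoᵛ ss (right D i j) x)
               (Us x) (λ σ l u → contᵛ ss D p x σ l (y x σ l u)))
    ... | i , y′ = i , Us , x , y′
    cont (seq a s t) D p τ m (σ , k , c , x , y , z)
      with cont s D p _ c x | cont t D p _ k y
    ... | i , x′ | j , y′ = _∨_ D i j , σ , k , c , mono s (left D i j) _ _ x′ , mono t (right D i j) _ _ y′ , z
    cont (case a K s alts) D p τ m (b , e , Us , k , c , x , y , z)
      with cont s D p _ c x | contᵃ alts D p e _ _ k y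
    ... | i , x′ | j , y′ = _∨_ D i j , b , e , Us , k , c , mono s (left D i j) _ _ x′ ,
                            monoᵃ alts (right D i j) e ⊆ᵉ-refl _ _ y′ , z

    contᵛ (s ∷ ss) D p zero    = cont s D p
    contᵛ (s ∷ ss) D p (suc x) = contᵛ ss D p x
    contᵃ (s ∷ alts) D p (here refl) δ = cont s (δ ⧺ᵈ D) (⧺ᵈ-⋃ δ D p)
    contᵃ (s ∷ alts) D p (there e)   δ = contᵃ alts D p e δ
    contᵏ bs D p zero    x τ m ()
    contᵏ bs D p (suc N) = contᵛ bs (recᵈ bs N D) (⧺-⋃ D (λ i → kleene (binds bs (env D i)) N) (contᵏ bs D p N) p)

    -- This half of the fixed-point equation needs continuity: a token over the union of the stages
    -- is already one over a single stage `N`, hence appears at stage `suc N`.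
    rec-closed : ∀ {A n k ρ} (bs : Vec (Tm A (k + n)) k) → binds bs ρ (rec bs ρ) ⊆ᵉ rec bs ρ
    rec-closed {ρ = ρ} bs i τ m x with contᵛ bs (stages bs ρ) (stages-⋃ bs) i τ m x
    ... | N , y = suc N , y

    rec-unfold : ∀ {A n k ρ} (bs : Vec (Tm A (k + n)) k) → rec bs ρ ⊆ᵉ binds bs ρ (rec bs ρ)
    rec-unfold bs i τ m (suc N , x) = binds-mono bs ⊆ᵉ-refl (λ _ _ _ q → N , q) i τ m x

    -- Continuity for the family of finite parts of `es`, joined by concatenation. It replaces
    -- arbitrary predicates, such as the denotation of an argument, by lists that a token can
    -- record.
    compact : ∀ {A n a ρ} (s : Tm A (a + n)) (es : Fin a → Pred) → ∀ τ m → ⟦ s ⟧ (es ⧺ ρ) τ m →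
              ∃ λ Us → (∀ i → ⟪ Us i ⟫ ⊆ es i) × ⟦ s ⟧ ((λ i → ⟪ Us i ⟫) ⧺ ρ) τ m
    compact {n = n} {a = a} {ρ = ρ} s es τ m x
      with cont s D (⧺-⋃ ρᵈ (λ U i → ⟪ proj₁ U i ⟫) single (λ _ _ _ q → base ρᵈ , q)) τ m x
      where
      Ix′ = Σ (Fin a → List (Ty × ℕ)) λ Us → ∀ i → ⟪ Us i ⟫ ⊆ es i
      join : Ix′ → Ix′ → Ix′
      join (U , p) (U′ , q) = (λ i → U i List.++ U′ i) , λ i τ n x → [ p i τ n , q i τ n ]′ (∈-++⁻ (U i) x)
      ρᵈ : Directed n
      ρᵈ = record { Ix = Ix′ ; base = (λ _ → []) , λ _ _ _ () ; _∨_ = join ; env = λ _ → ρ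
                  ; left = λ _ _ → ⊆ᵉ-refl ; right = λ _ _ → ⊆ᵉ-refl }
      D : Directed (a + n)
      D = record { Ix = Ix′ ; base = base ρᵈ ; _∨_ = join ; env = λ U → (λ i → ⟪ proj₁ U i ⟫) ⧺ ρ
                 ; left  = λ U U′ → ⧺-mono {δ = λ i → ⟪ proj₁ U i ⟫} {ρ = ρ} (λ i _ _ → ∈-++⁺ˡ) ⊆ᵉ-refl
                 ; right = λ U U′ → ⧺-mono {δ = λ i → ⟪ proj₁ U′ i ⟫} {ρ = ρ} (λ i _ _ → ∈-++⁺ʳ (proj₁ U i)) ⊆ᵉ-refl }
      single : ∀ x τ m → es x τ m → ∃ λ (U : Ix′) → ⟪ proj₁ U x ⟫ τ m
      single x τ m q = (U , U⊆) , mem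
        where
        U : Fin a → List (Ty × ℕ)
        U y with y Finₚ.≟ x
        ... | yes _ = (τ , m) ∷ []
        ... | no _  = []
        U⊆ : ∀ y → ⟪ U y ⟫ ⊆ es y
        U⊆ y with y Finₚ.≟ x
        ... | yes refl = λ { _ _ (here refl) → q }
        ... | no _     = λ _ _ ()
        mem : ⟪ U x ⟫ τ m
        mem with x Finₚ.≟ x
        ... | yes _ = here refl
        ... | no ¬p = contradiction refl ¬p
    ... | (Us , p) , y = Us , p , y

    compactᵃ : ∀ {A n as b ρ} (alts : Alts A n as) (e : b ∈ as) (es : Fin b → Pred) →
               ∀ τ m → ⟦ alts ⟧ᵃ ρ e es τ m →
               ∃ λ (Us : Fin b → List (Ty × ℕ)) → (∀ i → ⟪ Us i ⟫ ⊆ es i) × ⟦ alts ⟧ᵃ ρ e (λ i → ⟪ Us i ⟫) τ m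
    compactᵃ (s ∷ alts) (here refl) es = compact s es
    compactᵃ (s ∷ alts) (there e)   es = compactᵃ alts e es

  -- Renaming and substitution

  lookup-id : ∀ {n} (x : Fin n) → lookup idᵛ x ≡ x
  lookup-id zero    = refl
  lookup-id (suc x) = trans (lookup-map x suc idᵛ) (cong suc (lookup-id x))

  lookup-wk⋆ : ∀ k {n} (x : Fin n) → lookup (wk⋆ k) x ≡ k ↑ʳ x
  lookup-wk⋆ zero    x = lookup-id x
  lookup-wk⋆ (suc k) x = trans (lookup-map x suc (wk⋆ k)) (cong suc (lookup-wk⋆ k x))

  lookup-⊙ : ∀ {l m n} (σ : Sub Fin l m) (τ : Sub Fin m n) x → lookup (σ ⊙ τ) x ≡ lookup τ (lookup σ x)
  lookup-⊙ σ τ x = lookup-map x (lookup τ) σ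

  lookup-↑⋆-↑ʳ : ∀ k {m n} (σ : Sub Fin m n) x → lookup (σ ↑⋆ k) (k ↑ʳ x) ≡ k ↑ʳ lookup σ x
  lookup-↑⋆-↑ʳ zero    σ x = refl
  lookup-↑⋆-↑ʳ (suc k) σ x = trans (lookup-map (k ↑ʳ x) suc (σ ↑⋆ k)) (cong suc (lookup-↑⋆-↑ʳ k σ x))

  lookup-embed-↑ᵈ : ∀ ds {m n} (σ : Sub Fin m n) x →
                    lookup (σ ↑ᵈ ds) (lookup (embed ds) x) ≡ lookup (embed ds) (lookup σ x)
  lookup-embed-↑ᵈ []       σ x = trans (cong (lookup σ) (lookup-id x)) (sym (lookup-id (lookup σ x)))
  lookup-embed-↑ᵈ (d ∷ ds) σ x = begin
    lookup ((σ ↑⋆ d) ↑ᵈ ds) (lookup (wk⋆ d ⊙ embed ds) x)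
      ≡⟨ cong (lookup ((σ ↑⋆ d) ↑ᵈ ds)) (trans (lookup-⊙ (wk⋆ d) (embed ds) x) (cong (lookup (embed ds)) (lookup-wk⋆ d x))) ⟩
    lookup ((σ ↑⋆ d) ↑ᵈ ds) (lookup (embed ds) (d ↑ʳ x))
      ≡⟨ lookup-embed-↑ᵈ ds (σ ↑⋆ d) (d ↑ʳ x) ⟩
    lookup (embed ds) (lookup (σ ↑⋆ d) (d ↑ʳ x))
      ≡⟨ cong (lookup (embed ds)) (lookup-↑⋆-↑ʳ d σ x) ⟩
    lookup (embed ds) (d ↑ʳ lookup σ x)
      ≡⟨ cong (lookup (embed ds)) (lookup-wk⋆ d (lookup σ x)) ⟨
    lookup (embed ds) (lookup (wk⋆ d) (lookup σ x))
      ≡⟨ lookup-⊙ (wk⋆ d) (embed ds) (lookup σ x) ⟨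
    lookup (embed (d ∷ ds)) (lookup σ x) ∎
    where open ≡-Reasoning

  ↑ʳ↑ˡ-reassoc : ∀ k k′ n (j : Fin k′) → cast (sym (+-assoc k k′ n)) (k ↑ʳ (j ↑ˡ n)) ≡ (k ↑ʳ j) ↑ˡ n
  ↑ʳ↑ˡ-reassoc k k′ n j = Finₚ.toℕ-injective (begin
    toℕ (cast _ (k ↑ʳ (j ↑ˡ n))) ≡⟨ Finₚ.toℕ-cast _ (k ↑ʳ (j ↑ˡ n)) ⟩
    toℕ (k ↑ʳ (j ↑ˡ n))          ≡⟨ Finₚ.toℕ-↑ʳ k (j ↑ˡ n) ⟩
    k + toℕ (j ↑ˡ n)             ≡⟨ cong (k +_) (Finₚ.toℕ-↑ˡ j n) ⟩
    k + toℕ j                    ≡⟨ Finₚ.toℕ-↑ʳ k j ⟨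
    toℕ (k ↑ʳ j)                 ≡⟨ Finₚ.toℕ-↑ˡ (k ↑ʳ j) n ⟨
    toℕ ((k ↑ʳ j) ↑ˡ n)          ∎)
    where open ≡-Reasoning

  lookup-insert-↑ˡ : ∀ k k′ n (j : Fin k′) → lookup (insert k k′ n) (j ↑ˡ n) ≡ (k ↑ʳ j) ↑ˡ n
  lookup-insert-↑ˡ k k′ n j = begin
    lookup (insert k k′ n) (j ↑ˡ n)             ≡⟨ lookup-⊙ (wk⋆ k) (reassoc k k′ n) (j ↑ˡ n) ⟩
    lookup (reassoc k k′ n) (lookup (wk⋆ k) (j ↑ˡ n)) ≡⟨ cong (lookup (reassoc k k′ n)) (lookup-wk⋆ k (j ↑ˡ n)) ⟩
    lookup (reassoc k k′ n) (k ↑ʳ (j ↑ˡ n))     ≡⟨ lookup∘tabulate _ (k ↑ʳ (j ↑ˡ n)) ⟩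
    cast _ (k ↑ʳ (j ↑ˡ n))                      ≡⟨ ↑ʳ↑ˡ-reassoc k k′ n j ⟩
    (k ↑ʳ j) ↑ˡ n                               ∎
    where open ≡-Reasoning

  ⧺-reassoc : ∀ k k′ {n} (δ : Fin (k + k′) → Pred) (ρ : Env n) x →
              (δ ⧺ ρ) (cast (sym (+-assoc k k′ n)) x) ≡ ((λ i → δ (i ↑ˡ k′)) ⧺ (λ j → δ (k ↑ʳ j)) ⧺ ρ) x
  ⧺-reassoc zero    k′ δ ρ x       = cong (δ ⧺ ρ) (Finₚ.cast-is-id _ x)
  ⧺-reassoc (suc k) k′ δ ρ zero    = refl
  ⧺-reassoc (suc k) k′ δ ρ (suc x) = ⧺-reassoc k k′ (δ ∘ suc) ρ x

  ⧺-lookup-reassoc : ∀ k k′ {n} (δ : Fin (k + k′) → Pred) (ρ : Env n) x →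
                     (δ ⧺ ρ) (lookup (reassoc k k′ n) x) ≡ ((λ i → δ (i ↑ˡ k′)) ⧺ (λ j → δ (k ↑ʳ j)) ⧺ ρ) x
  ⧺-lookup-reassoc k k′ δ ρ x = trans (cong (δ ⧺ ρ) (lookup∘tabulate _ x)) (⧺-reassoc k k′ δ ρ x)

  ⧺-lookup-insert : ∀ k k′ {n} (δ : Fin (k + k′) → Pred) (ρ : Env n) x →
                    (δ ⧺ ρ) (lookup (insert k k′ n) x) ≡ ((λ j → δ (k ↑ʳ j)) ⧺ ρ) x
  ⧺-lookup-insert k k′ {n} δ ρ x = begin
    (δ ⧺ ρ) (lookup (insert k k′ n) x)
      ≡⟨ cong (δ ⧺ ρ) (trans (lookup-⊙ (wk⋆ k) (reassoc k k′ n) x) (cong (lookup (reassoc k k′ n)) (lookup-wk⋆ k x))) ⟩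
    (δ ⧺ ρ) (lookup (reassoc k k′ n) (k ↑ʳ x))
      ≡⟨ ⧺-lookup-reassoc k k′ δ ρ (k ↑ʳ x) ⟩
    ((λ i → δ (i ↑ˡ k′)) ⧺ (λ j → δ (k ↑ʳ j)) ⧺ ρ) (k ↑ʳ x)
      ≡⟨ ⧺-↑ʳ k _ _ x ⟩
    ((λ j → δ (k ↑ʳ j)) ⧺ ρ) x ∎
    where open ≡-Reasoning

  ⧺-lookup-wk⋆ : ∀ k {n} (δ : Fin k → Pred) (ρ : Env n) x → (δ ⧺ ρ) (lookup (wk⋆ k) x) ≡ ρ x
  ⧺-lookup-wk⋆ k δ ρ x = trans (cong (δ ⧺ ρ) (lookup-wk⋆ k x)) (⧺-↑ʳ k δ ρ x)

  module Substitution (ι v : ℕ) where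
    open Model ι v

    module Traverse {A : Set} {T : ℕ → Set} (l : Lift T (Tm A)) (a₀ : A) where
      open Lift l using (lift; weaken) renaming (var to varᵀ; _↑⋆_ to _↑⋆ᵀ_)
      open Traversal l

      -- Stated for an arbitrary `Lift`: the instance for variables comes first and supplies the
      -- weakening that the instance for terms needs below binders.
      module Forward
        (lift-var : ∀ {n} (x : Fin n) → lift (varᵀ x) ≡ var a₀ x)
        (weaken-⊑ : ∀ {n} (t : T n) {ρ} {κ : Env (suc n)} → ρ ⊆ᵉ κ ∘ suc → lift t ∣ ρ ⊑ lift (weaken t) ∣ κ)
        where

        _↦ₛ_ : ∀ {m n} → Env m × Sub T m n → Env n → Set
        (ρ , σ) ↦ₛ ρ′ = ∀ x → var a₀ x ∣ ρ ⊑ lift (lookup σ x) ∣ ρ′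

        ext : ∀ {k m n ρ ρ′} {σ : Sub T m n} {δ ε : Fin k → Pred} → (ρ , σ) ↦ₛ ρ′ → δ ⊆ᵉ ε →
              (δ ⧺ ρ , σ ↑⋆ᵀ k) ↦ₛ (ε ⧺ ρ′)
        ext {zero}  p q x = p x
        ext {suc k} {ρ′ = ρ′} {δ = δ} {ε} p q zero =
          subst (λ z → var a₀ zero ∣ _ ⊑ z ∣ ε ⧺ ρ′) (sym (lift-var zero)) (var-⊑ (q zero))
        ext {suc k} {ρ′ = ρ′} {σ} {δ} {ε} p q (suc x) =
          subst (λ z → var a₀ (suc x) ∣ _ ⊑ lift z ∣ ε ⧺ ρ′) (sym (lookup-map x weaken (σ ↑⋆ᵀ k)))
            (⊑-trans ⟨ wt ih , sem ih ⟩ (weaken-⊑ (lookup (σ ↑⋆ᵀ k) x) {κ = ε ⧺ ρ′} ⊆ᵉ-refl))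
          where ih = ext {k} {ρ′ = ρ′} p (q ∘ suc) x

        sub-⊑  : ∀ {m n ρ ρ′} (s : Tm A m) {σ : Sub T m n} → (ρ , σ) ↦ₛ ρ′ → s ∣ ρ ⊑ s / σ ∣ ρ′
        sub-⊑ᵛ : ∀ {m n k ρ ρ′} (ss : Vec (Tm A m) k) {σ : Sub T m n} → (ρ , σ) ↦ₛ ρ′ → ⟦ ss ⟧ᵛ ρ ⊆ᵉ ⟦ ss /Vec σ ⟧ᵛ ρ′
        sub-⊑ᵃ : ∀ {m n as ρ ρ′} (alts : Alts A m as) {σ : Sub T m n} → (ρ , σ) ↦ₛ ρ′ →
                 ∀ {b} (e : b ∈ as) δ → ⟦ alts ⟧ᵃ ρ e δ ⊆ ⟦ alts /Alts σ ⟧ᵃ ρ′ e δ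
        sub-⊑ (var a x)       p = ⟨ wt (p x) , sem (p x) ⟩
        sub-⊑ (app a s t)     p = app-⊑ (sub-⊑ s p) (sem (sub-⊑ t p))
        sub-⊑ (lam a s)       p = lam-⊑ (λ U → sem (sub-⊑ s (ext p ⊆ᵉ-refl)))
        sub-⊑ (letrec a bs t) p = letrec-⊑ (λ q → sub-⊑ᵛ bs (ext p q)) (λ q → sem (sub-⊑ t (ext p q)))
        sub-⊑ (con a K c ss)  p = con-⊑ (sub-⊑ᵛ ss p)
        sub-⊑ (seq a s t)     p = seq-⊑ (sub-⊑ s p) (sem (sub-⊑ t p))
        sub-⊑ (case a K s alts) p = case-⊑ (sub-⊑ s p) (sub-⊑ᵃ alts p)
        sub-⊑ᵛ (s ∷ ss) p zero    = sem (sub-⊑ s p)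
        sub-⊑ᵛ (s ∷ ss) p (suc i) = sub-⊑ᵛ ss p i
        sub-⊑ᵃ (s ∷ alts) p (here refl) δ = sem (sub-⊑ s (ext p ⊆ᵉ-refl))
        sub-⊑ᵃ (s ∷ alts) p (there e)   δ = sub-⊑ᵃ alts p e δ

      module Backward
        (lift-var : ∀ {n} (x : Fin n) → lift (varᵀ x) ≡ var a₀ x)
        (weaken-⊒ : ∀ {n} (t : T n) {ρ} {κ : Env (suc n)} → κ ∘ suc ⊆ᵉ ρ → lift (weaken t) ∣ κ ⊑ lift t ∣ ρ)
        where

        _↤ₛ_ : ∀ {m n} → Env m × Sub T m n → Env n → Set
        (ρ , σ) ↤ₛ ρ′ = ∀ x → lift (lookup σ x) ∣ ρ′ ⊑ var a₀ x ∣ ρ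

        ext : ∀ {k m n ρ ρ′} {σ : Sub T m n} {δ ε : Fin k → Pred} → (ρ , σ) ↤ₛ ρ′ → ε ⊆ᵉ δ →
              (δ ⧺ ρ , σ ↑⋆ᵀ k) ↤ₛ (ε ⧺ ρ′)
        ext {zero}  p q x = p x
        ext {suc k} {ρ′ = ρ′} {δ = δ} {ε} p q zero =
          subst (λ z → z ∣ ε ⧺ ρ′ ⊑ var a₀ zero ∣ _) (sym (lift-var zero)) (var-⊑ (q zero))
        ext {suc k} {ρ′ = ρ′} {σ} {δ} {ε} p q (suc x) =
          subst (λ z → lift z ∣ ε ⧺ ρ′ ⊑ var a₀ (suc x) ∣ _) (sym (lookup-map x weaken (σ ↑⋆ᵀ k)))
            (⊑-trans (weaken-⊒ (lookup (σ ↑⋆ᵀ k) x) {κ = ε ⧺ ρ′} ⊆ᵉ-refl) ⟨ wt ih , sem ih ⟩)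
          where ih = ext {k} {ρ′ = ρ′} p (q ∘ suc) x

        sub-⊒  : ∀ {m n ρ ρ′} (s : Tm A m) {σ : Sub T m n} → (ρ , σ) ↤ₛ ρ′ → s / σ ∣ ρ′ ⊑ s ∣ ρ
        sub-⊒ᵛ : ∀ {m n k ρ ρ′} (ss : Vec (Tm A m) k) {σ : Sub T m n} → (ρ , σ) ↤ₛ ρ′ → ⟦ ss /Vec σ ⟧ᵛ ρ′ ⊆ᵉ ⟦ ss ⟧ᵛ ρ
        sub-⊒ᵃ : ∀ {m n as ρ ρ′} (alts : Alts A m as) {σ : Sub T m n} → (ρ , σ) ↤ₛ ρ′ →
                 ∀ {b} (e : b ∈ as) δ → ⟦ alts /Alts σ ⟧ᵃ ρ′ e δ ⊆ ⟦ alts ⟧ᵃ ρ e δ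
        sub-⊒ (var a x)       p = ⟨ wt (p x) , sem (p x) ⟩
        sub-⊒ (app a s t)     p = app-⊑ (sub-⊒ s p) (sem (sub-⊒ t p))
        sub-⊒ (lam a s)       p = lam-⊑ (λ U → sem (sub-⊒ s (ext p ⊆ᵉ-refl)))
        sub-⊒ (letrec a bs t) p = letrec-⊑ (λ q → sub-⊒ᵛ bs (ext p q)) (λ q → sem (sub-⊒ t (ext p q)))
        sub-⊒ (con a K c ss)  p = con-⊑ (sub-⊒ᵛ ss p)
        sub-⊒ (seq a s t)     p = seq-⊑ (sub-⊒ s p) (sem (sub-⊒ t p))
        sub-⊒ (case a K s alts) p = case-⊑ (sub-⊒ s p) (sub-⊒ᵃ alts p)
        sub-⊒ᵛ (s ∷ ss) p zero    = sem (sub-⊒ s p)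
        sub-⊒ᵛ (s ∷ ss) p (suc i) = sub-⊒ᵛ ss p i
        sub-⊒ᵃ (s ∷ alts) p (here refl) δ = sem (sub-⊒ s (ext p ⊆ᵉ-refl))
        sub-⊒ᵃ (s ∷ alts) p (there e)   δ = sub-⊒ᵃ alts p e δ

    module Renaming {A : Set} (a₀ : A) where
      open TermSubst (termSubst a₀) using (_/Var_; varLift)
      open Traversal {A} varLift using (_/Vec_; _/Alts_)
      private
        module F = Traverse.Forward varLift a₀ (λ _ → refl) (λ t p → var-⊑ (p t))
        module B = Traverse.Backward varLift a₀ (λ _ → refl) (λ t p → var-⊑ (p t))

      ren-⊑ : ∀ {m n ρ ρ′} (s : Tm A m) {σ : Sub Fin m n} → ρ ⊆ᵉ ρ′ ∘ lookup σ → s ∣ ρ ⊑ s /Var σ ∣ ρ′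
      ren-⊑ s p = F.sub-⊑ s (λ x → var-⊑ (p x))

      ren-⊒ : ∀ {m n ρ ρ′} (s : Tm A m) {σ : Sub Fin m n} → ρ′ ∘ lookup σ ⊆ᵉ ρ → s /Var σ ∣ ρ′ ⊑ s ∣ ρ
      ren-⊒ s p = B.sub-⊒ s (λ x → var-⊑ (p x))

      ren-⊑ᵛ : ∀ {m n k ρ ρ′} (ss : Vec (Tm A m) k) {σ : Sub Fin m n} → ρ ⊆ᵉ ρ′ ∘ lookup σ →
               ⟦ ss ⟧ᵛ ρ ⊆ᵉ ⟦ ss /Vec σ ⟧ᵛ ρ′
      ren-⊑ᵛ ss p = F.sub-⊑ᵛ ss (λ x → var-⊑ (p x))

      ren-⊒ᵛ : ∀ {m n k ρ ρ′} (ss : Vec (Tm A m) k) {σ : Sub Fin m n} → ρ′ ∘ lookup σ ⊆ᵉ ρ →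
               ⟦ ss /Vec σ ⟧ᵛ ρ′ ⊆ᵉ ⟦ ss ⟧ᵛ ρ
      ren-⊒ᵛ ss p = B.sub-⊒ᵛ ss (λ x → var-⊑ (p x))

      ren-⊑ᵃ : ∀ {m n as ρ ρ′} (alts : Alts A m as) {σ : Sub Fin m n} → ρ ⊆ᵉ ρ′ ∘ lookup σ →
               ∀ {b} (e : b ∈ as) δ → ⟦ alts ⟧ᵃ ρ e δ ⊆ ⟦ alts /Alts σ ⟧ᵃ ρ′ e δ
      ren-⊑ᵃ alts p = F.sub-⊑ᵃ alts (λ x → var-⊑ (p x))

      ren-⊒ᵃ : ∀ {m n as ρ ρ′} (alts : Alts A m as) {σ : Sub Fin m n} → ρ′ ∘ lookup σ ⊆ᵉ ρ →
               ∀ {b} (e : b ∈ as) δ → ⟦ alts /Alts σ ⟧ᵃ ρ′ e δ ⊆ ⟦ alts ⟧ᵃ ρ e δ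
      ren-⊒ᵃ alts p = B.sub-⊒ᵃ alts (λ x → var-⊑ (p x))

    module TermSubstitution {A : Set} (a₀ : A) where
      open TermSubst (termSubst a₀) using (_/_; _/Var_; termLift) renaming (id to ids)
      open Renaming a₀
      private
        weaken-suc : ∀ {n} (x : Fin n) → lookup (wk⋆ 1) x ≡ suc x
        weaken-suc x = lookup-wk⋆ 1 x
        module F = Traverse.Forward termLift a₀ (λ _ → refl)
          (λ t {ρ} {κ} p → ren-⊑ t (λ x → ⊆-trans (p x) (⊆-reflexive (cong κ (sym (weaken-suc x))))))
        module B = Traverse.Backward termLift a₀ (λ _ → refl)
          (λ t {ρ} {κ} p → ren-⊒ t (λ x → ⊆-trans (⊆-reflexive (cong κ (weaken-suc x))) (p x)))

      lookup-ids : ∀ {n} (x : Fin n) → lookup ids x ≡ var a₀ x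
      lookup-ids zero    = refl
      lookup-ids (suc x) = trans (lookup-map x _ ids)
        (trans (cong (_/Var wk⋆ 1) (lookup-ids x)) (cong (var a₀) (weaken-suc x)))

      -- Holds for all charges: a variable has the greatest possible weight, `ι`, and what it pays
      -- covers the term put in its place.
      subst-⊑ : ∀ {m n ρ} (s : Tm A (m + n)) (ts : Vec (Tm A n) m) → s ∣ ⟦ ts ⟧ᵛ ρ ⧺ ρ ⊑ s / (ts ++ ids) ∣ ρ
      subst-⊑ {ρ = ρ} s ts = F.sub-⊑ s (vars {ρ = ρ} ts)
        where
        vars : ∀ {m n ρ} (ts : Vec (Tm A n) m) x → var a₀ x ∣ ⟦ ts ⟧ᵛ ρ ⧺ ρ ⊑ lookup (ts ++ ids) x ∣ ρ
        vars {ρ = ρ} []       x       = subst (λ z → var a₀ x ∣ ρ ⊑ z ∣ ρ) (sym (lookup-ids x)) (var-⊑ ⊆-refl)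
        vars         (t ∷ ts) zero    = ⟨ weight≤ι t , (λ τ n (m , p , q) → up t (m+n≤o⇒n≤o v q) p) ⟩
        vars         (t ∷ ts) (suc x) = ⟨ wt ih , sem ih ⟩
          where ih = vars ts x

      -- Putting a variable back for a term may raise the weight and adds `v` to the cost; this is
      -- harmless only when both charges vanish.
      subst-⊒ : ι ≡ 0 → v ≡ 0 → ∀ {m n ρ} (s : Tm A (m + n)) (ts : Vec (Tm A n) m) →
                s / (ts ++ ids) ∣ ρ ⊑ s ∣ ⟦ ts ⟧ᵛ ρ ⧺ ρ
      subst-⊒ refl refl {ρ = ρ} s ts = B.sub-⊒ s (vars {ρ = ρ} ts)
        where
        vars : ∀ {m n ρ} (ts : Vec (Tm A n) m) x → lookup (ts ++ ids) x ∣ ρ ⊑ var a₀ x ∣ ⟦ ts ⟧ᵛ ρ ⧺ ρ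
        vars {ρ = ρ} []       x       = subst (λ z → z ∣ ρ ⊑ var a₀ x ∣ ρ) (sym (lookup-ids x)) (var-⊑ ⊆-refl)
        vars         (t ∷ ts) zero    = ⟨ z≤n , (λ τ n p → n , p , ≤-refl) ⟩
        vars         (t ∷ ts) (suc x) = ⟨ wt ih , sem ih ⟩
          where ih = vars ts x

  -- Contexts and recursive bindings

  ∀-++ : ∀ {ℓ} k {n} {P : Fin (k + n) → Set ℓ} → (∀ i → P (i ↑ˡ n)) → (∀ j → P (k ↑ʳ j)) → ∀ x → P x
  ∀-++ zero    p q x       = q x
  ∀-++ (suc k) p q zero    = p zero
  ∀-++ (suc k) p q (suc x) = ∀-++ k (p ∘ suc) q x

  module _ {k k′ n} (δ : Fin k → Pred) (δ′ : Fin k′ → Pred) (ρ : Env n) where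

    ⧺-assoc-⊆ : ((δ ⧺ δ′) ⧺ ρ) ∘ lookup (reassoc k k′ n) ⊆ᵉ δ ⧺ δ′ ⧺ ρ
    ⧺-assoc-⊆ x = ⊆-trans (⊆-reflexive (⧺-lookup-reassoc k k′ (δ ⧺ δ′) ρ x))
      (⧺-mono (λ i → ⊆-reflexive (⧺-↑ˡ δ δ′ i)) (⧺-mono (λ j → ⊆-reflexive (⧺-↑ʳ k δ δ′ j)) ⊆ᵉ-refl) x)

    ⧺-insert-⊆ : ((δ ⧺ δ′) ⧺ ρ) ∘ lookup (insert k k′ n) ⊆ᵉ δ′ ⧺ ρ
    ⧺-insert-⊆ x = ⊆-trans (⊆-reflexive (⧺-lookup-insert k k′ (δ ⧺ δ′) ρ x))
      (⧺-mono (λ j → ⊆-reflexive (⧺-↑ʳ k δ δ′ j)) ⊆ᵉ-refl x)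

  module _ {A : Set} where

    lookup-≔-elim : ∀ {k} {bs : Vec A k} {y : Fin k} {q} {P : Fin k → A → Set} →
                    P y q → (∀ i → i ≢ y → P i (lookup bs i)) → ∀ i → P i (lookup (bs [ y ]≔ q) i)
    lookup-≔-elim {bs = bs} {y} {q} {P} p r i with i Finₚ.≟ y
    ... | yes refl = subst (P i) (sym (lookup∘updateAt i bs)) p
    ... | no i≢y   = subst (P i) (sym (lookup∘updateAt′ i y i≢y bs)) (r i i≢y)

  -- ρ ⊢ ds ⊳ κ: κ extends ρ by values for the variables that ds binds.

  _⊢_⊳_ : ∀ {n} → Env n → ∀ ds → Env (ds ▷ n) → Set₁
  ρ ⊢ ds ⊳ κ = ∀ x → κ (lookup (embed ds) x) ≡ ρ x

  module Contexts (ι v : ℕ) where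
    open Model ι v

    ⊳-inner : ∀ {d n} (δ : Fin d → Pred) {ρ : Env n} ds κ → (δ ⧺ ρ) ⊢ ds ⊳ κ → ρ ⊢ (d ∷ ds) ⊳ κ
    ⊳-inner {d} δ {ρ} ds κ p x = trans (cong κ (lookup-⊙ (wk⋆ d) (embed ds) x))
      (trans (p (lookup (wk⋆ d) x)) (⧺-lookup-wk⋆ d δ ρ x))

    module _ {A : Set} where

      -- The premise speaks of all environments `κ` that extend `ρ`: nothing is known about the
      -- values bound on the way to the hole, but the variables in scope outside keep theirs. A step
      -- at the hole may thus rely on a binding of an outer letrec.
      ctx-⊑  : ∀ {ds n} (C : Ctx A ds n) {ρ u u′} → (∀ κ → ρ ⊢ ds ⊳ κ → u ∣ κ ⊑ u′ ∣ κ) →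
               plug C u ∣ ρ ⊑ plug C u′ ∣ ρ
      ctx-⊑ᵛ : ∀ {ds n k} (E : CtxVec A ds n k) {ρ u u′} → (∀ κ → ρ ⊢ ds ⊳ κ → u ∣ κ ⊑ u′ ∣ κ) →
               ⟦ plugVec E u ⟧ᵛ ρ ⊆ᵉ ⟦ plugVec E u′ ⟧ᵛ ρ
      ctx-⊑ᵃ : ∀ {ds n as} (E : CtxAlts A ds n as) {ρ u u′} → (∀ κ → ρ ⊢ ds ⊳ κ → u ∣ κ ⊑ u′ ∣ κ) →
               ∀ {b} (e : b ∈ as) δ → ⟦ plugAlts E u ⟧ᵃ ρ e δ ⊆ ⟦ plugAlts E u′ ⟧ᵃ ρ e δ
      ctx-⊑ hole {ρ} p = p ρ (λ x → cong ρ (lookup-id x))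
      ctx-⊑ (appˡ a C t) p = app-⊑ (ctx-⊑ C p) ⊆-refl
      ctx-⊑ (appʳ a s C) p = app-⊑ (⊑-mono s ⊆ᵉ-refl) (sem (ctx-⊑ C p))
      ctx-⊑ (lam {ds = ds} a C) p = lam-⊑ (λ U → sem (ctx-⊑ C (λ κ q → p κ (⊳-inner _ ds κ q))))
      ctx-⊑ (letrecᵉ {ds = ds} a E t) {u = u} p = letrec-⊑
        (λ {δ} {ε} q → ⊆ᵉ-trans (monoᵛ (plugVec E u) (⧺-mono q ⊆ᵉ-refl)) (ctx-⊑ᵛ E (λ κ r → p κ (⊳-inner ε ds κ r))))
        (λ q → mono t (⧺-mono q ⊆ᵉ-refl))
      ctx-⊑ (letrecᵇ {ds = ds} a bs C) {u = u} p = letrec-⊑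
        (λ q → monoᵛ bs (⧺-mono q ⊆ᵉ-refl))
        (λ {δ} {ε} q → ⊆-trans (mono (plug C u) (⧺-mono q ⊆ᵉ-refl)) (sem (ctx-⊑ C (λ κ r → p κ (⊳-inner ε ds κ r)))))
      ctx-⊑ (con a K c E) p = con-⊑ (ctx-⊑ᵛ E p)
      ctx-⊑ (seqˡ a C t) p = seq-⊑ (ctx-⊑ C p) ⊆-refl
      ctx-⊑ (seqʳ a s C) p = seq-⊑ (⊑-mono s ⊆ᵉ-refl) (sem (ctx-⊑ C p))
      ctx-⊑ (caseˢ a K C alts) p = case-⊑ (ctx-⊑ C p) (λ e δ → ⊆-refl)
      ctx-⊑ (caseᵃ a K s E) p = case-⊑ (⊑-mono s ⊆ᵉ-refl) (ctx-⊑ᵃ E p)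
      ctx-⊑ᵛ (here C ss) p zero    = sem (ctx-⊑ C p)
      ctx-⊑ᵛ (here C ss) p (suc i) = ⊆-refl
      ctx-⊑ᵛ (there s E) p zero    = ⊆-refl
      ctx-⊑ᵛ (there s E) p (suc i) = ctx-⊑ᵛ E p i
      ctx-⊑ᵃ (here {ds = ds} C alts) p (here refl) δ = sem (ctx-⊑ C (λ κ q → p κ (⊳-inner δ ds κ q)))
      ctx-⊑ᵃ (here C alts) p (there e)   δ = ⊆-refl
      ctx-⊑ᵃ (there s E) p (here refl) δ = ⊆-refl
      ctx-⊑ᵃ (there s E) p (there e)   δ = ctx-⊑ᵃ E p e δ

    binds-lookup : ∀ {A k n} (bs : Vec (Tm A (k + n)) k) {ρ δ} i → binds bs ρ δ i ≡ ⟦ lookup bs i ⟧ (δ ⧺ ρ)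
    binds-lookup bs i = ⟦⟧ᵛ-lookup bs _ i

    rec-≔ : ∀ {A k n} (bs : Vec (Tm A (k + n)) k) {ρ δ} {y : Fin k} {q} → ⟦ q ⟧ (δ ⧺ ρ) ⊆ δ y →
            (∀ i → i ≢ y → ⟦ lookup bs i ⟧ (δ ⧺ ρ) ⊆ δ i) → binds (bs [ y ]≔ q) ρ δ ⊆ᵉ δ
    rec-≔ bs {ρ} {δ} {y} {q} p r i = ⊆-trans (⊆-reflexive (binds-lookup (bs [ y ]≔ q) i))
      (lookup-≔-elim {bs = bs} {P = λ i s → ⟦ s ⟧ (δ ⧺ ρ) ⊆ δ i} p r i)

    rec-lookup⊆ : ∀ {A k n ρ} (bs : Vec (Tm A (k + n)) k) i → rec bs ρ i ⊆ ⟦ lookup bs i ⟧ (rec bs ρ ⧺ ρ)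
    rec-lookup⊆ bs i = ⊆-trans (rec-unfold bs i) (⊆-reflexive (binds-lookup bs i))

    rec-lookup⊇ : ∀ {A k n ρ} (bs : Vec (Tm A (k + n)) k) i → ⟦ lookup bs i ⟧ (rec bs ρ ⧺ ρ) ⊆ rec bs ρ i
    rec-lookup⊇ bs i = ⊆-trans (⊆-reflexive (sym (binds-lookup bs i))) (rec-closed bs i)

    -- An environment need not be upward closed in the cost, but a recursive value is the denotation
    -- of its binding, which is.
    rec-up : ∀ {A k n ρ} (bs : Vec (Tm A (k + n)) k) i {τ m m′} → m ≤ m′ → rec bs ρ i τ m → rec bs ρ i τ m′
    rec-up bs i l p = rec-lookup⊇ bs i _ _ (up (lookup bs i) l (rec-lookup⊆ bs i _ _ p))

    chain-⊆ : ∀ {A k n ρ x y} {bs : Vec (Tm A (k + n)) k} → Chain bs x y → rec bs ρ y ⊆ rec bs ρ x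
    chain-⊆ [] = ⊆-refl
    chain-⊆ {ρ = ρ} {bs = bs} (_∷ʳ_ {x} {y} c eq) τ m p
      with subst (λ s → ⟦ s ⟧ (rec bs ρ ⧺ ρ) τ m) eq (rec-lookup⊆ bs y τ m p)
    ... | m′ , q , l = rec-up bs _ (m+n≤o⇒n≤o v l)
      (chain-⊆ {bs = bs} c τ m′ (subst (λ d → d τ m′) (⧺-↑ˡ (rec bs ρ) ρ x) q))

    -- Each link of the chain is an indirection that charges `v`, so a token keeps its cost from the
    -- start of the chain to its end only for `v = 0`. The converse direction merely sheds charges.
    chain-⊇ : v ≡ 0 → ∀ {A k n ρ x y} {bs : Vec (Tm A (k + n)) k} → Chain bs x y → rec bs ρ x ⊆ rec bs ρ y
    chain-⊇ _ [] = ⊆-refl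
    chain-⊇ refl {ρ = ρ} {bs = bs} (_∷ʳ_ {x} {y} c eq) τ m p = rec-lookup⊇ bs y τ m
      (subst (λ s → ⟦ s ⟧ (rec bs ρ ⧺ ρ) τ m) (sym eq)
        (m , subst (λ d → d τ m) (sym (⧺-↑ˡ (rec bs ρ) ρ x)) (chain-⊇ refl {bs = bs} c τ m p) , ≤-refl))

    ⟦⟧ᵛ-++ˡ : ∀ {A n k k′} (ss : Vec (Tm A n) k) (ts : Vec (Tm A n) k′) ρ i →
              ⟦ ss ++ ts ⟧ᵛ ρ (i ↑ˡ k′) ≡ ⟦ ss ⟧ᵛ ρ i
    ⟦⟧ᵛ-++ˡ (s ∷ ss) ts ρ zero    = refl
    ⟦⟧ᵛ-++ˡ (s ∷ ss) ts ρ (suc i) = ⟦⟧ᵛ-++ˡ ss ts ρ i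

    ⟦⟧ᵛ-++ʳ : ∀ {A n k k′} (ss : Vec (Tm A n) k) (ts : Vec (Tm A n) k′) ρ j →
              ⟦ ss ++ ts ⟧ᵛ ρ (k ↑ʳ j) ≡ ⟦ ts ⟧ᵛ ρ j
    ⟦⟧ᵛ-++ʳ []       ts ρ j = refl
    ⟦⟧ᵛ-++ʳ (s ∷ ss) ts ρ j = ⟦⟧ᵛ-++ʳ ss ts ρ j

    binds-++ : ∀ {A k k′ n ρ} (ss : Vec (Tm A ((k + k′) + n)) k) (ts : Vec (Tm A ((k + k′) + n)) k′) {δ δ′} →
      ⟦ ss ⟧ᵛ ((δ ⧺ δ′) ⧺ ρ) ⊆ᵉ δ → ⟦ ts ⟧ᵛ ((δ ⧺ δ′) ⧺ ρ) ⊆ᵉ δ′ → binds (ss ++ ts) ρ (δ ⧺ δ′) ⊆ᵉ δ ⧺ δ′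
    binds-++ {k = k} {k′} {ρ = ρ} ss ts {δ} {δ′} p q = ∀-++ k
      (λ i → ⊆-trans (⊆-reflexive (⟦⟧ᵛ-++ˡ ss ts _ i)) (⊆-trans (p i) (⊆-reflexive (sym (⧺-↑ˡ δ δ′ i)))))
      (λ j → ⊆-trans (⊆-reflexive (⟦⟧ᵛ-++ʳ ss ts _ j)) (⊆-trans (q j) (⊆-reflexive (sym (⧺-↑ʳ k δ δ′ j)))))

    rec-++ˡ : ∀ {A k k′ n ρ} (ss : Vec (Tm A ((k + k′) + n)) k) (ts : Vec (Tm A ((k + k′) + n)) k′) →
              ∀ i → ⟦ ss ⟧ᵛ (rec (ss ++ ts) ρ ⧺ ρ) i ⊆ rec (ss ++ ts) ρ (i ↑ˡ k′)
    rec-++ˡ ss ts i = ⊆-trans (⊆-reflexive (sym (⟦⟧ᵛ-++ˡ ss ts _ i))) (rec-closed (ss ++ ts) (i ↑ˡ _))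

    rec-++ʳ : ∀ {A k k′ n ρ} (ss : Vec (Tm A ((k + k′) + n)) k) (ts : Vec (Tm A ((k + k′) + n)) k′) →
              ∀ j → ⟦ ts ⟧ᵛ (rec (ss ++ ts) ρ ⧺ ρ) j ⊆ rec (ss ++ ts) ρ (k ↑ʳ j)
    rec-++ʳ {k = k} ss ts j = ⊆-trans (⊆-reflexive (sym (⟦⟧ᵛ-++ʳ ss ts _ j))) (rec-closed (ss ++ ts) (k ↑ʳ j))

    ⟦⟧ᵛ-updateAt : ∀ {A n k κ} (bs : Vec (Tm A n) k) x {f} → (∀ s → ⟦ f s ⟧ κ ⊆ ⟦ s ⟧ κ) →
                   ⟦ bs [ x ]%= f ⟧ᵛ κ ⊆ᵉ ⟦ bs ⟧ᵛ κ
    ⟦⟧ᵛ-updateAt (b ∷ bs) zero    p zero    = p b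
    ⟦⟧ᵛ-updateAt (b ∷ bs) zero    p (suc i) = ⊆-refl
    ⟦⟧ᵛ-updateAt (b ∷ bs) (suc x) p zero    = ⊆-refl
    ⟦⟧ᵛ-updateAt (b ∷ bs) (suc x) p (suc i) = ⟦⟧ᵛ-updateAt bs x p i

    ⟦⟧ᵛ-≔ : ∀ {A n k κ} (bs : Vec (Tm A n) k) x {q} → ⟦ q ⟧ κ ⊆ ⟦ lookup bs x ⟧ κ →
            ⟦ bs [ x ]≔ q ⟧ᵛ κ ⊆ᵉ ⟦ bs ⟧ᵛ κ
    ⟦⟧ᵛ-≔ (b ∷ bs) zero    p zero    = p
    ⟦⟧ᵛ-≔ (b ∷ bs) zero    p (suc i) = ⊆-refl
    ⟦⟧ᵛ-≔ (b ∷ bs) (suc x) p zero    = ⊆-refl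
    ⟦⟧ᵛ-≔ (b ∷ bs) (suc x) p (suc i) = ⟦⟧ᵛ-≔ bs x p i

  -- Independence of the charges

  _≼_ : Pred → Pred → Set
  d ≼ e = ∀ τ n → d τ n → ∃ (e τ)

  _·_ : Pred → Pred → Pred
  (d · e) τ n = ∃ λ U → ∃ λ m → ∃ λ c → d (fun U τ m) c × ⟪ U ⟫ ⊆ e

  -- R τ d: d has the token τ hereditarily, whatever the costs.  This is the
  -- logical relation that turns tokens of one model into tokens of another.

  R  : Ty → Pred → Set₁
  Rˡ : List (Ty × ℕ) → Pred → Set₁
  R lam⋆        d = Level.Lift _ (∃ (d lam⋆))
  R (fun U τ m) d = Level.Lift (Level.suc Level.zero) (∃ (d lam⋆)) × (∀ e → Rˡ U e → R τ (d · e))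
  R (con K c Us) d = ∃ λ (es : Fin _ → Pred) → (∀ i → Rˡ (Us i) (es i)) ×
    (∀ Vs → (∀ i → ⟪ Vs i ⟫ ⊆ es i) → ∃ (d (con K c Vs)))
  Rˡ []            d = Level.Lift _ ⊤
  Rˡ ((σ , _) ∷ U) d = R σ d × Rˡ U d

  R-≼ : ∀ τ {d e} → d ≼ e → R τ d → R τ e
  R-≼ lam⋆         p (Level.lift (m , q)) = Level.lift (p lam⋆ m q)
  R-≼ (fun U τ m)  p (Level.lift (k , q) , r) = Level.lift (p lam⋆ k q) , λ e x →
    R-≼ τ (λ { _ n (V , l , c , y , z) → let c′ , y′ = p _ c y in n , V , l , c′ , y′ , z }) (r e x)
  R-≼ (con K c Us) p (es , q , r) = es , q , λ Vs x → let m , y = r Vs x in p _ m y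

  -- The `lam⋆` component of `R` at function tokens and the choice of empty lists at constructor
  -- tokens give a token without any argument at hand.
  R-inhabited : ∀ τ {d} → R τ d → ∃₂ d
  R-inhabited lam⋆         (Level.lift (m , p))     = lam⋆ , m , p
  R-inhabited (fun U τ m)  (Level.lift (k , p) , _) = lam⋆ , k , p
  R-inhabited (con K c Us) (es , _ , r)       = _ , r (λ _ → []) (λ _ _ _ ())

  Rˡ-tabulate : ∀ U {d} → (∀ τ n → (τ , n) ∈ U → R τ d) → Rˡ U d
  Rˡ-tabulate []            p = Level.lift tt
  Rˡ-tabulate ((σ , n) ∷ U) p = p σ n (here refl) , Rˡ-tabulate U (λ τ n x → p τ n (there x))

  Rˡ-lookup : ∀ {U d τ n} → Rˡ U d → (τ , n) ∈ U → R τ d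
  Rˡ-lookup (r , rs) (here refl) = r
  Rˡ-lookup (r , rs) (there x)   = Rˡ-lookup rs x

  module Transfer (ι₀ v₀ ι v : ℕ) where
    module F = Model ι₀ v₀
    open Model ι v

    _⊩_ : ∀ {k} → (Fin k → Pred) → (Fin k → Pred) → Set₁
    δ ⊩ ε = ∀ x τ n → δ x τ n → R τ (ε x)

    ⊩-⧺ : ∀ {k n} {δ ε : Fin k → Pred} {ρ σ : Env n} → δ ⊩ ε → ρ ⊩ σ → (δ ⧺ ρ) ⊩ (ε ⧺ σ)
    ⊩-⧺ {zero}  p q x       = q x
    ⊩-⧺ {suc k} p q zero    = p zero
    ⊩-⧺ {suc k} p q (suc x) = ⊩-⧺ (p ∘ suc) q x

    -- The induction on `s` contains one on the Kleene stages for letrec. Relatedness of an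
    -- abstraction quantifies over arbitrary predicates `e` as arguments, whereas a token lists
    -- finitely many requirements; `compact` closes this gap, and `compactᵃ` does so for the fields
    -- of a constructor.
    fund  : ∀ {A n ρ ρ′} (s : Tm A n) → ρ ⊩ ρ′ → ∀ τ m → F.⟦ s ⟧ ρ τ m → R τ (⟦ s ⟧ ρ′)
    fundᵛ : ∀ {A n k ρ ρ′} (ss : Vec (Tm A n) k) → ρ ⊩ ρ′ → F.⟦ ss ⟧ᵛ ρ ⊩ ⟦ ss ⟧ᵛ ρ′
    fundᵃ : ∀ {A n as ρ ρ′} (alts : Alts A n as) → ρ ⊩ ρ′ → ∀ {b} (e : b ∈ as) {δ ε} → δ ⊩ ε →
            ∀ τ m → F.⟦ alts ⟧ᵃ ρ e δ τ m → R τ (⟦ alts ⟧ᵃ ρ′ e ε)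
    fund (var a x) p τ m (k , q , _) = R-≼ τ (λ _ l y → v + l , l , y , ≤-refl) (p x τ k q)
    fund (app a s t) p τ m (U , k , c , x , y , _) = R-≼ τ
      (λ { _ _ (V , l , c′ , x′ , y′) → _ , V , l , c′ , x′ , y′ , ≤-refl })
      (proj₂ (fund s p _ c x) _ (Rˡ-tabulate U (λ σ n z → fund t p σ n (y σ n z))))
    fund (lam a s) p lam⋆ m x = Level.lift (0 , tt)
    fund {ρ′ = ρ′} (lam a s) p (fun U τ k) m x = Level.lift (0 , tt) , λ e r → R-≼ τ
      (λ _ l y → let Us , q , z = compact s (λ (_ : Fin 1) → e) _ l y in
         l , Us zero , l , 0 , mono s (⧺-mono {δ = λ i → ⟪ Us i ⟫} {ρ = ρ′} (λ { zero → ⊆-refl }) ⊆ᵉ-refl) _ l z , q zero)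
      (fund s (⊩-⧺ (λ { zero σ n z → Rˡ-lookup r z }) p) τ k x)
    fund {ρ = ρ} {ρ′} (letrec a bs t) p τ m (k , x , _) = R-≼ τ (λ _ l y → ι + l , l , y , ≤-refl)
      (fund t (⊩-⧺ (λ { i σ n (N , q) → stage N i σ n q }) p) τ k x)
      where
      stage : ∀ N → F.kleene (F.binds bs ρ) N ⊩ rec bs ρ′
      stage zero    i σ n ()
      stage (suc N) i σ n q = R-≼ σ (λ κ l z → l , rec-closed bs i κ l z)
        (fundᵛ bs (⊩-⧺ (stage N) p) i σ n q)
    fund {ρ′ = ρ′} (con a K c ss) p _ m (Us , refl , q) = ⟦ ss ⟧ᵛ ρ′ ,
      (λ i → Rˡ-tabulate (Us i) (λ σ n z → fundᵛ ss p i σ n (q i σ n z))) ,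
      (λ Vs x → 0 , Vs , refl , x)
    fund (seq a s t) p τ m (σ , k , c , x , y , _) = R-≼ τ
      (λ κ l z → let σ′ , c′ , x′ = R-inhabited σ (fund s p σ c x) in _ , σ′ , l , c′ , x′ , z , ≤-refl)
      (fund t p τ k y)
    fund {ρ′ = ρ′} (case a K s alts) p τ m (b , e , Us , k , c , x , y , _) with fund s p _ c x
    ... | es , q , r = R-≼ τ
      (λ κ l z → let Vs , w , z′ = compactᵃ alts e es κ l z ; c′ , x′ = r Vs w in
         _ , b , e , Vs , l , c′ , x′ , z′ , ≤-refl)
      (fundᵃ alts p e (λ i σ n z → Rˡ-lookup (q i) z) τ k y)
    fundᵛ (s ∷ ss) p zero    = fund s p
    fundᵛ (s ∷ ss) p (suc i) = fundᵛ ss p i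
    fundᵃ (s ∷ alts) p (here refl) q = fund s (⊩-⧺ q p)
    fundᵃ (s ∷ alts) p (there e)   q = fundᵃ alts p e q

    transfer : ∀ {A n} (s : Tm A n) → ∃₂ (F.⟦ s ⟧ ∅ᵉ) → ∃₂ (⟦ s ⟧ ∅ᵉ)
    transfer s (τ , m , p) = R-inhabited τ (fund s (λ _ _ _ ()) τ m p)

  -- Soundness of reduction in the cost-free model

  module Free where
    open Model 0 0
    open Substitution 0 0
    open Contexts 0 0

    free-⊑ : ∀ {A B m n} {s : Tm A m} {s′ : Tm B n} {ρ ρ′} → ⟦ s ⟧ ρ ⊆ ⟦ s′ ⟧ ρ′ → s ∣ ρ ⊑ s′ ∣ ρ′
    free-⊑ {s′ = s′} p = ⟨ ≤-trans (weight≤ι s′) z≤n , p ⟩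

    cost-zero : ∀ {A n} (s : Tm A n) m → cost s 0 m ≤ m
    cost-zero s m = ≤-trans (+-monoʳ-≤ m (≤-trans (≤-reflexive (+-identityʳ (weight s))) (weight≤ι s)))
                            (≤-reflexive (+-identityʳ m))

    ⊑-up : ∀ {A B m n} {s : Tm A m} {s′ : Tm B n} {ρ ρ′} →
           (∀ τ m → ⟦ s ⟧ ρ τ m → ∃ λ m′ → ⟦ s′ ⟧ ρ′ τ m′ × m′ ≤ m) → s ∣ ρ ⊑ s′ ∣ ρ′
    ⊑-up {s′ = s′} p = free-⊑ (λ τ m x → let m′ , y , l = p τ m x in up s′ l y)

    module _ {A : Set} {n} {ρ : Env n} where

      -- The argument is a predicate `es` below the denotation of `t`, so that the letrec made by
      -- (lbeta) and the substitution made by (beta) are both covered. `compact` finds the finite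
      -- list that the function token needs.
      beta-⊇ : ∀ a b s t (es : Fin 1 → Pred) → es zero ⊆ ⟦ t ⟧ ρ → s ∣ es ⧺ ρ ⊑ app {A} a (lam b s) t ∣ ρ
      beta-⊇ a b s t es p = free-⊑ (λ τ m x → let Us , q , y = compact s es τ m x in
        Us zero , m , 0 ,
        mono s (⧺-mono {δ = λ i → ⟪ Us i ⟫} {ρ = ρ} (λ { zero → ⊆-refl }) ⊆ᵉ-refl) τ m y ,
        ⊆-trans (q zero) p , cost-zero (lam {A} {n} b s) m)

      seq-⊇ : ∀ {a v s} → ∃ (λ σ → ⟦ v ⟧ ρ σ 0) → s ∣ ρ ⊑ seq {A} a v s ∣ ρ
      seq-⊇ {v = v} (σ , p) = free-⊑ (λ τ m x → σ , m , 0 , p , x , cost-zero v m)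

      -- The scrutinee `u` is known only through its constructor tokens, which covers a variable
      -- that leads to a shared constructor as well as the constructor itself.
      case-⊇ : ∀ a {K b} u alts (c : b ∈ arities K) (es : Fin b → Pred) →
               (∀ Us → (∀ i → ⟪ Us i ⟫ ⊆ es i) → ⟦ u ⟧ ρ (con K c Us) 0) →
               All.lookup alts c ∣ es ⧺ ρ ⊑ case {A} a K u alts ∣ ρ
      case-⊇ a u alts c es p = free-⊑ (λ τ m x →
        let Us , q , y = compactᵃ alts c es τ m (subst (λ d → d τ m) (sym (⟦⟧ᵃ-lookup alts ρ c es)) x) in
        _ , c , Us , m , 0 , p Us q , y , cost-zero u m)

      value-inhabited : ∀ {v : Tm A n} → Value v → ∃ λ σ → ⟦ v ⟧ ρ σ 0
      value-inhabited lam = lam⋆ , tt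
      value-inhabited con = _ , (λ _ → []) , refl , λ _ _ _ ()

    module _ {A : Set} (a₀ : A) where
      open TermSubst (termSubst a₀) using (_/Var_; varLift)
      open Traversal {A} varLift using (_/Vec_; _/Alts_)
      open Renaming a₀

      module _ {n k} {ρ : Env n} (δ : Fin k → Pred) where

        wk-⊇ : ∀ t → t /Var wk⋆ k ∣ δ ⧺ ρ ⊑ t ∣ ρ
        wk-⊇ t = ren-⊒ t (λ x → ⊆-reflexive (⧺-lookup-wk⋆ k δ ρ x))

        wk-⊇ᵛ : ∀ {j} (ts : Vec (Tm A n) j) → ⟦ ts /Vec wk⋆ k ⟧ᵛ (δ ⧺ ρ) ⊆ᵉ ⟦ ts ⟧ᵛ ρ
        wk-⊇ᵛ ts = ren-⊒ᵛ ts (λ x → ⊆-reflexive (⧺-lookup-wk⋆ k δ ρ x))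

        wk-⊇ᵃ : ∀ {as} (alts : Alts A n as) {b} (e : b ∈ as) ε →
                ⟦ alts /Alts wk⋆ k ⟧ᵃ (δ ⧺ ρ) e ε ⊆ ⟦ alts ⟧ᵃ ρ e ε
        wk-⊇ᵃ alts = ren-⊒ᵃ alts (λ x → ⊆-reflexive (⧺-lookup-wk⋆ k δ ρ x))

      module _ {n} {ρ : Env n} {a b c : A} where

        lbeta-⊇ : ∀ {s t} → letrec a (t /Var wk⋆ 1 ∷ []) s ∣ ρ ⊑ app b (lam c s) t ∣ ρ
        lbeta-⊇ {s} {t} = ⊑-up (λ τ m (j , x , l) → j ,
          sem (beta-⊇ b c s t δ (⊆-trans (rec-unfold bs zero) (sem (wk-⊇ δ t)))) τ j x , l)
          where
          bs = t /Var wk⋆ 1 ∷ []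
          δ = rec bs ρ

        case-c-⊇ : ∀ {K k} (e : suc k ∈ arities K) ss alts →
                   letrec a (ss /Vec wk⋆ (suc k)) (All.lookup alts e) ∣ ρ ⊑ case b K (con c K e ss) alts ∣ ρ
        case-c-⊇ {k = k} e ss alts = ⊑-up (λ τ m (j , x , l) → j ,
          sem (case-⊇ b (con c _ e ss) alts e δ
            (λ Us q → Us , refl , λ i → ⊆-trans (q i) (⊆-trans (rec-unfold bs i) (wk-⊇ᵛ δ ss i)))) τ j x , l)
          where
          bs = ss /Vec wk⋆ (suc k)
          δ = rec bs ρ

        module _ {k} (bs : Vec (Tm A (suc k + n)) (suc k)) {s : Tm A (suc k + n)} where
          private δ = rec bs ρ

          lapp-⊇ : ∀ {d t} → letrec a bs (app b s (t /Var wk⋆ (suc k))) ∣ ρ ⊑ app c (letrec d bs s) t ∣ ρ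
          lapp-⊇ {d} {t} = free-⊑ (λ τ m (j , (U , l , i , x , y , z) , w) →
            U , l , i , (i , x , ≤-refl) , ⊆-trans y (sem (wk-⊇ δ t)) ,
            ≤-trans (cost-mono {s = s} {letrec d bs s} z≤n i l) (≤-trans z w))

          lseq-⊇ : ∀ {d t} → letrec a bs (seq b s (t /Var wk⋆ (suc k))) ∣ ρ ⊑ seq c (letrec d bs s) t ∣ ρ
          lseq-⊇ {d} {t} = free-⊑ (λ τ m (j , (U , l , i , x , y , z) , w) →
            U , l , i , (i , x , ≤-refl) , sem (wk-⊇ δ t) _ _ y ,
            ≤-trans (cost-mono {s = s} {letrec d bs s} z≤n i l) (≤-trans z w))

          lcase-⊇ : ∀ {d K alts} → letrec a bs (case b K s (alts /Alts wk⋆ (suc k))) ∣ ρ ⊑ case c K (letrec d bs s) alts ∣ ρ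
          lcase-⊇ {d} {alts = alts} = free-⊑ (λ τ m (j , (f , e , Us , l , i , x , y , z) , w) →
            f , e , Us , l , i , (i , x , ≤-refl) , wk-⊇ᵃ δ alts e _ _ _ y ,
            ≤-trans (cost-mono {s = s} {letrec d bs s} z≤n i l) (≤-trans z w))

      embed-⊇ : ∀ {n ds} {ρ : Env n} {κ} t → ρ ⊢ ds ⊳ κ → t /Var embed ds ∣ κ ⊑ t ∣ ρ
      embed-⊇ t r = ren-⊒ t (λ x → ⊆-reflexive (r x))

    module _ {A : Set} {n k} {ρ : Env n} {a b : A} (bs : Vec (Tm A (suc k + n)) (suc k)) where

      letrec-body-⊇ : ∀ {t t′} → t′ ∣ rec bs ρ ⧺ ρ ⊑ t ∣ rec bs ρ ⧺ ρ → letrec a bs t′ ∣ ρ ⊑ letrec b bs t ∣ ρ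
      letrec-body-⊇ p = free-⊑ (λ τ m (j , x , y) → j , sem p τ j x , y)

      -- Fixed-point induction: if the new binding denotes no more than the old one in the old
      -- solution, that solution is closed under the changed bindings and so contains their least
      -- one.
      letrec-≔-⊇ : ∀ {y q t} → q ∣ rec bs ρ ⧺ ρ ⊑ lookup bs y ∣ rec bs ρ ⧺ ρ →
                   letrec a (bs [ y ]≔ q) t ∣ ρ ⊑ letrec b bs t ∣ ρ
      letrec-≔-⊇ {y} {q} {t} p = free-⊑ (λ τ m (j , x , z) → j , mono t (⧺-mono least ⊆ᵉ-refl) τ j x , z)
        where
        least : rec (bs [ y ]≔ q) ρ ⊆ᵉ rec bs ρ
        least = rec-least (bs [ y ]≔ q)
          (rec-≔ bs (⊆-trans (sem p) (rec-lookup⊇ bs y)) (λ i _ → rec-lookup⊇ bs i))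

    chain-occ-⊇ : ∀ {A k n x y u} {a : A} {ρ : Env n} (bs : Vec (Tm A (k + n)) k) → lookup bs x ≡ u → Chain bs x y →
                  ∀ ds {κ} → (rec bs ρ ⧺ ρ) ⊢ ds ⊳ κ → u ∣ rec bs ρ ⧺ ρ ⊑ occ a ds y ∣ κ
    chain-occ-⊇ {x = x} {y} {ρ = ρ} bs refl c ds r = free-⊑ (λ τ m p →
      m , subst (λ d → d τ m) (sym (trans (r (y ↑ˡ _)) (⧺-↑ˡ (rec bs ρ) ρ y)))
            (chain-⊇ refl {bs = bs} c τ m (rec-lookup⊇ bs x τ m p)) , ≤-refl)

  -- Soundness of the call-by-need rules

  module NeedSoundness where
    open Model 0 0
    open Substitution 0 0
    open Contexts 0 0
    open Free
    open Need
    open TermSubst (termSubst ∅) using (_/Var_; varLift)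
    open Traversal {Label} varLift using (_/Vec_; _/Alts_)
    open Renaming ∅

    plug-/Ctx     : ∀ {ds m n} (C : LCtx ds m) (σ : Sub Fin m n) u →
                    plug (C /Ctx σ) (u /Var (σ ↑ᵈ ds)) ≡ plug C u /Var σ
    plugVec-/Ctx  : ∀ {ds m n k} (E : CtxVec Label ds m k) (σ : Sub Fin m n) u →
                    plugVec (E /CtxVec σ) (u /Var (σ ↑ᵈ ds)) ≡ plugVec E u /Vec σ
    plugAlts-/Ctx : ∀ {ds m n as} (E : CtxAlts Label ds m as) (σ : Sub Fin m n) u →
                    plugAlts (E /CtxAlts σ) (u /Var (σ ↑ᵈ ds)) ≡ plugAlts E u /Alts σ
    plug-/Ctx hole             σ u = refl
    plug-/Ctx (appˡ a C t)     σ u = cong (λ z → app a z (t /Var σ)) (plug-/Ctx C σ u)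
    plug-/Ctx (appʳ a s C)     σ u = cong (app a (s /Var σ)) (plug-/Ctx C σ u)
    plug-/Ctx (lam a C)        σ u = cong (lam a) (plug-/Ctx C (σ ↑⋆ 1) u)
    plug-/Ctx (letrecᵉ {k = k} a E t)  σ u = cong (λ z → letrec a z (t /Var (σ ↑⋆ suc k))) (plugVec-/Ctx E (σ ↑⋆ suc k) u)
    plug-/Ctx (letrecᵇ {k = k} a bs C) σ u = cong (letrec a (bs /Vec (σ ↑⋆ suc k))) (plug-/Ctx C (σ ↑⋆ suc k) u)
    plug-/Ctx (con a K c E)    σ u = cong (con a K c) (plugVec-/Ctx E σ u)
    plug-/Ctx (seqˡ a C t)     σ u = cong (λ z → seq a z (t /Var σ)) (plug-/Ctx C σ u)
    plug-/Ctx (seqʳ a s C)     σ u = cong (seq a (s /Var σ)) (plug-/Ctx C σ u)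
    plug-/Ctx (caseˢ a K C alts) σ u = cong (λ z → case a K z (alts /Alts σ)) (plug-/Ctx C σ u)
    plug-/Ctx (caseᵃ a K s E)  σ u = cong (case a K (s /Var σ)) (plugAlts-/Ctx E σ u)
    plugVec-/Ctx (here C ss) σ u = cong (_∷ (ss /Vec σ)) (plug-/Ctx C σ u)
    plugVec-/Ctx (there s E) σ u = cong (s /Var σ ∷_) (plugVec-/Ctx E σ u)
    plugAlts-/Ctx (here {a = a} C alts) σ u = cong (_∷ (alts /Alts σ)) (plug-/Ctx C (σ ↑⋆ a) u)
    plugAlts-/Ctx (there {a = a} s E)   σ u = cong (s /Var (σ ↑⋆ a) ∷_) (plugAlts-/Ctx E σ u)

    lookup-/Alts : ∀ {m n as b} (alts : Alts Label m as) (σ : Sub Fin m n) (c : b ∈ as) →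
                   All.lookup (alts /Alts σ) c ≡ All.lookup alts c /Var (σ ↑⋆ b)
    lookup-/Alts (s ∷ alts) σ (here refl) = refl
    lookup-/Alts (s ∷ alts) σ (there c)   = lookup-/Alts alts σ c

    upᵛ : ∀ {A n k} (ss : Vec (Tm A n) k) i {ρ τ m m′} → m ≤ m′ → ⟦ ss ⟧ᵛ ρ i τ m → ⟦ ss ⟧ᵛ ρ i τ m′
    upᵛ (s ∷ ss) zero    = up s
    upᵛ (s ∷ ss) (suc i) = upᵛ ss i

    ys-⊆ : ∀ k {k′ n} {κ : Env ((k + k′) + n)} {d : Fin k → Pred} →
           (∀ i {τ m m′} → m ≤ m′ → d i τ m → d i τ m′) →
           (∀ i → κ ((i ↑ˡ k′) ↑ˡ n) ⊆ d i) → ⟦ ys k {k′} {n} ⟧ᵛ κ ⊆ᵉ d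
    ys-⊆ k {k′} {n} {κ} u p i τ m x
      with subst (λ s → ⟦ s ⟧ κ τ m) (lookup∘tabulate (λ i → var ∅ ((i ↑ˡ k′) ↑ˡ n)) i)
             (subst (λ e → e τ m) (⟦⟧ᵛ-lookup (ys k {k′} {n}) κ i) x)
    ... | m′ , q , l = u i l (p i τ m′ q)

    -- The candidate `η` gives the fresh variable of each field the meaning of that field in the old
    -- letrec and keeps the old values otherwise. It is closed under the split bindings, hence
    -- contains their least solution.
    module Split {n k′ b K} (c : suc b ∈ arities K) (ss : Vec (LTm (k′ + n)) (suc b)) (bs : Vec (LTm (k′ + n)) k′)
                 {x₁ : Fin k′} (eq : lookup bs x₁ ≡ con S K c ss) (ρ : Env n) where

      δ : Fin k′ → Pred
      δ = rec bs ρ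

      δ′ : Fin (suc b) → Pred
      δ′ = ⟦ ss ⟧ᵛ (δ ⧺ ρ)

      η : Fin (suc b + k′) → Pred
      η = δ′ ⧺ δ

      σ : Sub Fin (k′ + n) ((suc b + k′) + n)
      σ = insert (suc b) k′ n

      η-ys : ⟦ ys (suc b) {k′} {n} ⟧ᵛ (η ⧺ ρ) ⊆ᵉ δ′
      η-ys = ys-⊆ (suc b) (λ i → upᵛ ss i) (λ i → ⊆-reflexive (trans (⧺-↑ˡ η ρ (i ↑ˡ k′)) (⧺-↑ˡ δ′ δ i)))

      split-⊆ : binds (split c x₁ ss bs) ρ η ⊆ᵉ η
      split-⊆ = binds-++ (ss /Vec σ) _ (ren-⊒ᵛ ss (⧺-insert-⊆ δ′ δ ρ))
        (λ j → ⊆-trans (⊆-reflexive (⟦⟧ᵛ-lookup ((bs /Vec σ) [ x₁ ]≔ con ∅ K c (ys (suc b))) _ j))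
          (lookup-≔-elim {bs = bs /Vec σ} {P = λ i s → ⟦ s ⟧ (η ⧺ ρ) ⊆ δ i}
            (⊆-trans (sem (con-⊑ {ρ = η ⧺ ρ} {δ ⧺ ρ} {∅} {S} {ss = ys (suc b)} {ss} η-ys))
              (⊆-trans (⟦⟧-≡ (sym eq)) (rec-lookup⊇ bs x₁)))
            (λ i _ → ⊆-trans (⊆-reflexive (sym (⟦⟧ᵛ-lookup (bs /Vec σ) _ i)))
              (⊆-trans (ren-⊒ᵛ bs (⧺-insert-⊆ δ′ δ ρ) i) (rec-closed bs i))) j))

      module _ {xₘ} (ch : Chain bs x₁ xₘ) {ds} (C : LCtx ds (k′ + n))
               (a : Label) (alts : Alts Label (ds ▷ (k′ + n)) (arities K)) where

        redex : LTm (ds ▷ (k′ + n))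
        redex = case a K (occ V ds xₘ) alts

        -- The comparison is with the redex renamed into the larger scope. By `plug-/Ctx` the
        -- context can then be renamed along with it, and both sides share one context.
        rebind-⊑ : ∀ κ → (η ⧺ ρ) ⊢ ds ⊳ κ →
                   rebind b k′ n ds (All.lookup alts c) ∣ κ ⊑ redex /Var (σ ↑ᵈ ds) ∣ κ
        rebind-⊑ κ r = ⊑-up (λ τ m (j , x , l) → j , sem (case-⊇ a scrut (alts /Alts (σ ↑ᵈ ds)) c δ′ known) τ j
          (subst (λ s → ⟦ s ⟧ (δ′ ⧺ κ) τ j) (sym (lookup-/Alts alts (σ ↑ᵈ ds) c))
            (mono (All.lookup alts c /Var (σ ↑ᵈ ds ↑⋆ suc b)) (⧺-mono zs-⊆ ⊆ᵉ-refl) τ j x)) , l)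
          where
          scrut : LTm (ds ▷ ((suc b + k′) + n))
          scrut = occ V ds xₘ /Var (σ ↑ᵈ ds)
          zs = ys (suc b) /Vec (embed ds ⊙ wk⋆ (suc b))
          zs-⊆ : rec zs κ ⊆ᵉ δ′
          zs-⊆ = rec-least zs (λ i → ⊆-trans (ren-⊒ᵛ (ys (suc b))
            (λ x → ⊆-reflexive (trans (cong (δ′ ⧺ κ) (lookup-⊙ (embed ds) (wk⋆ (suc b)) x))
              (trans (⧺-lookup-wk⋆ (suc b) δ′ κ _) (r x)))) i) (η-ys i))
          position : κ (lookup (σ ↑ᵈ ds) (lookup (embed ds) (xₘ ↑ˡ n))) ≡ δ xₘ
          position = trans (cong κ (lookup-embed-↑ᵈ ds σ (xₘ ↑ˡ n)))
            (trans (r _) (trans (cong (η ⧺ ρ) (lookup-insert-↑ˡ (suc b) k′ n xₘ))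
              (trans (⧺-↑ˡ η ρ (suc b ↑ʳ xₘ)) (⧺-↑ʳ (suc b) δ′ δ xₘ))))
          known : ∀ Us → (∀ i → ⟪ Us i ⟫ ⊆ δ′ i) → ⟦ scrut ⟧ κ (con K c Us) 0
          known Us q = 0 , subst (λ d → d (con K c Us) 0) (sym position)
            (chain-⊇ refl {bs = bs} ch _ 0 (rec-lookup⊇ bs x₁ _ 0
              (subst (λ s → ⟦ s ⟧ (δ ⧺ ρ) (con K c Us) 0) (sym eq) (Us , refl , q)))) , z≤n

        plug-rebind-⊑ : plug (C /Ctx σ) (rebind b k′ n ds (All.lookup alts c)) ∣ η ⧺ ρ ⊑ plug C redex ∣ δ ⧺ ρ
        plug-rebind-⊑ = ⊑-trans (ctx-⊑ (C /Ctx σ) rebind-⊑)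
          (subst (λ s → s ∣ η ⧺ ρ ⊑ plug C redex ∣ δ ⧺ ρ) (sym (plug-/Ctx C σ redex))
            (ren-⊒ (plug C redex) (⧺-insert-⊆ δ′ δ ρ)))

    -- One half of Bekić's principle: the nested least solutions, put side by side, are closed under
    -- the flattened bindings.
    module Flatten {n k₁ k₂} (bs₁ : Vec (LTm (suc k₁ + n)) (suc k₁)) (bs₂ : Vec (LTm (suc k₂ + (suc k₁ + n))) (suc k₂))
                   (ρ : Env n) where

      σ : Sub Fin (suc k₁ + n) ((suc k₂ + suc k₁) + n)
      σ = insert (suc k₂) (suc k₁) n

      α : Sub Fin (suc k₂ + (suc k₁ + n)) ((suc k₂ + suc k₁) + n)
      α = reassoc (suc k₂) (suc k₁) n

      δ : Fin (suc k₁) → Pred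
      δ = rec bs₁ ρ

      δ′ : Fin (suc k₂) → Pred
      δ′ = rec bs₂ (δ ⧺ ρ)

      inner : ⟦ bs₂ /Vec α ⟧ᵛ ((δ′ ⧺ δ) ⧺ ρ) ⊆ᵉ δ′
      inner = ⊆ᵉ-trans (ren-⊒ᵛ bs₂ (⧺-assoc-⊆ δ′ δ ρ)) (rec-closed bs₂)

      outer : ⟦ bs₁ /Vec σ ⟧ᵛ ((δ′ ⧺ δ) ⧺ ρ) ⊆ᵉ δ
      outer = ⊆ᵉ-trans (ren-⊒ᵛ bs₁ (⧺-insert-⊆ δ′ δ ρ)) (rec-closed bs₁)

      llet-in-⊇ : ∀ {a b c} s → letrec a ((bs₂ /Vec α) ++ (bs₁ /Vec σ)) (s /Var α) ∣ ρ ⊑ letrec b bs₁ (letrec c bs₂ s) ∣ ρ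
      llet-in-⊇ s = free-⊑ (λ τ m (j , x , l) → j ,
        (j , sem (ren-⊒ s (⧺-assoc-⊆ δ′ δ ρ)) τ j (mono (s /Var α) (⧺-mono least ⊆ᵉ-refl) τ j x) , ≤-refl) , l)
        where
        least : rec ((bs₂ /Vec α) ++ (bs₁ /Vec σ)) ρ ⊆ᵉ δ′ ⧺ δ
        least = rec-least ((bs₂ /Vec α) ++ (bs₁ /Vec σ)) (binds-++ (bs₂ /Vec α) (bs₁ /Vec σ) inner outer)

      llet-e-⊇ : ∀ {a b c} x s t → lookup bs₁ x ≡ letrec c bs₂ s →
                 letrec a ((bs₂ /Vec α) ++ ((bs₁ /Vec σ) [ x ]≔ (s /Var α))) (t /Var σ) ∣ ρ ⊑ letrec b bs₁ t ∣ ρ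
      llet-e-⊇ y s t eq = free-⊑ (λ τ m (j , x , l) → j ,
        sem (ren-⊒ t (⧺-insert-⊆ δ′ δ ρ)) τ j (mono (t /Var σ) (⧺-mono least ⊆ᵉ-refl) τ j x) , l)
        where
        bs₁′ = (bs₁ /Vec σ) [ y ]≔ (s /Var α)
        at-y : ⟦ s /Var α ⟧ ((δ′ ⧺ δ) ⧺ ρ) ⊆ δ y
        at-y τ m q = rec-lookup⊇ bs₁ y τ m (subst (λ s → ⟦ s ⟧ (δ ⧺ ρ) τ m) (sym eq)
          (m , sem (ren-⊒ s (⧺-assoc-⊆ δ′ δ ρ)) τ m q , ≤-refl))
        outer′ : ⟦ bs₁′ ⟧ᵛ ((δ′ ⧺ δ) ⧺ ρ) ⊆ᵉ δ
        outer′ i = ⊆-trans (⊆-reflexive (⟦⟧ᵛ-lookup bs₁′ _ i))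
          (lookup-≔-elim {bs = bs₁ /Vec σ} {P = λ i s → ⟦ s ⟧ ((δ′ ⧺ δ) ⧺ ρ) ⊆ δ i} at-y
            (λ i _ → ⊆-trans (⊆-reflexive (sym (⟦⟧ᵛ-lookup (bs₁ /Vec σ) _ i))) (outer i)) i)
        least : rec ((bs₂ /Vec α) ++ bs₁′) ρ ⊆ᵉ δ′ ⧺ δ
        least = rec-least ((bs₂ /Vec α) ++ bs₁′) (binds-++ (bs₂ /Vec α) bs₁′ inner outer′)

    module _ {n k} {ρ : Env n} (bs : Vec (LTm (suc k + n)) (suc k)) where

      redex-e-⊇ : ∀ {ds a b} y (C : LCtx ds (suc k + n)) {u u′ t} →
                  lookup bs y ≡ plug C u → (∀ κ → (rec bs ρ ⧺ ρ) ⊢ ds ⊳ κ → u′ ∣ κ ⊑ u ∣ κ) →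
                  letrec a (bs [ y ]≔ plug C u′) t ∣ ρ ⊑ letrec b bs t ∣ ρ
      redex-e-⊇ y C {u′ = u′} eq p = letrec-≔-⊇ bs
        (subst (λ s → plug C u′ ∣ rec bs ρ ⧺ ρ ⊑ s ∣ rec bs ρ ⧺ ρ) (sym eq) (ctx-⊑ C p))

      redex-in-⊇ : ∀ {ds a b} (C : LCtx ds (suc k + n)) {u u′} →
                   (∀ κ → (rec bs ρ ⧺ ρ) ⊢ ds ⊳ κ → u′ ∣ κ ⊑ u ∣ κ) →
                   letrec a bs (plug C u′) ∣ ρ ⊑ letrec b bs (plug C u) ∣ ρ
      redex-in-⊇ C p = letrec-body-⊇ bs (ctx-⊑ C p)

      module _ {x₁ xₘ ar K} {c : ar ∈ arities K} {ss} (eq : lookup bs x₁ ≡ con S K c ss) (ch : Chain bs x₁ xₘ) where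

        known-⊇ : ∀ {a : Label} ds κ → (rec bs ρ ⧺ ρ) ⊢ ds ⊳ κ → ∀ Us → (∀ i → ⟪ Us i ⟫ ⊆ ⟦ ss ⟧ᵛ (rec bs ρ ⧺ ρ) i) →
                  ⟦ occ a ds xₘ ⟧ κ (con K c Us) 0
        known-⊇ {a} ds κ r Us q = sem (chain-occ-⊇ {a = a} bs eq ch ds {κ} r) _ 0 (Us , refl , q)

        seq-known-⊇ : ∀ {a b : Label} ds {s} κ → (rec bs ρ ⧺ ρ) ⊢ ds ⊳ κ → s ∣ κ ⊑ seq a (occ b ds xₘ) s ∣ κ
        seq-known-⊇ {b = b} ds κ r = seq-⊇ (_ , known-⊇ {b} ds κ r (λ _ → []) (λ _ _ _ ()))

      case-known-⊇ : ∀ {x₁ xₘ K} {c : 0 ∈ arities K} → lookup bs x₁ ≡ con S K c [] → Chain bs x₁ xₘ →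
                     ∀ {a b : Label} ds {alts} κ → (rec bs ρ ⧺ ρ) ⊢ ds ⊳ κ →
                     All.lookup alts c ∣ κ ⊑ case a K (occ b ds xₘ) alts ∣ κ
      case-known-⊇ {c = c} eq ch {a} {b} ds {alts} κ r =
        case-⊇ a (occ b ds _) alts c (λ ()) (λ Us _ → known-⊇ eq ch {b} ds κ r Us (λ ()))

    -- A contraction is sound wherever its redex lies, so it does not matter how the labelling found
    -- it. Rules that use a binding are compared in the solution `rec bs ρ` of the letrec; rules
    -- that add bindings use the candidates of `Split` and `Flatten`.
    ↦-⊇ : ∀ {n} {l l′ : LTm n} → l ↦ l′ → ∀ ρ → l′ ∣ ρ ⊑ l ∣ ρ
    ↦-⊇ (lbeta C s t) ρ = ctx-⊑ C (λ κ _ → lbeta-⊇ ∅)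
    ↦-⊇ (cp-in {ds = ds} bs C {s} eq ch) ρ = redex-in-⊇ bs C (λ κ r →
      ⊑-trans (embed-⊇ ∅ {ds = ds} (lam ∅ s) r) (⊑-trans (lam-⊑ (λ U → ⊆-refl)) (chain-occ-⊇ bs eq ch ds r)))
    ↦-⊇ (cp-e {ds = ds} bs {y = y} C {s} t eq ch _ eq′) ρ = redex-e-⊇ bs y C eq′ (λ κ r →
      ⊑-trans (embed-⊇ ∅ {ds = ds} (lam ∅ s) r) (⊑-trans (lam-⊑ (λ U → ⊆-refl)) (chain-occ-⊇ bs eq ch ds r)))
    ↦-⊇ (lapp C bs s t) ρ = ctx-⊑ C (λ κ _ → lapp-⊇ ∅ bs)
    ↦-⊇ (lcase C bs s alts) ρ = ctx-⊑ C (λ κ _ → lcase-⊇ ∅ bs)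
    ↦-⊇ (lseq C bs s t) ρ = ctx-⊑ C (λ κ _ → lseq-⊇ ∅ bs)
    ↦-⊇ (llet-in bs₁ bs₂ s) ρ = Flatten.llet-in-⊇ bs₁ bs₂ ρ s
    ↦-⊇ (llet-e bs₁ x bs₂ s t eq) ρ = Flatten.llet-e-⊇ bs₁ bs₂ ρ x s t eq
    ↦-⊇ (seq-c C s v _) ρ = ctx-⊑ C (λ κ _ → seq-⊇ (value-inhabited v))
    ↦-⊇ (seq-in {ds = ds} bs C s eq ch) ρ = redex-in-⊇ bs C (seq-known-⊇ bs eq ch ds)
    ↦-⊇ (seq-e {ds = ds} bs {y = y} C s t eq ch _ eq′) ρ = redex-e-⊇ bs y C eq′ (seq-known-⊇ bs eq ch ds)
    ↦-⊇ (case-c₀ C {a} c alts) ρ = ctx-⊑ C (λ κ _ → case-⊇ a (con S _ c []) alts c (λ ()) (λ Us q → Us , refl , λ ()))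
    ↦-⊇ (case-c C c ss alts) ρ = ctx-⊑ C (λ κ _ → case-c-⊇ ∅ c ss alts)
    ↦-⊇ (case-in₀ {ds = ds} bs C c alts eq ch) ρ = redex-in-⊇ bs C (case-known-⊇ bs eq ch ds)
    ↦-⊇ {n} (case-in {k = k} {ds} bs C {a′} {b} c ss alts eq ch) ρ = free-⊑ (λ τ m (j , x , l) → j ,
      sem (plug-rebind-⊑ ch C a′ alts) τ j
        (mono (plug (C /Ctx σ) (rebind b (suc k) n ds (All.lookup alts c))) (⧺-mono least ⊆ᵉ-refl) τ j x) , l)
      where
      open Split c ss bs eq ρ
      least : rec (split c _ ss bs) ρ ⊆ᵉ η
      least = rec-least (split c _ ss bs) split-⊆
    ↦-⊇ (case-e₀ {ds = ds} bs {u = u} C c alts t eq ch _ eq′) ρ = redex-e-⊇ bs u C eq′ (case-known-⊇ bs eq ch ds)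
    ↦-⊇ {n} (case-e {k = k} {ds} bs {u = u} C {a′} {b} c ss alts t eq ch _ eq′) ρ = free-⊑ (λ τ m (j , x , l) → j ,
      sem (ren-⊒ t (⧺-insert-⊆ δ′ δ ρ)) τ j (mono (t /Var σ) (⧺-mono (rec-least bs′ least) ⊆ᵉ-refl) τ j x) , l)
      where
      open Split c ss bs eq ρ
      q = plug (C /Ctx σ) (rebind b (suc k) n ds (All.lookup alts c))
      bs′ = split c _ ss bs [ suc b ↑ʳ u ]≔ q
      least : binds bs′ ρ η ⊆ᵉ η
      least = rec-≔ (split c _ ss bs) {δ = η} {y = suc b ↑ʳ u} {q}
        (⊆-trans (sem (plug-rebind-⊑ ch C a′ alts)) (⊆-trans (⟦⟧-≡ (sym eq′))
          (⊆-trans (rec-lookup⊇ bs u) (⊆-reflexive (sym (⧺-↑ʳ (suc b) δ′ δ u))))))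
        (λ i _ → ⊆-trans (⊆-reflexive (sym (binds-lookup (split c _ ss bs) i))) (split-⊆ i))

  -- Convergent terms have tokens

  module FreeSoundness where
    open Model 0 0
    open Substitution 0 0
    open Contexts 0 0
    open Free

    Inhabited : ∀ {A n} → Tm A n → Set
    Inhabited s = ∃₂ (⟦ s ⟧ ∅ᵉ)

    inhabited-⊑ : ∀ {A B n} {s : Tm A n} {t : Tm B n} → s ∣ ∅ᵉ ⊑ t ∣ ∅ᵉ → Inhabited s → Inhabited t
    inhabited-⊑ p (τ , m , x) = τ , m , sem p τ m x

    module _ where
      open Need

      ^-⊑ : ∀ {n} (s : LTm n) {l ρ} → s ^ l ∣ ρ ⊑ s ∣ ρ
      ^-⊑ (var a x)         = ⟨ ≤-refl , ⊆-refl ⟩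
      ^-⊑ (app a s t)       = ⟨ ≤-refl , ⊆-refl ⟩
      ^-⊑ (lam a s)         = ⟨ ≤-refl , ⊆-refl ⟩
      ^-⊑ (letrec a bs t)   = ⟨ ≤-refl , ⊆-refl ⟩
      ^-⊑ (con a K c ss)    = ⟨ ≤-refl , ⊆-refl ⟩
      ^-⊑ (seq a s t)       = ⟨ ≤-refl , ⊆-refl ⟩
      ^-⊑ (case a K s alts) = ⟨ ≤-refl , ⊆-refl ⟩

      module _ {n k : ℕ} {a b : Label} {ρ : Env n} where

        relabel-binds-⊑ : ∀ (bs bs′ : Vec (LTm (suc k + n)) (suc k)) {t t′} →
          (∀ κ → ⟦ bs ⟧ᵛ κ ⊆ᵉ ⟦ bs′ ⟧ᵛ κ) → (∀ κ → t ∣ κ ⊑ t′ ∣ κ) → letrec a bs t ∣ ρ ⊑ letrec b bs′ t′ ∣ ρ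
        relabel-binds-⊑ bs bs′ {t} p q = letrec-⊑
          (λ r → ⊆ᵉ-trans (monoᵛ bs (⧺-mono r ⊆ᵉ-refl)) (p _))
          (λ r → ⊆-trans (mono t (⧺-mono r ⊆ᵉ-refl)) (sem (q _)))

      occ-⊑ : ∀ {n k ds} {a b : Label} (C : LCtx ds (suc k + n)) (x : Fin (suc k)) κ →
              plug C (occ a ds x) ∣ κ ⊑ plug C (occ b ds x) ∣ κ
      occ-⊑ C x κ = ctx-⊑ C (λ κ′ _ → var-⊑ ⊆-refl)

      ⇝₀-⊇ : ∀ {n} {s s′ : LTm n} → s ⇝₀ s′ → ∀ ρ → s′ ∣ ρ ⊑ s ∣ ρ
      ⇝₀-⊇ (letrec bs s) ρ = relabel-binds-⊑ bs bs (λ κ → ⊆ᵉ-refl) (λ κ → ^-⊑ s)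
      ⇝₀-⊇ (app _ s t) ρ = app-⊑ (^-⊑ s) ⊆-refl
      ⇝₀-⊇ (seq _ s t) ρ = seq-⊑ (^-⊑ s) ⊆-refl
      ⇝₀-⊇ (case _ s alts) ρ = case-⊑ (^-⊑ s) (λ e δ → ⊆-refl)
      ⇝₀-⊇ (body bs x C) ρ = relabel-binds-⊑ (bs [ x ]%= (_^ S)) bs
        (λ κ → ⟦⟧ᵛ-updateAt bs x (λ s → sem (^-⊑ s))) (occ-⊑ C x)
      ⇝₀-⊇ (bind {ds = ds} bs x y C t _ _ eq) ρ = relabel-binds-⊑ ((bs [ y ]≔ plug C (occ V ds x)) [ x ]%= (_^ S)) bs
        (λ κ → ⊆ᵉ-trans (⟦⟧ᵛ-updateAt (bs [ y ]≔ plug C (occ V ds x)) x (λ s → sem (^-⊑ s)))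
          (⟦⟧ᵛ-≔ bs y (⊆-trans (sem (occ-⊑ C x κ)) (⟦⟧-≡ (sym eq)))))
        (λ κ → ⊑-mono t ⊆ᵉ-refl)
      ⇝₀-⊇ {n} (alias bs x y t _ eq) ρ = relabel-binds-⊑ ((bs [ y ]≔ var W (x ↑ˡ n)) [ x ]%= (_^ S)) bs
        (λ κ → ⊆ᵉ-trans (⟦⟧ᵛ-updateAt (bs [ y ]≔ var W (x ↑ˡ n)) x (λ s → sem (^-⊑ s)))
          (⟦⟧ᵛ-≔ bs y (⟦⟧-≡ (sym eq))))
        (λ κ → ⊑-mono t ⊆ᵉ-refl)

      ⇝*-⊇ : ∀ {n} {s s′ : LTm n} → s ⇝* s′ → ∀ ρ → s′ ∣ ρ ⊑ s ∣ ρ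
      ⇝*-⊇ {s = s} Star.ε ρ = ⊑-mono s ⊆ᵉ-refl
      ⇝*-⊇ (at C r _ ◅ rs) ρ = ⊑-trans (⇝*-⊇ rs ρ) (ctx-⊑ C (λ κ _ → ⇝₀-⊇ r κ))

      need-⟶-⊇ : ∀ {n} {s s′ : Exp n} → s ⟶ s′ → ∀ ρ → s′ ∣ ρ ⊑ s ∣ ρ
      need-⟶-⊇ {s = s} (step {l′ = l′} (ls , _) r) ρ =
        ⊑-trans (relabel-⊒ _ l′ ⊆ᵉ-refl) (⊑-trans (↦-⊇ r ρ) (⊑-trans (⇝*-⊇ ls ρ)
          (⊑-trans (^-⊑ (relabel (λ _ → ∅) s)) (relabel-⊒ _ s ⊆ᵉ-refl))))
        where open NeedSoundness

      need-answer-inhabited : ∀ {n} {s : Exp n} → Answer s → Inhabited s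
      need-answer-inhabited (value v) with value-inhabited v
      ... | σ , p = σ , 0 , p
      need-answer-inhabited (letrec-value bs v) with value-inhabited v
      ... | σ , p = σ , 0 , 0 , p , ≤-refl
      need-answer-inhabited {n} (letrec-con {a = a} {K} bs {x₁} {xₘ} {c} {ss} eq ch) = σ , 0 , 0 ,
        (0 , subst (λ d → d σ 0) (sym (⧺-↑ˡ (rec bs ∅ᵉ) ∅ᵉ xₘ)) (chain-⊇ refl {bs = bs} ch σ 0
          (rec-lookup⊇ bs x₁ σ 0 (subst (λ s → ⟦ s ⟧ (rec bs ∅ᵉ ⧺ ∅ᵉ) σ 0) (sym eq) ((λ _ → []) , refl , λ _ _ _ ())))) , ≤-refl) , ≤-refl
        where σ = con K c (λ _ → [])

      need-↓-inhabited : ∀ {n} {s v : Exp n} → Star _⟶_ s v → Answer v → Inhabited s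
      need-↓-inhabited Star.ε   a = need-answer-inhabited a
      need-↓-inhabited (r ◅ rs) a = inhabited-⊑ (need-⟶-⊇ r ∅ᵉ) (need-↓-inhabited rs a)

    module _ where
      open Name
      open Renaming {⊤} tt
      open TermSubstitution {⊤} tt

      R-⊑ : ∀ {ds n} (L : Ctx ⊤ ds n) (A : Ctx ⊤ [] (ds ▷ n)) {u u′} → (∀ κ → u′ ∣ κ ⊑ u ∣ κ) →
            ∀ ρ → plug L (plug A u′) ∣ ρ ⊑ plug L (plug A u) ∣ ρ
      R-⊑ L A p ρ = ctx-⊑ L (λ κ _ → ctx-⊑ A (λ κ′ _ → p κ′))

      name-⟶-⊇ : ∀ {n} {s s′ : Exp n} → s ⟶ s′ → ∀ ρ → s′ ∣ ρ ⊑ s ∣ ρ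
      name-⟶-⊇ (beta {L = L} {A} _ _ s t) = R-⊑ L A (λ κ →
        ⊑-trans (subst-⊒ refl refl s (t ∷ [])) (beta-⊇ tt tt s t (⟦ t ∷ [] ⟧ᵛ κ) ⊆-refl))
      name-⟶-⊇ (gcp {ds′ = ds′} {L = L} bs x {L′} {A} _ _ _) ρ = ctx-⊑ L (λ κ _ → letrec-body-⊇ bs
        (ctx-⊑ L′ {u = plug A (lookup bs x /Var embed ds′)} (λ κ′ r → ctx-⊑ A (λ κ″ r′ →
          let at-x = λ y → trans (trans (cong κ″ (sym (lookup-id (lookup (embed ds′) y)))) (r′ (lookup (embed ds′) y))) (r y) in
          ⊑-trans (ren-⊒ (lookup bs x) (λ y → ⊆-reflexive (at-x y))) (chain-occ-⊇ bs refl [] ds′ at-x)))))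
        where open TermSubst (termSubst tt) using (_/Var_)
      name-⟶-⊇ (lapp {L = L} {A} _ _ bs s t) = R-⊑ L A (λ κ → lapp-⊇ tt bs)
      name-⟶-⊇ (lcase {L = L} {A} _ _ bs s alts) = R-⊑ L A (λ κ → lcase-⊇ tt bs)
      name-⟶-⊇ (lseq {L = L} {A} _ _ bs s t) = R-⊑ L A (λ κ → lseq-⊇ tt bs)
      name-⟶-⊇ (seq {L = L} {A} _ _ v s) = R-⊑ L A (λ κ → seq-⊇ (value-inhabited v))
      name-⟶-⊇ (case {L = L} {A} _ _ c ss alts) = R-⊑ L A (λ κ →
        ⊑-trans (subst-⊒ refl refl (All.lookup alts c) ss)
          (case-⊇ tt (con tt _ c ss) alts c (⟦ ss ⟧ᵛ κ) (λ Us q → Us , refl , q)))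

      L-inhabited : ∀ {ds n} {L : Ctx ⊤ ds n} {v} → IsL L → Value v → ∀ ρ → ∃₂ (⟦ plug L v ⟧ ρ)
      L-inhabited hole v ρ with value-inhabited v
      ... | σ , p = σ , 0 , p
      L-inhabited (letrec {bs = bs} l) v ρ with L-inhabited l v (rec bs ρ ⧺ ρ)
      ... | σ , m , p = σ , m , m , p , ≤-refl

      name-↓-inhabited : ∀ {n} {s v : Exp n} → Star _⟶_ s v → Answer v → Inhabited s
      name-↓-inhabited Star.ε   (answer l v) = L-inhabited l v ∅ᵉ
      name-↓-inhabited (r ◅ rs) a = inhabited-⊑ (name-⟶-⊇ r ∅ᵉ) (name-↓-inhabited rs a)

  -- Steps that lower the cost

  module Strict (v : ℕ) where
    open Model 1 v
    open Substitution 1 v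

    infix 4 _∣_◃_∣_ _∣_⋖_∣_

    -- The decrease as seen from a strict position, which pays twice the cost plus the weight.
    -- Copying an abstraction over a variable keeps the cost and lowers only the weight: a decrease
    -- in this sense, but not in that of `_∣_⋖_∣_`, which asks for a lower cost.
    record _∣_◃_∣_ {A B m n} (s : Tm A m) (ρ : Env m) (s′ : Tm B n) (ρ′ : Env n) : Set where
      constructor mk◃
      field lt : ∀ τ c → ⟦ s ⟧ ρ τ c → ∃ λ c′ → ⟦ s′ ⟧ ρ′ τ c′ × c′ + c′ + weight s′ < c + c + weight s

    record _∣_⋖_∣_ {A B m n} (s : Tm A m) (ρ : Env m) (s′ : Tm B n) (ρ′ : Env n) : Set where
      constructor mk⋖
      field
        wt : weight s′ ≤ weight s
        lt : ∀ τ c → ⟦ s ⟧ ρ τ c → ∃ λ c′ → ⟦ s′ ⟧ ρ′ τ c′ × c′ < c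

    ⋖⇒◃ : ∀ {A B m n} {s : Tm A m} {ρ} {s′ : Tm B n} {ρ′} → s ∣ ρ ⋖ s′ ∣ ρ′ → s ∣ ρ ◃ s′ ∣ ρ′
    ⋖⇒◃ (mk⋖ w l) = mk◃ (λ τ c x → let c′ , y , p = l τ c x in c′ , y , +-mono-<-≤ (+-mono-< p p) w)

    ⊑-⋖-trans : ∀ {A B C l m n} {s : Tm A l} {ρ} {t : Tm B m} {σ} {u : Tm C n} {κ} →
                s ∣ ρ ⊑ t ∣ σ → t ∣ σ ⋖ u ∣ κ → s ∣ ρ ⋖ u ∣ κ
    ⊑-⋖-trans ⟨ w , p ⟩ (mk⋖ w′ q) = mk⋖ (≤-trans w′ w) (λ τ c x → q τ c (p τ c x))

    ⋖-⊑-trans : ∀ {A B C l m n} {s : Tm A l} {ρ} {t : Tm B m} {σ} {u : Tm C n} {κ} →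
                s ∣ ρ ⋖ t ∣ σ → t ∣ σ ⊑ u ∣ κ → s ∣ ρ ⋖ u ∣ κ
    ⋖-⊑-trans (mk⋖ w′ q) ⟨ w , p ⟩ = mk⋖ (≤-trans w w′) (λ τ c x → let c′ , y , l = q τ c x in c′ , p τ c′ y , l)

    cost-strict : ∀ {A B m n} (s : Tm A m) (s′ : Tm B n) {c c′} k →
                  c′ + c′ + weight s′ < c + c + weight s → cost s′ c′ k < cost s c k
    cost-strict s s′ {c} {c′} k l =
      subst₂ _<_ (eq c′ (weight s′) k) (eq c (weight s) k) (+-monoˡ-< (k + 2) l)
      where
      eq : ∀ c w k → c + c + w + (k + 2) ≡ c + c + k + (w + 2)
      eq = solve-∀

    m<cost : ∀ {A n} (s : Tm A n) c m → m < cost s c m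
    m<cost s c m = subst (_< cost s c m) (+-identityʳ m)
      (+-mono-≤-< (m≤n+m m (c + c)) (<-≤-trans (s≤s z≤n) (m≤n+m 2 (weight s))))

    module _ {A B : Set} {m n} {ρ : Env m} {ρ′ : Env n} {a : A} {b : B} where

      app-⋖ : ∀ {s s′ t t′} → s ∣ ρ ◃ s′ ∣ ρ′ → ⟦ t ⟧ ρ ⊆ ⟦ t′ ⟧ ρ′ → app a s t ∣ ρ ⋖ app b s′ t′ ∣ ρ′
      app-⋖ {s} {s′} (mk◃ p) q = mk⋖ ≤-refl (λ τ n (U , k , c , x , y , z) →
        let c′ , x′ , l = p _ c x in
        cost s′ c′ k , (U , k , c′ , x′ , ⊆-trans y q , ≤-refl) , <-≤-trans (cost-strict s s′ {c} {c′} k l) z)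

      seq-⋖ : ∀ {s s′ t t′} → s ∣ ρ ◃ s′ ∣ ρ′ → ⟦ t ⟧ ρ ⊆ ⟦ t′ ⟧ ρ′ → seq a s t ∣ ρ ⋖ seq b s′ t′ ∣ ρ′
      seq-⋖ {s} {s′} (mk◃ p) q = mk⋖ ≤-refl (λ τ n (U , k , c , x , y , z) →
        let c′ , x′ , l = p _ c x in
        cost s′ c′ k , (U , k , c′ , x′ , q _ _ y , ≤-refl) , <-≤-trans (cost-strict s s′ {c} {c′} k l) z)

      case-⋖ : ∀ {K s s′ alts alts′} → s ∣ ρ ◃ s′ ∣ ρ′ →
               (∀ {b} (e : b ∈ arities K) δ → ⟦ alts ⟧ᵃ ρ e δ ⊆ ⟦ alts′ ⟧ᵃ ρ′ e δ) →
               case a K s alts ∣ ρ ⋖ case b K s′ alts′ ∣ ρ′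
      case-⋖ {s = s} {s′} (mk◃ p) q = mk⋖ ≤-refl (λ τ n (d , e , Us , k , c , x , y , z) →
        let c′ , x′ , l = p _ c x in
        cost s′ c′ k , (d , e , Us , k , c′ , x′ , q e _ _ _ y , ≤-refl) , <-≤-trans (cost-strict s s′ {c} {c′} k l) z)

    letrec-⋖ : ∀ {A n k ρ} {a b : A} (bs : Vec (Tm A (suc k + n)) (suc k)) {t t′} →
               t ∣ rec bs ρ ⧺ ρ ⋖ t′ ∣ rec bs ρ ⧺ ρ → letrec a bs t ∣ ρ ⋖ letrec b bs t′ ∣ ρ
    letrec-⋖ bs (mk⋖ w p) = mk⋖ ≤-refl (λ τ n (m , x , l) →
      let m′ , y , l′ = p τ m x in suc m′ , (m′ , y , ≤-refl) , <-≤-trans (s≤s l′) l)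

    -- Inside a strict position the charge of the letrec counts twice, outside it counts once. The
    -- unit gained pays for the strict decrease, as the uncovered `s` weighs no more than the letrec
    -- did.
    lift-cost : ∀ {A B m n} (s : Tm A m) (t : Tm B n) {c i k} → weight t ≡ 1 → suc i ≤ c →
                suc (cost s i k) < cost t c k
    lift-cost s t {c} {i} {k} eq l rewrite eq = begin-strict
      suc (i + i + k + (weight s + 2)) ≤⟨ s≤s (+-monoʳ-≤ (i + i + k) (+-monoˡ-≤ 2 (weight≤ι s))) ⟩
      suc (i + i + k + 3)              <⟨ ≤-refl ⟩
      suc (suc (i + i + k + 3))        ≡⟨ arith i k ⟩
      suc i + suc i + k + 3            ≤⟨ +-monoˡ-≤ 3 (+-monoˡ-≤ k (+-mono-≤ l l)) ⟩
      c + c + k + 3                    ∎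
      where
      open ≤-Reasoning
      arith : ∀ i k → suc (suc (i + i + k + 3)) ≡ suc i + suc i + k + 3
      arith = solve-∀

    module _ {A : Set} (a₀ : A) {n} {ρ : Env n} {a b c : A} where
      open TermSubst (termSubst a₀) using (_/Var_; varLift)
      open Traversal {A} varLift using (_/Vec_; _/Alts_)
      open Renaming a₀

      module _ {k} (bs : Vec (Tm A (suc k + n)) (suc k)) {s : Tm A (suc k + n)} where
        private
          wk-⊆ : ρ ⊆ᵉ (rec bs ρ ⧺ ρ) ∘ lookup (wk⋆ (suc k))
          wk-⊆ x = ⊆-reflexive (sym (⧺-lookup-wk⋆ (suc k) (rec bs ρ) ρ x))

        lapp-⋖ : ∀ {d t} → app a (letrec d bs s) t ∣ ρ ⋖ letrec b bs (app c s (t /Var wk⋆ (suc k))) ∣ ρ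
        lapp-⋖ {d} {t} = mk⋖ ≤-refl (λ τ m (U , l , i , (j , x , w) , y , z) →
          suc (cost s j l) , (_ , (U , l , j , x , ⊆-trans y (sem (ren-⊑ t wk-⊆)) , ≤-refl) , ≤-refl) ,
          <-≤-trans (lift-cost s (letrec d bs s) refl w) z)

        lseq-⋖ : ∀ {d t} → seq a (letrec d bs s) t ∣ ρ ⋖ letrec b bs (seq c s (t /Var wk⋆ (suc k))) ∣ ρ
        lseq-⋖ {d} {t} = mk⋖ ≤-refl (λ τ m (U , l , i , (j , x , w) , y , z) →
          suc (cost s j l) , (_ , (U , l , j , x , sem (ren-⊑ t wk-⊆) _ _ y , ≤-refl) , ≤-refl) ,
          <-≤-trans (lift-cost s (letrec d bs s) refl w) z)

        lcase-⋖ : ∀ {d K alts} → case a K (letrec d bs s) alts ∣ ρ ⋖ letrec b bs (case c K s (alts /Alts wk⋆ (suc k))) ∣ ρ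
        lcase-⋖ {d} {alts = alts} = mk⋖ ≤-refl (λ τ m (f , e , Us , l , i , (j , x , w) , y , z) →
          suc (cost s j l) , (_ , (f , e , Us , l , j , x , ren-⊑ᵃ alts wk-⊆ e _ _ _ y , ≤-refl) , ≤-refl) ,
          <-≤-trans (lift-cost s (letrec d bs s) refl w) z)

    seq-value-⋖ : ∀ {A n} {ρ : Env n} {a : A} {u s} → seq a u s ∣ ρ ⋖ s ∣ ρ
    seq-value-⋖ {u = u} {s} = mk⋖ (weight≤ι s) (λ τ m (σ , k , c , x , y , z) → k , y , <-≤-trans (m<cost u c k) z)

  -- Progress and termination of call-by-name

  module NameAdequacy where
    open Model 1 1
    open Substitution 1 1
    open Contexts 1 1
    open Strict 1
    open Name
    open Renaming {⊤} tt
    open TermSubstitution {⊤} tt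
    open TermSubst (termSubst tt) using (_/_; _/Var_; sub)

    A-⋖ : ∀ {n} {A : Ctx ⊤ [] n} → IsA A → ∀ {ρ u u′} → u ∣ ρ ⋖ u′ ∣ ρ → plug A u ∣ ρ ⋖ plug A u′ ∣ ρ
    A-⋖ hole     p = p
    A-⋖ (app A)  p = app-⋖ (⋖⇒◃ (A-⋖ A p)) ⊆-refl
    A-⋖ (case A) p = case-⋖ (⋖⇒◃ (A-⋖ A p)) (λ e δ → ⊆-refl)
    A-⋖ (seq A)  p = seq-⋖ (⋖⇒◃ (A-⋖ A p)) ⊆-refl

    L-⋖ : ∀ {ds n} {L : Ctx ⊤ ds n} → IsL L → ∀ {ρ u u′} → (∀ κ → ρ ⊢ ds ⊳ κ → u ∣ κ ⋖ u′ ∣ κ) →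
          plug L u ∣ ρ ⋖ plug L u′ ∣ ρ
    L-⋖ hole {ρ} p = p ρ (λ x → cong ρ (lookup-id x))
    L-⋖ (letrec {ds = ds} {bs = bs} L) {ρ} p = letrec-⋖ bs (L-⋖ L (λ κ r → p κ (⊳-inner (rec bs ρ) ds κ r)))

    -- A redex comes with its step in every A-context, so that each recursive call of `spine` only
    -- has to add a frame around `A`.
    data Spine {n} : Exp n → Set₁ where
      redex : ∀ {A r} → IsA A → ∀ r′ → (∀ {A} → IsA A → plug A r ⟶ plug A r′) → (∀ ρ → r ∣ ρ ⋖ r′ ∣ ρ) →
              Spine (plug A r)
      var   : ∀ {A} → IsA A → ∀ x → Spine (plug A (var tt x))
      letrec : ∀ {k} (bs : Vec _ (suc k)) t → Spine (letrec tt bs t)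
      value : ∀ {s} → Value s → Spine s

    beta-⋖ : ∀ {n} (s : Exp (suc n)) t ρ → app tt (lam tt s) t ∣ ρ ⋖ s / sub t ∣ ρ
    beta-⋖ s t ρ = mk⋖ (weight≤ι _) (λ τ m (U , k , c , x , y , z) → k ,
      sem (subst-⊑ {ρ = ρ} s (t ∷ [])) τ k (mono s (⧺-mono {δ = λ (_ : Fin 1) → ⟪ U ⟫} {ρ = ρ} (λ { zero → y }) ⊆ᵉ-refl) τ k x) ,
      <-≤-trans (m<cost (lam tt s) c k) z)

    case-con-⋖ : ∀ {n K a} (c : a ∈ arities K) (ss : Vec (Exp n) a) alts ρ →
                 case tt K (con tt K c ss) alts ∣ ρ ⋖ All.lookup alts c / (ss ++ TermSubst.id (termSubst tt)) ∣ ρ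
    case-con-⋖ c ss alts ρ = mk⋖ (weight≤ι _) (λ { τ m (b , e , Us , k , i , (_ , refl , p) , y , z) → k ,
      sem (subst-⊑ {ρ = ρ} (All.lookup alts c) ss) τ k
        (mono (All.lookup alts c) (⧺-mono {δ = λ i → ⟪ Us i ⟫} {ρ = ρ} p ⊆ᵉ-refl) τ k
          (subst (λ d → d τ k) (⟦⟧ᵃ-lookup alts ρ c _) y)) ,
      <-≤-trans (m<cost (con tt _ c ss) i k) z })

    app-value : ∀ {n} {s : Exp n} t {ρ U τ m c} → Value s → ⟦ s ⟧ ρ (fun U τ m) c → Spine (app tt s t)
    app-value t (lam {s = s}) x = redex hole _ (λ A → beta hole A s t) (beta-⋖ s t)
    app-value t con (_ , () , _)

    case-value : ∀ {n} {s : Exp n} {K} alts {ρ a c} {e : a ∈ arities K} {Us} → Value s → ⟦ s ⟧ ρ (con K e Us) c →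
                 Spine (case tt K s alts)
    case-value alts lam ()
    case-value alts (con {c = c} {ss}) (_ , refl , _) = redex hole _ (λ A → case hole A c ss alts) (case-con-⋖ c ss alts)

    spine : ∀ {n} (s : Exp n) {ρ τ m} → ⟦ s ⟧ ρ τ m → Spine s
    spine (var tt x)       _ = var hole x
    spine (lam tt s)       _ = value lam
    spine (con tt K c ss)  _ = value con
    spine (letrec tt bs t) _ = letrec bs t
    spine (app tt s t) (_ , _ , _ , x , _) with spine s x
    ... | redex A r′ st p = redex (app A) r′ st p
    ... | var A y         = var (app A) y
    ... | letrec bs u     = redex hole _ (λ A → lapp hole A bs u t) (λ ρ → lapp-⋖ tt bs)
    ... | value v         = app-value t v x
    spine (seq tt s t) (_ , _ , _ , x , _) with spine s x
    ... | redex A r′ st p = redex (seq A) r′ st p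
    ... | var A y         = var (seq A) y
    ... | letrec bs u     = redex hole _ (λ A → lseq hole A bs u t) (λ ρ → lseq-⋖ tt bs)
    ... | value v         = redex hole _ (λ A → seq hole A v t) (λ ρ → seq-value-⋖)
    spine (case tt K s alts) (_ , _ , _ , _ , _ , x , _) with spine s x
    ... | redex A r′ st p = redex (case A) r′ st p
    ... | var A y         = var (case A) y
    ... | letrec bs u     = redex hole _ (λ A → lcase hole A bs u alts) (λ ρ → lcase-⋖ tt bs)
    ... | value v         = case-value alts v x

    -- `free` means that evaluation demands a variable bound outside the term. It is stuck there,
    -- but an enclosing letrec that binds the variable turns it into a (gcp) step.
    data Progress {n} : Exp n → Set₁ where
      answer : ∀ {s} → Answer s → Progress s
      steps  : ∀ {s s′} → s ⟶ s′ → (∀ ρ → s ∣ ρ ⋖ s′ ∣ ρ) → Progress s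
      free   : ∀ {ds} {L : Ctx ⊤ ds n} {A} → IsL L → IsA A → ∀ x → Progress (plug L (plug A (var tt (lookup (embed ds) x))))

    letrec-⟶ : ∀ {n k} {bs : Vec _ (suc k)} {s s′ : Exp (suc k + n)} → s ⟶ s′ → letrec tt bs s ⟶ letrec tt bs s′
    letrec-⟶ (beta L A s t)      = beta (letrec L) A s t
    letrec-⟶ (gcp bs x L L′ A)   = gcp bs x (letrec L) L′ A
    letrec-⟶ (lapp L A bs s t)   = lapp (letrec L) A bs s t
    letrec-⟶ (lcase L A bs s t)  = lcase (letrec L) A bs s t
    letrec-⟶ (lseq L A bs s t)   = lseq (letrec L) A bs s t
    letrec-⟶ (seq L A v s)       = seq (letrec L) A v s
    letrec-⟶ (case L A c ss t)   = case (letrec L) A c ss t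

    -- Here the charge of variables is spent: the occurrence pays at least `1 + m` for what its
    -- binding yields at cost `m`.
    gcp-⋖ : ∀ {n k ds} (bs : Vec (Exp (suc k + n)) (suc k)) i {κ : Env (ds ▷ (suc k + n))} {ρ} → (rec bs ρ ⧺ ρ) ⊢ ds ⊳ κ →
            occ tt ds i ∣ κ ⋖ lookup bs i /Var embed ds ∣ κ
    gcp-⋖ {ds = ds} bs i {κ} {ρ} r = mk⋖ (weight≤ι _) (λ τ n (m , x , l) → m ,
      sem (ren-⊑ (lookup bs i) {σ = embed ds} (λ y → ⊆-reflexive (sym (r y)))) τ m
        (rec-lookup⊆ bs i τ m (subst (λ d → d τ m) (trans (r (i ↑ˡ _)) (⧺-↑ˡ (rec bs ρ) ρ i)) x)) , l)

    progress : ∀ {n} (s : Exp n) {ρ τ m} → ⟦ s ⟧ ρ τ m → Progress s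
    progress-spine : ∀ {n} {s : Exp n} {ρ τ m} → Spine s → ⟦ s ⟧ ρ τ m → Progress s
    progress-letrec : ∀ {n k} (bs : Vec (Exp (suc k + n)) (suc k)) {t} → Progress t → Progress (letrec tt bs t)

    progress s x = progress-spine (spine s x) x

    progress-spine (redex A r′ st p) _ = steps (st A) (λ ρ → A-⋖ A (p ρ))
    progress-spine (var {A} a x)     _ = subst (λ y → Progress (plug A (var tt y))) (lookup-id x) (free hole a x)
    progress-spine (value v)         _ = answer (answer hole v)
    progress-spine (letrec bs t) (m , x , _) = progress-letrec bs (progress t x)

    progress-letrec bs (answer (answer l v)) = answer (answer (letrec l) v)
    progress-letrec bs (steps st p)          = steps (letrec-⟶ st) (λ ρ → letrec-⋖ bs (p (rec bs ρ ⧺ ρ)))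
    -- The demanded variable is either bound by this letrec, which yields (gcp), or bound further
    -- out, and then the whole letrec is again `free`.
    progress-letrec {n} {k} bs (free {ds} {L} {A} l a x) = ∀-++ (suc k) {P = λ x → Progress (letrec tt bs (plug L (plug A (var tt (lookup (embed ds) x)))))}
      (λ i → steps (gcp bs i hole l a)
        (λ ρ → letrec-⋖ bs (L-⋖ l (λ κ r → A-⋖ a (gcp-⋖ {ds = ds} bs i r)))))
      (λ j → subst (λ y → Progress (letrec tt bs (plug L (plug A (var tt y)))))
        (trans (lookup-⊙ (wk⋆ (suc k)) (embed ds) j) (cong (lookup (embed ds)) (lookup-wk⋆ (suc k) j)))
        (free (letrec l) a j))
      x

    A-inside : ∀ {n} {A : Ctx ⊤ [] n} → IsA A → ∀ {u ρ τ m} → ⟦ plug A u ⟧ ρ τ m → ∃₂ (⟦ u ⟧ ρ)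
    A-inside hole     x = _ , _ , x
    A-inside (app A)  (_ , _ , _ , x , _) = A-inside A x
    A-inside (case A) (_ , _ , _ , _ , _ , x , _) = A-inside A x
    A-inside (seq A)  (_ , _ , _ , x , _) = A-inside A x

    L-inside : ∀ {ds n} {L : Ctx ⊤ ds n} → IsL L → ∀ {u ρ τ m} → ⟦ plug L u ⟧ ρ τ m →
               ∃ λ κ → (ρ ⊢ ds ⊳ κ) × ∃₂ (⟦ u ⟧ κ)
    L-inside hole {ρ = ρ} x = ρ , (λ y → cong ρ (lookup-id y)) , _ , _ , x
    L-inside (letrec {ds = ds} {bs = bs} l) {ρ = ρ} (_ , x , _) with L-inside l x
    ... | κ , r , y = κ , ⊳-inner (rec bs ρ) ds κ r , y

    -- Well-founded induction on the cost with the token `τ` fixed, as a step keeps the token. The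
    -- `free` case is refuted by the empty environment.
    name-↓ : ∀ {n} (s : Exp n) {τ m} → ⟦ s ⟧ ∅ᵉ τ m → ∃ λ u → Star _⟶_ s u × Answer u
    name-↓ s {τ} {m} = <-rec (λ m → ∀ {s} → ⟦ s ⟧ ∅ᵉ τ m → ∃ λ u → Star _⟶_ s u × Answer u) (λ m ih x → go ih (progress _ x) x) m
      where
      go : ∀ {m s} → (∀ {m′} → m′ < m → ∀ {s} → ⟦ s ⟧ ∅ᵉ τ m′ → ∃ λ u → Star _⟶_ s u × Answer u) →
           Progress s → ⟦ s ⟧ ∅ᵉ τ m → ∃ λ u → Star _⟶_ s u × Answer u
      go ih (answer a) x = _ , Star.ε , a
      go ih (steps st p) x with _∣_⋖_∣_.lt (p ∅ᵉ) τ _ x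
      ... | m′ , y , l with ih l y
      ... | u , sts , a = u , st ◅ sts , a
      go ih (free {ds = ds} l a y) x with L-inside l x
      ... | κ , r , σ , i , z with A-inside a z
      ... | _ , _ , _ , w , _ with subst (λ d → d _ _) (r y) w
      ... | ()

  -- Labelling

  module Labels where
    open Need

    TermPred : Set₁
    TermPred = ∀ {n} → LTm n → Set

    Every  : TermPred → TermPred
    Below  : TermPred → TermPred
    Everyᵛ : TermPred → ∀ {n k} → Vec (LTm n) k → Set
    Everyᵃ : TermPred → ∀ {n as} → Alts Label n as → Set
    Every Q s = Q s × Below Q s
    Below Q (var a x)         = ⊤
    Below Q (app a s t)       = Every Q s × Every Q t
    Below Q (lam a s)         = Every Q s
    Below Q (letrec a bs t)   = Everyᵛ Q bs × Every Q t
    Below Q (con a K c ss)    = Everyᵛ Q ss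
    Below Q (seq a s t)       = Every Q s × Every Q t
    Below Q (case a K s alts) = Every Q s × Everyᵃ Q alts
    Everyᵛ Q []       = ⊤
    Everyᵛ Q (s ∷ ss) = Every Q s × Everyᵛ Q ss
    Everyᵃ Q []         = ⊤
    Everyᵃ Q (s ∷ alts) = Every Q s × Everyᵃ Q alts

    module _ {Q : TermPred} where

      Every-plug  : ∀ {ds n} (C : LCtx ds n) {u} → Every Q (plug C u) → Every Q u
      Every-plugᵛ : ∀ {ds n k} (E : CtxVec Label ds n k) {u} → Everyᵛ Q (plugVec E u) → Every Q u
      Every-plugᵃ : ∀ {ds n as} (E : CtxAlts Label ds n as) {u} → Everyᵃ Q (plugAlts E u) → Every Q u
      Every-plug hole             p = p
      Every-plug (appˡ a C t)     (_ , p , _) = Every-plug C p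
      Every-plug (appʳ a s C)     (_ , _ , p) = Every-plug C p
      Every-plug (lam a C)        (_ , p)     = Every-plug C p
      Every-plug (letrecᵉ a E t)  (_ , p , _) = Every-plugᵛ E p
      Every-plug (letrecᵇ a bs C) (_ , _ , p) = Every-plug C p
      Every-plug (con a K c E)    (_ , p)     = Every-plugᵛ E p
      Every-plug (seqˡ a C t)     (_ , p , _) = Every-plug C p
      Every-plug (seqʳ a s C)     (_ , _ , p) = Every-plug C p
      Every-plug (caseˢ a K C alts) (_ , p , _) = Every-plug C p
      Every-plug (caseᵃ a K s E)  (_ , _ , p) = Every-plugᵃ E p
      Every-plugᵛ (here C ss) (p , _) = Every-plug C p
      Every-plugᵛ (there s E) (_ , p) = Every-plugᵛ E p
      Every-plugᵃ (here C alts) (p , _) = Every-plug C p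
      Every-plugᵃ (there s E)   (_ , p) = Every-plugᵃ E p

      Every-lookup : ∀ {n k} {bs : Vec (LTm n) k} → Everyᵛ Q bs → ∀ i → Every Q (lookup bs i)
      Every-lookup {bs = _ ∷ _} (p , ps) zero    = p
      Every-lookup {bs = _ ∷ _} (p , ps) (suc i) = Every-lookup ps i

      Every-tabulate : ∀ {n k} {bs : Vec (LTm n) k} → (∀ i → Every Q (lookup bs i)) → Everyᵛ Q bs
      Every-tabulate {bs = []}    p = tt
      Every-tabulate {bs = _ ∷ _} p = p zero , Every-tabulate (p ∘ suc)

    module _ {Q R : TermPred} (f : ∀ {n} (u : LTm n) → Every Q u → R u) where

      Every-map  : ∀ {n} (s : LTm n) → Every Q s → Every R s
      Below-map  : ∀ {n} (s : LTm n) → Below Q s → Below R s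
      Every-mapᵛ : ∀ {n k} (ss : Vec (LTm n) k) → Everyᵛ Q ss → Everyᵛ R ss
      Every-mapᵃ : ∀ {n as} (alts : Alts Label n as) → Everyᵃ Q alts → Everyᵃ R alts
      Every-map s p = f s p , Below-map s (proj₂ p)
      Below-map (var a x)         p       = tt
      Below-map (app a s t)       (p , q) = Every-map s p , Every-map t q
      Below-map (lam a s)         p       = Every-map s p
      Below-map (letrec a bs t)   (p , q) = Every-mapᵛ bs p , Every-map t q
      Below-map (con a K c ss)    p       = Every-mapᵛ ss p
      Below-map (seq a s t)       (p , q) = Every-map s p , Every-map t q
      Below-map (case a K s alts) (p , q) = Every-map s p , Every-mapᵃ alts q
      Every-mapᵛ []       _       = tt
      Every-mapᵛ (s ∷ ss) (p , q) = Every-map s p , Every-mapᵛ ss q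
      Every-mapᵃ []         _       = tt
      Every-mapᵃ (s ∷ alts) (p , q) = Every-map s p , Every-mapᵃ alts q

    -- `S` and `T` are the labels on which the labelling may still act; `V` and `W` record where it
    -- has been.
    Dull : TermPred
    Dull u = ¬ S∨T (label u)

    Clean : TermPred
    Clean = Every Dull

    ∅-dull : ¬ S∨T ∅
    ∅-dull ()
    V-dull : ¬ S∨T V
    V-dull ()
    W-dull : ¬ S∨T W
    W-dull ()

    unlabelled : ∀ {n} → Exp n → LTm n
    unlabelled = relabel (λ _ → ∅)

    unlabelled-clean  : ∀ {n} (s : Exp n) → Clean (unlabelled s)
    unlabelled-cleanᵛ : ∀ {n k} (ss : Vec (Exp n) k) → Everyᵛ Dull (relabelVec (λ _ → ∅) ss)
    unlabelled-cleanᵃ : ∀ {n as} (alts : Alts ⊤ n as) → Everyᵃ Dull (relabelAlts (λ _ → ∅) alts)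
    unlabelled-clean (var a x)         = ∅-dull , tt
    unlabelled-clean (app a s t)       = ∅-dull , unlabelled-clean s , unlabelled-clean t
    unlabelled-clean (lam a s)         = ∅-dull , unlabelled-clean s
    unlabelled-clean (letrec a bs t)   = ∅-dull , unlabelled-cleanᵛ bs , unlabelled-clean t
    unlabelled-clean (con a K c ss)    = ∅-dull , unlabelled-cleanᵛ ss
    unlabelled-clean (seq a s t)       = ∅-dull , unlabelled-clean s , unlabelled-clean t
    unlabelled-clean (case a K s alts) = ∅-dull , unlabelled-clean s , unlabelled-cleanᵃ alts
    unlabelled-cleanᵛ []       = tt
    unlabelled-cleanᵛ (s ∷ ss) = unlabelled-clean s , unlabelled-cleanᵛ ss
    unlabelled-cleanᵃ []         = tt
    unlabelled-cleanᵃ (s ∷ alts) = unlabelled-clean s , unlabelled-cleanᵃ alts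

    label-unlabelled : ∀ {n} (s : Exp n) → label (unlabelled s) ≡ ∅
    label-unlabelled (var a x)         = refl
    label-unlabelled (app a s t)       = refl
    label-unlabelled (lam a s)         = refl
    label-unlabelled (letrec a bs t)   = refl
    label-unlabelled (con a K c ss)    = refl
    label-unlabelled (seq a s t)       = refl
    label-unlabelled (case a K s alts) = refl

    forget-unlabelled  : ∀ {n} (s : Exp n) → forget (unlabelled s) ≡ s
    forget-unlabelledᵛ : ∀ {n k} (ss : Vec (Exp n) k) → relabelVec (λ _ → tt) (relabelVec (λ _ → ∅) ss) ≡ ss
    forget-unlabelledᵃ : ∀ {n as} (alts : Alts ⊤ n as) → relabelAlts (λ _ → tt) (relabelAlts (λ _ → ∅) alts) ≡ alts
    forget-unlabelled (var tt x)         = refl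
    forget-unlabelled (app tt s t)       = cong₂ (app tt) (forget-unlabelled s) (forget-unlabelled t)
    forget-unlabelled (lam tt s)         = cong (lam tt) (forget-unlabelled s)
    forget-unlabelled (letrec tt bs t)   = cong₂ (letrec tt) (forget-unlabelledᵛ bs) (forget-unlabelled t)
    forget-unlabelled (con tt K c ss)    = cong (con tt K c) (forget-unlabelledᵛ ss)
    forget-unlabelled (seq tt s t)       = cong₂ (seq tt) (forget-unlabelled s) (forget-unlabelled t)
    forget-unlabelled (case tt K s alts) = cong₂ (case tt K) (forget-unlabelled s) (forget-unlabelledᵃ alts)
    forget-unlabelledᵛ []       = refl
    forget-unlabelledᵛ (s ∷ ss) = cong₂ _∷_ (forget-unlabelled s) (forget-unlabelledᵛ ss)
    forget-unlabelledᵃ []         = refl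
    forget-unlabelledᵃ (s ∷ alts) = cong₂ _∷_ (forget-unlabelled s) (forget-unlabelledᵃ alts)

    NoFail : TermPred
    NoFail u = ¬ Fails₀ u

    ¬Fails : ∀ {n} {s : LTm n} → Every NoFail s → ¬ Fails s
    ¬Fails p (at C f) = proj₁ (Every-plug C p) f

    NonVar : TermPred
    NonVar (var a x) = ¬ S∨T a
    NonVar _         = ⊤

    -- Either fail rule needs an occurrence of a variable labelled `S` in a binding.
    NonVar-nofail : ∀ {n} (u : LTm n) → Every NonVar u → NoFail u
    NonVar-nofail _ (_ , ps , _) (visited bs x y C t _ _ eq) =
      proj₁ (Every-plug C (subst (Every NonVar) eq (Every-lookup ps y))) isS
    NonVar-nofail _ (_ , ps , _) (self bs x C t eq) =
      proj₁ (Every-plug C (subst (Every NonVar) eq (Every-lookup ps x))) isS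

    -- Labelling comes to rest at an `S` on a value or a letrec; only `T` makes a letrec go on. The
    -- remaining nodes must be free of `S` and `T`.
    Finished : TermPred
    Finished (var a x)         = ¬ S∨T a
    Finished (app a s t)       = ¬ S∨T a
    Finished (lam a s)         = ⊤
    Finished (letrec a bs t)   = a ≢ T
    Finished (con a K c ss)    = ⊤
    Finished (seq a s t)       = ¬ S∨T a
    Finished (case a K s alts) = ¬ S∨T a

    Finished-NonVar : ∀ {n} (u : LTm n) → Every Finished u → NonVar u
    Finished-NonVar (var a x)         (p , _) = p
    Finished-NonVar (app a s t)       _ = tt
    Finished-NonVar (lam a s)         _ = tt
    Finished-NonVar (letrec a bs t)   _ = tt
    Finished-NonVar (con a K c ss)    _ = tt
    Finished-NonVar (seq a s t)       _ = tt
    Finished-NonVar (case a K s alts) _ = tt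

    Dull-Finished : ∀ {n} (u : LTm n) → Clean u → Finished u
    Dull-Finished (var a x)         (p , _) = p
    Dull-Finished (app a s t)       (p , _) = p
    Dull-Finished (lam a s)         _ = tt
    Dull-Finished (letrec a bs t)   (p , _) refl = p isT
    Dull-Finished (con a K c ss)    _ = tt
    Dull-Finished (seq a s t)       (p , _) = p
    Dull-Finished (case a K s alts) (p , _) = p

    Finished-¬⇝₀ : ∀ {n} {u u′ : LTm n} → Every Finished u → ¬ (u ⇝₀ u′)
    Finished-¬⇝₀ (p , _) (letrec bs s) = p refl
    Finished-¬⇝₀ (p , _) (app a s t)   = p a
    Finished-¬⇝₀ (p , _) (seq a s t)   = p a
    Finished-¬⇝₀ (p , _) (case a s t)  = p a
    Finished-¬⇝₀ (_ , _ , p) (body bs x C) = proj₁ (Every-plug C p) isS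
    Finished-¬⇝₀ (_ , ps , _) (bind bs x y C t _ _ eq) =
      proj₁ (Every-plug C (subst (Every Finished) eq (Every-lookup ps y))) isS
    Finished-¬⇝₀ (_ , ps , _) (alias bs x y t _ eq) =
      proj₁ (subst (Every Finished) eq (Every-lookup ps y)) isS

    Finished-labelling : ∀ {n} {s : Exp n} {l} → start s ⇝* l → Every Finished l → Labelling s l
    Finished-labelling {l = l} r p = r , ¬Fails (Every-map NonVar-nofail l (Every-map Finished-NonVar l p)) ,
      λ { _ (at C st _) → Finished-¬⇝₀ (Every-plug C p) st }

    data IsV {n} : LCtx [] n → Set where
      hole : IsV hole
      app  : ∀ {A t} → IsV A → Clean t → IsV (appˡ V A t)
      seq  : ∀ {A t} → IsV A → Clean t → IsV (seqˡ V A t)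
      case : ∀ {K A alts} → IsV A → Everyᵃ Dull alts → IsV (caseˢ V K A alts)

    -- What lets a property pass along a spine: it holds at clean subterms and at frames labelled
    -- `V`. Cleanliness, absence of failure and the end of labelling are all instances.
    record Admissible (Q : TermPred) : Set where
      field
        on-dull  : ∀ {n} (u : LTm n) → Clean u → Q u
        on-app   : ∀ {n} (s t : LTm n) → Q (app V s t)
        on-seq   : ∀ {n} (s t : LTm n) → Q (seq V s t)
        on-case  : ∀ {n K} (s : LTm n) alts → Q (case V K s alts)

      plugV : ∀ {n} {A : LCtx [] n} → IsV A → ∀ {u} → Every Q u → Every Q (plug A u)
      plugV hole       p = p
      plugV (app A q)  p = on-app _ _ , plugV A p , Every-map on-dull _ q
      plugV (seq A q)  p = on-seq _ _ , plugV A p , Every-map on-dull _ q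
      plugV (case A q) p = on-case _ _ , plugV A p , Every-mapᵃ on-dull _ q

    Dull-admissible : Admissible Dull
    Dull-admissible = record { on-dull = λ _ → proj₁ ; on-app = λ _ _ → V-dull ; on-seq = λ _ _ → V-dull ; on-case = λ _ _ → V-dull }

    NonVar-admissible : Admissible NonVar
    NonVar-admissible = record { on-dull = λ u p → Finished-NonVar u (Every-map Dull-Finished u p)
                               ; on-app = λ _ _ → tt ; on-seq = λ _ _ → tt ; on-case = λ _ _ → tt }

    Finished-admissible : Admissible Finished
    Finished-admissible = record { on-dull = Dull-Finished ; on-app = λ _ _ → V-dull ; on-seq = λ _ _ → V-dull ; on-case = λ _ _ → V-dull }

    NoFail-admissible : Admissible NoFail
    NoFail-admissible = record
      { on-dull = λ u p → NonVar-nofail u (Every-map (Admissible.on-dull NonVar-admissible) u p)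
      ; on-app = λ _ _ () ; on-seq = λ _ _ () ; on-case = λ _ _ () }

    infixr 9 _⊚_

    -- The inner context has no binders, so the composite keeps the list `ds` of the outer one and
    -- no concatenation of lists enters the types.
    _⊚_  : ∀ {A ds n} → Ctx A ds n → Ctx A [] (ds ▷ n) → Ctx A ds n
    _⊚ᵛ_ : ∀ {A ds n k} → CtxVec A ds n k → Ctx A [] (ds ▷ n) → CtxVec A ds n k
    _⊚ᵃ_ : ∀ {A ds n as} → CtxAlts A ds n as → Ctx A [] (ds ▷ n) → CtxAlts A ds n as
    hole             ⊚ D = D
    appˡ a C t       ⊚ D = appˡ a (C ⊚ D) t
    appʳ a s C       ⊚ D = appʳ a s (C ⊚ D)
    lam a C          ⊚ D = lam a (C ⊚ D)
    letrecᵉ a E t    ⊚ D = letrecᵉ a (E ⊚ᵛ D) t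
    letrecᵇ a bs C   ⊚ D = letrecᵇ a bs (C ⊚ D)
    con a K c E      ⊚ D = con a K c (E ⊚ᵛ D)
    seqˡ a C t       ⊚ D = seqˡ a (C ⊚ D) t
    seqʳ a s C       ⊚ D = seqʳ a s (C ⊚ D)
    caseˢ a K C alts ⊚ D = caseˢ a K (C ⊚ D) alts
    caseᵃ a K s E    ⊚ D = caseᵃ a K s (E ⊚ᵃ D)
    here C ss ⊚ᵛ D = here (C ⊚ D) ss
    there s E ⊚ᵛ D = there s (E ⊚ᵛ D)
    here C alts ⊚ᵃ D = here (C ⊚ D) alts
    there s E   ⊚ᵃ D = there s (E ⊚ᵃ D)

    plug-⊚  : ∀ {A ds n} (C : Ctx A ds n) D u → plug (C ⊚ D) u ≡ plug C (plug D u)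
    plug-⊚ᵛ : ∀ {A ds n k} (E : CtxVec A ds n k) D u → plugVec (E ⊚ᵛ D) u ≡ plugVec E (plug D u)
    plug-⊚ᵃ : ∀ {A ds n as} (E : CtxAlts A ds n as) D u → plugAlts (E ⊚ᵃ D) u ≡ plugAlts E (plug D u)
    plug-⊚ hole             D u = refl
    plug-⊚ (appˡ a C t)     D u = cong (λ z → app a z t) (plug-⊚ C D u)
    plug-⊚ (appʳ a s C)     D u = cong (app a s) (plug-⊚ C D u)
    plug-⊚ (lam a C)        D u = cong (lam a) (plug-⊚ C D u)
    plug-⊚ (letrecᵉ a E t)  D u = cong (λ z → letrec a z t) (plug-⊚ᵛ E D u)
    plug-⊚ (letrecᵇ a bs C) D u = cong (letrec a bs) (plug-⊚ C D u)
    plug-⊚ (con a K c E)    D u = cong (con a K c) (plug-⊚ᵛ E D u)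
    plug-⊚ (seqˡ a C t)     D u = cong (λ z → seq a z t) (plug-⊚ C D u)
    plug-⊚ (seqʳ a s C)     D u = cong (seq a s) (plug-⊚ C D u)
    plug-⊚ (caseˢ a K C alts) D u = cong (λ z → case a K z alts) (plug-⊚ C D u)
    plug-⊚ (caseᵃ a K s E)  D u = cong (case a K s) (plug-⊚ᵃ E D u)
    plug-⊚ᵛ (here C ss) D u = cong (_∷ ss) (plug-⊚ C D u)
    plug-⊚ᵛ (there s E) D u = cong (s ∷_) (plug-⊚ᵛ E D u)
    plug-⊚ᵃ (here C alts) D u = cong (_∷ alts) (plug-⊚ C D u)
    plug-⊚ᵃ (there s E)   D u = cong (s ∷_) (plug-⊚ᵃ E D u)

    -- Demand that enters a term comes to rest at a value or a letrec; the only other possibility is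
    -- a variable (see `Focus`), where it passes on to a binding.
    data Terminal {n} : LTm n → Set where
      lam    : ∀ {s} → Clean s → Terminal (lam S s)
      con    : ∀ {a K} {c : a ∈ arities K} {ss} → Everyᵛ Dull ss → Terminal (con S K c ss)
      letrec : ∀ {k} {bs : Vec _ (suc k)} {t} → Everyᵛ Dull bs → Clean t → Terminal (letrec S bs t)

    data Focus {n} : LTm n → Set where
      var      : ∀ x → Focus (var S x)
      terminal : ∀ {r} → Terminal r → Focus r

    Terminal-finished : ∀ {n} {r : LTm n} → Terminal r → Every Finished r
    Terminal-finished (lam p)      = tt , Every-map Dull-Finished _ p
    Terminal-finished (con p)      = tt , Every-mapᵛ Dull-Finished _ p
    Terminal-finished (letrec p q) = (λ ()) , Every-mapᵛ Dull-Finished _ p , Every-map Dull-Finished _ q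

    NonVar-dull : ∀ {n} (u : LTm n) → Clean u → Every NonVar u
    NonVar-dull = Every-map (Admissible.on-dull NonVar-admissible)

    record Descent {ds n} (C : LCtx ds n) (l : LTm n) (t : LTm (ds ▷ n)) : Set where
      field
        {A}    : LCtx [] (ds ▷ n)
        {r}    : LTm (ds ▷ n)
        spine  : IsV A
        focus  : Focus r
        same   : forget (plug A r) ≡ forget t
        steps  : l ⇝* plug C (plug A r)

    module _ where
      open Descent

      -- No fail rule applies as long as no variable is labelled `S` or `T`. A context of the
      -- descent has to preserve this for the labelling steps at its hole to be permitted.
      Safe : ∀ {ds n} → LCtx ds n → Set
      Safe C = ∀ {u} → Every NonVar u → Every NonVar (plug C u)

      safe-step : ∀ {ds n} (C : LCtx ds n) → Safe C → ∀ {u u′} → Every NonVar u → u ⇝₀ u′ → plug C u ⇝ plug C u′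
      safe-step C safe {u} p st = at C st (¬Fails (Every-map NonVar-nofail (plug C u) (safe p)))

      wrap : ∀ {ds n} (C : LCtx ds n) (D : LCtx [] (ds ▷ n)) {l u s t} →
             l ⇝ plug C (plug D u) → (∀ {A} → IsV A → IsV (D ⊚ A)) →
             (∀ {v} → forget v ≡ forget s → forget (plug D v) ≡ forget t) →
             Descent (C ⊚ D) (plug (C ⊚ D) u) s → Descent C l t
      wrap C D {l} {u} st sp fo d = record
        { A = D ⊚ A d ; r = r d ; spine = sp (spine d) ; focus = focus d
        ; same = trans (cong forget (plug-⊚ D (A d) (r d))) (fo (same d))
        ; steps = st ◅ subst₂ _⇝*_ (plug-⊚ C D u)
            (trans (plug-⊚ C D (plug (A d) (r d))) (cong (plug C) (sym (plug-⊚ D (A d) (r d))))) (steps d) }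

      Safe-⊚ : ∀ {ds n} (C : LCtx ds n) D → Safe C → (∀ {u} → Every NonVar u → Every NonVar (plug D u)) → Safe (C ⊚ D)
      Safe-⊚ C D safe safeD {u} p = subst (Every NonVar) (sym (plug-⊚ C D u)) (safe (safeD p))

      descend : ∀ {ds n} (C : LCtx ds n) → Safe C → ∀ t → Below Dull t → Descent C (plug C (t ^ S)) t
      descend C safe (var a x)       p = record { A = hole ; spine = hole ; focus = var x ; same = refl ; steps = Star.ε }
      descend C safe (lam a s)       p = record { A = hole ; spine = hole ; focus = terminal (lam p) ; same = refl ; steps = Star.ε }
      descend C safe (con a K c ss)  p = record { A = hole ; spine = hole ; focus = terminal (con p) ; same = refl ; steps = Star.ε }
      descend C safe (letrec a bs t) (p , q) =
        record { A = hole ; spine = hole ; focus = terminal (letrec p q) ; same = refl ; steps = Star.ε }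
      descend C safe (app a s t) (p , q) = wrap C (appˡ V hole t)
        (safe-step C safe (tt , NonVar-dull s p , NonVar-dull t q) (app isS s t)) (λ A → app A q)
        (cong (λ z → app tt z (forget t)))
        (descend (C ⊚ appˡ V hole t) (Safe-⊚ C _ safe (λ r → tt , r , NonVar-dull t q)) s (proj₂ p))
      descend C safe (seq a s t) (p , q) = wrap C (seqˡ V hole t)
        (safe-step C safe (tt , NonVar-dull s p , NonVar-dull t q) (seq isS s t)) (λ A → seq A q)
        (cong (λ z → seq tt z (forget t)))
        (descend (C ⊚ seqˡ V hole t) (Safe-⊚ C _ safe (λ r → tt , r , NonVar-dull t q)) s (proj₂ p))
      descend C safe (case a K s alts) (p , q) = wrap C (caseˢ V K hole alts)
        (safe-step C safe (tt , NonVar-dull s p , q′) (case isS s alts)) (λ A → case A q)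
        (cong (λ z → case tt K z _))
        (descend (C ⊚ caseˢ V K hole alts) (Safe-⊚ C _ safe (λ r → tt , r , q′)) s (proj₂ p))
        where q′ = Every-mapᵃ (Admissible.on-dull NonVar-admissible) alts q

  -- The variable that evaluation of the term demands first. Annotations are ignored, so that the
  -- relation passes between a program and its labelled versions.
  data Heads {A : Set} {n} : Tm A n → Fin n → Set where
    var  : ∀ {a x} → Heads (var a x) x
    app  : ∀ {a s t x} → Heads s x → Heads (app a s t) x
    seq  : ∀ {a s t x} → Heads s x → Heads (seq a s t) x
    case : ∀ {a K s alts x} → Heads s x → Heads (case a K s alts) x

  Heads-relabel⁺ : ∀ {A B n x} {f : A → B} {s : Tm A n} → Heads s x → Heads (relabel f s) x
  Heads-relabel⁺ var      = var
  Heads-relabel⁺ (app h)  = app (Heads-relabel⁺ h)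
  Heads-relabel⁺ (seq h)  = seq (Heads-relabel⁺ h)
  Heads-relabel⁺ (case h) = case (Heads-relabel⁺ h)

  Heads-relabel⁻ : ∀ {A B n x} {f : A → B} (s : Tm A n) → Heads (relabel f s) x → Heads s x
  Heads-relabel⁻ (var a x)         var      = var
  Heads-relabel⁻ (app a s t)       (app h)  = app (Heads-relabel⁻ s h)
  Heads-relabel⁻ (seq a s t)       (seq h)  = seq (Heads-relabel⁻ s h)
  Heads-relabel⁻ (case a K s alts) (case h) = case (Heads-relabel⁻ s h)

  module _ where
    open Need
    open Labels

    Heads-plugV : ∀ {n} {A : LCtx [] n} {a x} → IsV A → Heads (plug A (var a x)) x
    Heads-plugV hole       = var
    Heads-plugV (app A _)  = app (Heads-plugV A)
    Heads-plugV (seq A _)  = seq (Heads-plugV A)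
    Heads-plugV (case A _) = case (Heads-plugV A)

    same-plug : ∀ {m} {A : LCtx [] m} → IsV A → ∀ (l l′ : Label) (y : Fin m) → forget (plug A (var l y)) ≡ forget (plug A (var l′ y))
    same-plug hole       l l′ y = refl
    same-plug (app A _)  l l′ y = cong (λ z → app tt z _) (same-plug A l l′ y)
    same-plug (seq A _)  l l′ y = cong (λ z → seq tt z _) (same-plug A l l′ y)
    same-plug (case A _) l l′ y = cong (λ z → case tt _ z _) (same-plug A l l′ y)

    entry : ∀ {A n k} → Vec (Tm A n) k → Fin k → CtxVec A [] n k
    entry (b ∷ bs) zero    = here hole bs
    entry (b ∷ bs) (suc y) = there b (entry bs y)

    plugVec-entry : ∀ {A n k} (bs : Vec (Tm A n) k) y u → plugVec (entry bs y) u ≡ bs [ y ]≔ u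
    plugVec-entry (b ∷ bs) zero    u = refl
    plugVec-entry (b ∷ bs) (suc y) u = cong (b ∷_) (plugVec-entry bs y u)

    private
      app-inj₁ : ∀ {A n a b} {s s′ t t′ : Tm A n} → _≡_ {A = Tm A n} (app a s t) (app b s′ t′) → s ≡ s′
      app-inj₁ refl = refl
      app-inj₂ : ∀ {A n a b} {s s′ t t′ : Tm A n} → _≡_ {A = Tm A n} (app a s t) (app b s′ t′) → t ≡ t′
      app-inj₂ refl = refl
      seq-inj₁ : ∀ {A n a b} {s s′ t t′ : Tm A n} → _≡_ {A = Tm A n} (seq a s t) (seq b s′ t′) → s ≡ s′
      seq-inj₁ refl = refl
      seq-inj₂ : ∀ {A n a b} {s s′ t t′ : Tm A n} → _≡_ {A = Tm A n} (seq a s t) (seq b s′ t′) → t ≡ t′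
      seq-inj₂ refl = refl
      case-inj₁ : ∀ {A n a b K K′} {s s′ : Tm A n} {t t′} → _≡_ {A = Tm A n} (case a K s t) (case b K′ s′ t′) → s ≡ s′
      case-inj₁ refl = refl

    unclean : ∀ {n ds} (C : LCtx ds n) {x t} → plug C (var S x) ≡ t → ¬ Clean t
    unclean C refl p = proj₁ (Every-plug C p) isS

    unclean-alts : ∀ {n ds a b K K′} {s s′ : LTm n} (E : CtxAlts Label ds n (arities K)) {x alts} →
                   case a K s (plugAlts E (var S x)) ≡ case b K′ s′ alts → ¬ Everyᵃ Dull alts
    unclean-alts E refl p = proj₁ (Every-plugᵃ E p) isS

    -- Labelling and fail rules may match with any context `C`, but when the side terms of a spine
    -- are clean, the only variable labelled `S` is the one at its end. As the scope at the hole
    -- depends on `ds`, the binder list and the variable are compared together in a Σ-type.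
    spine-var : ∀ {n} {A : LCtx [] n} → IsV A → ∀ {ds} (C : LCtx ds n) {x y} →
                plug C (var S x) ≡ plug A (var S y) → _≡_ {A = Σ (List ℕ) λ ds → Fin (ds ▷ n)} (ds , x) ([] , y)
    spine-var hole       hole             refl = refl
    spine-var (app A _)  (appˡ a C t)     eq   = spine-var A C (app-inj₁ eq)
    spine-var (app {t = t} _ q) (appʳ a s C) eq = ⊥-elim (unclean C {t = t} (app-inj₂ eq) q)
    spine-var (seq A _)  (seqˡ a C t)     eq   = spine-var A C (seq-inj₁ eq)
    spine-var (seq {t = t} _ q) (seqʳ a s C) eq = ⊥-elim (unclean C {t = t} (seq-inj₂ eq) q)
    spine-var (case A _) (caseˢ a K C t)  eq   = spine-var A C (case-inj₁ eq)
    spine-var (case _ q) (caseᵃ a K s E)  eq   = ⊥-elim (unclean-alts E eq q)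

    spine-occ : ∀ {k n} {A : LCtx [] (k + n)} → IsV A → ∀ {ds} (C : LCtx ds (k + n)) (x y : Fin k) →
                plug C (occ S ds x) ≡ plug A (var S (y ↑ˡ n)) → x ≡ y
    spine-occ {k} {n} A {ds} C x y eq = Finₚ.↑ˡ-injective n x y (go ds (spine-var A C eq))
      where
      go : ∀ ds {z w} → _≡_ {A = Σ (List ℕ) λ ds → Fin (ds ▷ (k + n))} (ds , lookup (embed ds) z) ([] , w) → z ≡ w
      go []       eq = trans (sym (lookup-id _)) (second eq)
        where
        second : ∀ {a b} → _≡_ {A = Σ (List ℕ) λ ds → Fin (ds ▷ (k + n))} ([] , a) ([] , b) → a ≡ b
        second refl = refl
      go (d ∷ ds) ()

  -- Search for the demanded binding

  module HeadVariables where
    open Model 1 0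

    Heads-inside : ∀ {A n x ρ τ m} {s : Tm A n} → Heads s x → ⟦ s ⟧ ρ τ m → ∃₂ (ρ x)
    Heads-inside var      (m , x , _) = _ , m , x
    Heads-inside (app h)  (_ , _ , _ , x , _) = Heads-inside h x
    Heads-inside (seq h)  (_ , _ , _ , x , _) = Heads-inside h x
    Heads-inside (case h) (_ , _ , _ , _ , _ , x , _) = Heads-inside h x

  module Search {n k} (pbs : Vec (Exp (suc k + n)) (suc k)) (pbody : Exp (suc k + n)) where
    open Model 1 0
    open Contexts 1 0
    open Need
    open Labels
    open HeadVariables

    program : Exp n
    program = letrec tt pbs pbody

    _⇒_ : Fin (suc k) → Fin (suc k) → Set
    i ⇒ j = Heads (lookup pbs i) (j ↑ˡ n)

    _⇒⁺_ : Fin (suc k) → Fin (suc k) → Set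
    i ⇒⁺ j = ∃ λ z → i ⇒ z × Star _⇒_ z j

    _⇒⁺-∷_ : ∀ {i j z} → i ⇒⁺ j → j ⇒ z → i ⇒⁺ z
    (_ , e , es) ⇒⁺-∷ e′ = _ , e , es ◅◅ (e′ ◅ Star.ε)

    Reached : Fin (suc k) → Set
    Reached i = ∃ λ z → Heads pbody (z ↑ˡ n) × Star _⇒_ z i

    Stage : ℕ → Fin (suc k) → Set
    Stage N i = ∃₂ (kleene (binds pbs ∅ᵉ) N i)

    Stage-heads : ∀ {N i x} → Heads (lookup pbs i) x → Stage N i → ∃ λ N′ → N′ < N × ∃₂ ((kleene (binds pbs ∅ᵉ) N′ ⧺ ∅ᵉ {n}) x)
    Stage-heads {suc N} {i} h (τ , m , x) =
      N , ≤-refl , Heads-inside h (subst (λ d → d τ m) (binds-lookup pbs i) x)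

    Stage-⇒ : ∀ {N i j} → i ⇒ j → Stage N i → ∃ λ N′ → N′ < N × Stage N′ j
    Stage-⇒ {N} {i} {j} h x with Stage-heads {N} {i} h x
    ... | N′ , l , τ , m , y = N′ , l , τ , m , subst (λ d → d τ m) (⧺-↑ˡ _ ∅ᵉ j) y

    Stage-⇒⋆ : ∀ N {i j} → Star _⇒_ i j → Stage N i → ∃ λ N′ → N′ ≤ N × Stage N′ j
    Stage-⇒⋆ N Star.ε   x = N , ≤-refl , x
    Stage-⇒⋆ N {i} (e ◅ es) x with Stage-⇒ {N} {i} e x
    ... | N′ , l , y with Stage-⇒⋆ N′ es y
    ... | N″ , l′ , z = N″ , ≤-trans l′ (<⇒≤ l) , z

    -- The Kleene stage drops along every head edge, so the search never meets a
    -- visited binding and the fail rules do not apply.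

    acyclic : ∀ N {i} → Stage N i → ¬ (i ⇒⁺ i)
    acyclic = <-rec (λ N → ∀ {i} → Stage N i → ¬ (i ⇒⁺ i)) (λ N ih {i} x (z , e , es) →
      let N′ , l , y = Stage-⇒ {N} {i} e x ; N″ , l′ , w = Stage-⇒⋆ N′ es y in
      ih (≤-<-trans l′ l) w (z , e , es))

    bound : ∀ {k} {δ : Fin k → Pred} x → ∃₂ ((δ ⧺ ∅ᵉ {n}) x) → ∃ λ y → x ≡ y ↑ˡ n × ∃₂ (δ y)
    bound {zero}  x ()
    bound {suc k} zero p = zero , refl , p
    bound {suc k} {δ} (suc x) p with bound {δ = δ ∘ suc} x p
    ... | y , refl , q = suc y , refl , q

    -- The labelled occurrence of xₘ at which the chain to the binding cur starts.

    data Reference (lbs : Vec (LTm (suc k + n)) (suc k)) (B : LTm (suc k + n)) (cur xₘ : Fin (suc k)) : Set where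
      body : ∀ {A} → IsV A → B ≡ plug A (var V (xₘ ↑ˡ n)) → Reference lbs B cur xₘ
      bind : ∀ u {A} → IsV A → ¬ IsHole A → lookup lbs u ≡ plug A (var V (xₘ ↑ˡ n)) →
             u ⇒⁺ cur → Reached u → ∃ (λ N → Stage N u) → Reference lbs B cur xₘ

    -- Invariant of the search. `lbs` omits the `S` of the binding under inspection, which keeps it
    -- clean; `steps` puts it back. By `status`, a binding that has been passed leads to `cur` by
    -- head edges, and any other carries no label at its root. `chain` and `ref` keep the occurrence
    -- on which a copying, (seq) or (case) rule will act.
    record State (cur : Fin (suc k)) : Set where
      field
        lbs    : Vec (LTm (suc k + n)) (suc k)
        B      : LTm (suc k + n)
        steps  : start program ⇝* letrec V (lbs [ cur ]%= (_^ S)) B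
        clean  : ∀ i → Clean (lookup lbs i)
        cleanB : Clean B
        same   : ∀ i → forget (lookup lbs i) ≡ lookup pbs i
        sameB  : forget B ≡ pbody
        status : ∀ i → i ⇒⁺ cur ⊎ label (lookup lbs i) ≡ ∅
        {xₘ}   : Fin (suc k)
        chain  : Chain pbs cur xₘ
        ref    : Reference lbs B cur xₘ
        reach  : Reached cur

    record Final : Set where
      field
        {cur}  : Fin (suc k)
        state  : State cur
        stage  : ∃ λ N → Stage N cur
        {A}    : LCtx [] (suc k + n)
        {r}    : LTm (suc k + n)
        spine  : IsV A
        term   : Terminal r
      open State state public hiding (steps)
      field
        same-cur   : forget (plug A r) ≡ lookup pbs cur
        steps  : start program ⇝* letrec V (lbs [ cur ]≔ plug A r) B

    isHole? : ∀ {m} {A : LCtx [] m} → IsV A → (A ≡ hole) ⊎ ¬ IsHole A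
    isHole? hole       = inj₁ refl
    isHole? (app _ _)  = inj₂ λ ()
    isHole? (seq _ _)  = inj₂ λ ()
    isHole? (case _ _) = inj₂ λ ()

    Chain-trans : ∀ {x y z} → Chain pbs x y → Chain pbs y z → Chain pbs x z
    Chain-trans c []        = c
    Chain-trans c (d ∷ʳ eq) = Chain-trans c d ∷ʳ eq

    module Next {cur} (st : State cur) {N} (stage : Stage N cur) {A : LCtx [] (suc k + n)} (spine : IsV A)
                (x : Fin (suc k)) {N′} (stage′ : Stage N′ x)
                (same-cur : forget (plug A (var S (x ↑ˡ n))) ≡ lookup pbs cur)
                (steps′ : start program ⇝* letrec V (State.lbs st [ cur ]≔ plug A (var S (x ↑ˡ n))) (State.B st)) where
      open State st

      edge : cur ⇒ x
      edge = subst (λ s → Heads s (x ↑ˡ n)) same-cur (Heads-relabel⁺ (Heads-plugV spine))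

      cur≢x : x ≢ cur
      cur≢x refl = acyclic N stage (_ , edge , Star.ε)

      -- If `x` had been passed before, it would lead to `cur` by head edges, and `edge` would close
      -- a cycle.
      x-new : label (lookup lbs x) ≡ ∅
      x-new with status x
      ... | inj₁ p = contradiction (p ⇒⁺-∷ edge) (acyclic N′ stage′)
      ... | inj₂ p = p

      mid : Vec (LTm (suc k + n)) (suc k)
      mid = lbs [ cur ]≔ plug A (var S (x ↑ˡ n))

      mid-cur : lookup mid cur ≡ plug A (var S (x ↑ˡ n))
      mid-cur = lookup∘updateAt cur lbs

      mid-other : ∀ {i} → i ≢ cur → lookup mid i ≡ lookup lbs i
      mid-other {i} p = lookup∘updateAt′ i cur p lbs

      -- Among the bindings, the label `S` is on a single variable, the one at the end of the spine
      -- of `cur`; so a fail rule could only concern `cur` and `x`.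
      mid-unclean : ∀ {ds} {C : LCtx ds (suc k + n)} {i y} → lookup mid i ≡ plug C (occ S ds y) → i ≡ cur × y ≡ x
      mid-unclean {C = C} {i} {y} eq with i Finₚ.≟ cur
      ... | yes refl = refl , spine-occ spine C y x (trans (sym eq) mid-cur)
      ... | no i≢cur = contradiction (clean i) (unclean C (trans (sym eq) (mid-other i≢cur)))

      mid-nofail : NoFail (letrec V mid B)
      mid-nofail (visited bs y z C t y≢z l eq) with mid-unclean {C = C} eq
      ... | refl , refl = ∅≠ (subst V∨W (trans (cong label (mid-other y≢z)) x-new) l)
        where
        ∅≠ : ¬ V∨W ∅
        ∅≠ ()
      mid-nofail (self bs y C t eq) with mid-unclean {C = C} eq
      ... | refl , p = cur≢x (sym p)

      mid-safe : ¬ Fails (letrec V mid B)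
      mid-safe = ¬Fails (mid-nofail , Every-tabulate (lookup-≔-elim {bs = lbs} {P = λ _ → Every NoFail}
          (Admissible.plugV NoFail-admissible spine ((λ ()) , tt)) (λ i _ → dull (clean i))) , dull cleanB)
        where
        dull : ∀ {m} {u : LTm m} → Clean u → Every NoFail u
        dull = Every-map (Admissible.on-dull NoFail-admissible) _

      module _ (t : LTm (suc k + n)) (t-clean : Clean t) (t-same : forget t ≡ lookup pbs cur)
               (st : letrec V mid B ⇝ letrec V ((mid [ cur ]≔ t) [ x ]%= (_^ S)) B)
               {xₘ} (chain′ : Chain pbs x xₘ) (ref′ : Reference (lbs [ cur ]≔ t) B x xₘ) where

        next : State x
        next = record
          { lbs = lbs [ cur ]≔ t ; B = B
          ; steps = steps′ ◅◅ subst (λ bs → letrec V mid B ⇝ letrec V (bs [ x ]%= (_^ S)) B) (Vecₚ.[]≔-idempotent lbs cur) st ◅ Star.ε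
          ; clean = lookup-≔-elim {bs = lbs} {P = λ _ → Clean} t-clean (λ i _ → clean i)
          ; cleanB = cleanB
          ; same = lookup-≔-elim {bs = lbs} {P = λ i s → forget s ≡ lookup pbs i} t-same (λ i _ → same i)
          ; sameB = sameB
          ; status = lookup-≔-elim {bs = lbs} {P = λ i s → i ⇒⁺ x ⊎ label s ≡ ∅} (inj₁ (_ , edge , Star.ε))
              (λ i _ → [ (λ p → inj₁ (p ⇒⁺-∷ edge)) , inj₂ ]′ (status i))
          ; chain = chain′ ; ref = ref′
          ; reach = let z , h , es = reach in z , h , es ◅◅ (edge ◅ Star.ε) }

      occ≡ : ∀ (l : Label) → occ l [] x ≡ var {n = suc k + n} l (x ↑ˡ n)
      occ≡ l = cong (var l) (lookup-id (x ↑ˡ n))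

      next-state : State x
      next-state with isHole? spine
      ... | inj₂ nh = next (plug A (var V (x ↑ˡ n))) t-clean (trans (same-plug spine V S _) same-cur)
        (subst (λ u → letrec V mid B ⇝ letrec V ((mid [ cur ]≔ plug A u) [ x ]%= (_^ S)) B) (occ≡ V)
          (at hole (bind mid x cur A B cur≢x nh (trans mid-cur (cong (plug A) (sym (occ≡ S))))) mid-safe))
        [] (bind cur spine nh (lookup∘updateAt cur lbs) (_ , edge , Star.ε) reach (N , stage))
        where
        t-clean = Admissible.plugV Dull-admissible spine (V-dull , tt)
      -- An empty spine means `cur = x`: this link is put in front of the chain, and the occurrence
      -- at its end stays. With frames in between, as above, a new chain begins at `x`.
      ... | inj₁ refl = next (var W (x ↑ˡ n)) (W-dull , tt) same-cur
        (at hole (alias mid x cur B cur≢x mid-cur) mid-safe)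
        (Chain-trans ([] ∷ʳ sym same-cur) chain) (ref′ ref)
        where
        ref′ : ∀ {t} → Reference lbs B cur xₘ → Reference (lbs [ cur ]≔ t) B x xₘ
        ref′ (body s eq) = body s eq
        ref′ {t} (bind u s nh eq p r ne) = bind u s nh
          (trans (lookup∘updateAt′ u cur (λ { refl → acyclic N stage p }) lbs) eq) (p ⇒⁺-∷ edge) r ne

    -- Recursion on the Kleene stage: the binding demanded next has a token one stage earlier, and
    -- at stage zero no binding has any.
    search : ∀ N {cur} → Stage N cur → State cur → Final
    search (suc N) {cur} ne st = go (Descent.focus d) (Descent.same d) (Descent.steps d)
      where
      open State st
      C : LCtx (suc k ∷ []) n
      C = letrecᵉ V (entry lbs cur) B
      nonvar : ∀ {m} {u : LTm m} → Clean u → Every NonVar u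
      nonvar {u = u} = NonVar-dull u
      safe : Safe C
      safe {u} p = tt , subst (Everyᵛ NonVar) (sym (plugVec-entry lbs cur u))
        (Every-tabulate (lookup-≔-elim {bs = lbs} {P = λ _ → Every NonVar} p (λ i _ → nonvar (clean i)))) , nonvar cleanB
      d : Descent C (plug C (lookup lbs cur ^ S)) (lookup lbs cur)
      d = descend C safe (lookup lbs cur) (proj₂ (clean cur))
      A : LCtx [] (suc k + n)
      A = Descent.A d
      steps-to : ∀ {r} → plug C (lookup lbs cur ^ S) ⇝* plug C (plug A r) →
                 start program ⇝* letrec V (lbs [ cur ]≔ plug A r) B
      steps-to {r} rs = steps ◅◅ subst₂ _⇝*_
        (cong (λ bs → letrec V bs B) (trans (plugVec-entry lbs cur _) (sym (Vecₚ.updateAt-cong-local cur lbs refl))))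
        (cong (λ bs → letrec V bs B) (plugVec-entry lbs cur _)) rs
      go : ∀ {r} → Focus r → forget (plug A r) ≡ forget (lookup lbs cur) →
           plug C (lookup lbs cur ^ S) ⇝* plug C (plug A r) → Final
      go (terminal t) eq rs = record
        { state = st ; stage = suc N , ne ; spine = Descent.spine d ; term = t
        ; same-cur = trans eq (same cur) ; steps = steps-to rs }
      -- The head variable has a token, which a free variable has not; so it is bound by this
      -- letrec.
      go (var w) eq rs with bound w (Heads-inside (subst (λ s → Heads s w) (trans eq (same cur))
                              (Heads-relabel⁺ (Heads-plugV (Descent.spine d))))
                              (subst (λ d → d _ _) (binds-lookup pbs cur) (proj₂ (proj₂ ne))))
      ... | x , refl , ne′ = search N ne′
        (Next.next-state st {suc N} ne (Descent.spine d) x {N} ne′ (trans eq (same cur)) (steps-to rs))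

  -- Call-by-need: contraction in a spine and its effect on the enclosing letrec

  module NeedContraction where
    open Model 1 0
    open Substitution 1 0
    open Contexts 1 0
    open Strict 0
    open Need
    open Labels
    open TermSubst (termSubst ∅) using (_/Var_; varLift)
    open Traversal {Label} varLift using (_/Vec_; _/Alts_)
    open Renaming ∅

    ⋖⇒≪ : ∀ {A B m n} {s : Tm A m} {ρ} {s′ : Tm B n} {ρ′} → s ∣ ρ ⋖ s′ ∣ ρ′ → ⟦ s ⟧ ρ ≪ ⟦ s′ ⟧ ρ′
    ⋖⇒≪ p τ c x = let c′ , y , l = _∣_⋖_∣_.lt p τ c x in c′ , l , y

    ⋖⇒⊆ : ∀ {A B m n} {s : Tm A m} {ρ} {s′ : Tm B n} {ρ′} → s ∣ ρ ⋖ s′ ∣ ρ′ → ⟦ s ⟧ ρ ⊆ ⟦ s′ ⟧ ρ′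
    ⋖⇒⊆ {s′ = s′} p τ c x = let c′ , y , l = _∣_⋖_∣_.lt p τ c x in up s′ (<⇒≤ l) y

    -- This fixes the summand `ι + ι` of `cost`: the contracta of (lbeta) and (case) can be letrecs,
    -- which charge 1 themselves, and one more unit must be left for the decrease.
    sm<cost : ∀ {A n} (s : Tm A n) c m → suc m < cost s c m
    sm<cost s c m = begin
      suc (suc m)               ≡⟨ +-comm 2 m ⟩
      m + 2                     ≤⟨ +-mono-≤ (m≤n+m m (c + c)) (m≤n+m 2 (weight s)) ⟩
      c + c + m + (weight s + 2) ∎
      where open ≤-Reasoning

    lbeta-⋖ : ∀ {n} {ρ : Env n} {a b c : Label} s t → app a (lam b s) t ∣ ρ ⋖ letrec c (t /Var wk⋆ 1 ∷ []) s ∣ ρ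
    lbeta-⋖ {ρ = ρ} {b = b} s t = mk⋖ ≤-refl (λ τ n (U , m , c , x , y , z) → suc m ,
      (m , mono s (⧺-mono {δ = λ (_ : Fin 1) → ⟪ U ⟫} {ρ = ρ} (λ { zero → ⊆-trans y arg }) ⊆ᵉ-refl) τ m x , ≤-refl) ,
      <-≤-trans (sm<cost (lam b s) c m) z)
      where
      bs = t /Var wk⋆ 1 ∷ []
      arg : ⟦ t ⟧ ρ ⊆ rec bs ρ zero
      arg = ⊆-trans (sem (ren-⊑ t (λ x → ⊆-reflexive (sym (⧺-lookup-wk⋆ 1 (rec bs ρ) ρ x))))) (rec-closed bs zero)

    case-c₀-⋖ : ∀ {n} {ρ : Env n} {a b : Label} {K} (c : 0 ∈ arities K) alts → case a K (con b K c []) alts ∣ ρ ⋖ All.lookup alts c ∣ ρ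
    case-c₀-⋖ {n} {ρ} {b = b} c alts = mk⋖ (weight≤ι (All.lookup alts c)) (λ { τ n (_ , e , Us , m , d , (_ , refl , _) , y , z) →
      m , subst (λ d → d τ m) (⟦⟧ᵃ-lookup alts ρ c (λ i → ⟪ Us i ⟫)) y , <-≤-trans (m<cost {n = n} (con b _ c []) d m) z })

    case-c-⋖ : ∀ {n k} {ρ : Env n} {a b l : Label} {K} (c : suc k ∈ arities K) ss alts →
               case a K (con b K c ss) alts ∣ ρ ⋖ letrec l (ss /Vec wk⋆ (suc k)) (All.lookup alts c) ∣ ρ
    case-c-⋖ {k = k} {ρ = ρ} {b = b} c ss alts = mk⋖ ≤-refl (λ { τ n (_ , e , Us , m , d , (_ , refl , p) , y , z) → suc m ,
      (m , mono (All.lookup alts c) (⧺-mono {δ = λ i → ⟪ Us i ⟫} {ρ = ρ} (λ i → ⊆-trans (p i) (args i)) ⊆ᵉ-refl) τ m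
         (subst (λ d → d τ m) (⟦⟧ᵃ-lookup alts ρ c _) y) , ≤-refl) ,
      <-≤-trans (sm<cost (con b _ c ss) d m) z })
      where
      bs = ss /Vec wk⋆ (suc k)
      args : ⟦ ss ⟧ᵛ ρ ⊆ᵉ rec bs ρ
      args = ⊆ᵉ-trans (ren-⊑ᵛ ss (λ x → ⊆-reflexive (sym (⧺-lookup-wk⋆ (suc k) (rec bs ρ) ρ x)))) (rec-closed bs)

    -- The view of a spine from its inner end: a redex consists of the focus and the frame right
    -- around it.
    data LastFrame {n} : LCtx [] n → Set where
      hole : LastFrame hole
      app  : ∀ {A} → IsV A → ∀ t → LastFrame (A ⊚ appˡ V hole t)
      seq  : ∀ {A} → IsV A → ∀ t → LastFrame (A ⊚ seqˡ V hole t)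
      case : ∀ {A} → IsV A → ∀ {K} alts → LastFrame (A ⊚ caseˢ V K hole alts)

    lastFrame : ∀ {n} {A : LCtx [] n} → IsV A → LastFrame A
    lastFrame hole = hole
    lastFrame (app A q) with lastFrame A
    ... | hole        = app hole _
    ... | app B t     = app (app B q) t
    ... | seq B t     = seq (app B q) t
    ... | case B alts = case (app B q) alts
    lastFrame (seq A q) with lastFrame A
    ... | hole        = seq hole _
    ... | app B t     = app (seq B q) t
    ... | seq B t     = seq (seq B q) t
    ... | case B alts = case (seq B q) alts
    lastFrame (case A q) with lastFrame A
    ... | hole        = case hole _
    ... | app B t     = app (case B q) t
    ... | seq B t     = seq (case B q) t
    ... | case B alts = case (case B q) alts

    inside : ∀ {n} {A : LCtx [] n} → IsV A → ∀ {u ρ τ m} → ⟦ plug A u ⟧ ρ τ m → ∃₂ (⟦ u ⟧ ρ)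
    inside hole       x = _ , _ , x
    inside (app A _)  (_ , _ , _ , x , _) = inside A x
    inside (seq A _)  (_ , _ , _ , x , _) = inside A x
    inside (case A _) (_ , _ , _ , _ , _ , x , _) = inside A x

    spine-⋖ : ∀ {n} {A : LCtx [] n} → IsV A → ∀ {ρ u u′} → u ∣ ρ ⋖ u′ ∣ ρ → plug A u ∣ ρ ⋖ plug A u′ ∣ ρ
    spine-⋖ hole       p = p
    spine-⋖ (app A _)  p = app-⋖ (⋖⇒◃ (spine-⋖ A p)) ⊆-refl
    spine-⋖ (seq A _)  p = seq-⋖ (⋖⇒◃ (spine-⋖ A p)) ⊆-refl
    spine-⋖ (case A _) p = case-⋖ (⋖⇒◃ (spine-⋖ A p)) (λ e δ → ⊆-refl)

    spine-ren-⋖ : ∀ {m n} {A : LCtx [] m} → IsV A → ∀ {ρ ρ′ u u′} {σ : Sub Fin m n} → ρ ⊆ᵉ ρ′ ∘ lookup σ →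
                  u ∣ ρ ⋖ u′ ∣ ρ′ → plug A u ∣ ρ ⋖ plug (A /Ctx σ) u′ ∣ ρ′
    spine-ren-⋖ hole              q p = p
    spine-ren-⋖ (app {t = t} A _) q p = app-⋖ (⋖⇒◃ (spine-ren-⋖ A q p)) (sem (ren-⊑ t q))
    spine-ren-⋖ (seq {t = t} A _) q p = seq-⋖ (⋖⇒◃ (spine-ren-⋖ A q p)) (sem (ren-⊑ t q))
    spine-ren-⋖ (case {alts = alts} A _) q p = case-⋖ (⋖⇒◃ (spine-ren-⋖ A q p)) (ren-⊑ᵃ alts q)

    -- The innermost frame turns a mere drop in weight, as from copying an abstraction, into a drop
    -- in cost; the frames around it preserve that.
    frame-⋖ : ∀ {n} {A : LCtx [] n} → LastFrame A → ¬ IsHole A → ∀ {ρ u u′} → u ∣ ρ ◃ u′ ∣ ρ → plug A u ∣ ρ ⋖ plug A u′ ∣ ρ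
    frame-⋖ hole nh = contradiction isHole nh
    frame-⋖ (app {A} a t) _ {ρ} {u} {u′} p = subst₂ (λ s s′ → s ∣ ρ ⋖ s′ ∣ ρ) (sym (plug-⊚ A _ u)) (sym (plug-⊚ A _ u′))
      (spine-⋖ a (app-⋖ p ⊆-refl))
    frame-⋖ (seq {A} a t) _ {ρ} {u} {u′} p = subst₂ (λ s s′ → s ∣ ρ ⋖ s′ ∣ ρ) (sym (plug-⊚ A _ u)) (sym (plug-⊚ A _ u′))
      (spine-⋖ a (seq-⋖ p ⊆-refl))
    frame-⋖ (case {A} a alts) _ {ρ} {u} {u′} p = subst₂ (λ s s′ → s ∣ ρ ⋖ s′ ∣ ρ) (sym (plug-⊚ A _ u)) (sym (plug-⊚ A _ u′))
      (spine-⋖ a (case-⋖ p (λ e δ → ⊆-refl)))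

    Local : ∀ {ds n} → LCtx ds n → LTm (ds ▷ n) → Set₁
    Local C s = ∃ λ s′ → plug C s ↦ plug C s′ × (∀ ρ → s ∣ ρ ⋖ s′ ∣ ρ)

    local-redex : ∀ {ds n} (C : LCtx ds n) {A : LCtx [] (ds ▷ n)} (F : LCtx [] (ds ▷ n)) {r q′} → IsV A →
                  plug (C ⊚ A) (plug F r) ↦ plug (C ⊚ A) q′ → (∀ ρ → plug F r ∣ ρ ⋖ q′ ∣ ρ) → Local C (plug (A ⊚ F) r)
    local-redex C {A} F {r} {q′} a st p = plug A q′ ,
      subst₂ _↦_ (trans (plug-⊚ C A (plug F r)) (cong (plug C) (sym (plug-⊚ A F r)))) (plug-⊚ C A q′) st ,
      λ ρ → subst (λ s → s ∣ ρ ⋖ plug A q′ ∣ ρ) (sym (plug-⊚ A F r)) (spine-⋖ a (p ρ))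

    -- The frame and the focus together select the rule; the ill-typed pairs, such as an applied
    -- constructor, are excluded by the token.
    local : ∀ {ds n} (C : LCtx ds n) {A : LCtx [] (ds ▷ n)} {r ρ} → LastFrame A → ¬ IsHole A → Terminal r →
            ∃₂ (⟦ plug A r ⟧ ρ) → Local C (plug A r)
    local C hole nh t x = contradiction isHole nh
    local C {r = r} {ρ} (app {A} a t) _ term (τ , m , x) =
      go term (inside a (subst (λ s → ⟦ s ⟧ ρ τ m) (plug-⊚ A (appˡ V hole t) r) x))
      where
      go : ∀ {r} → Terminal r → ∃₂ (⟦ app V r t ⟧ ρ) → Local C (plug (A ⊚ appˡ V hole t) r)
      go (lam {s} _) _ = local-redex C (appˡ V hole t) a (lbeta (C ⊚ A) s t) (λ ρ → lbeta-⋖ s t)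
      go (con _) (_ , _ , _ , _ , _ , (_ , () , _) , _)
      go (letrec {bs = bs} {s} _ _) _ = local-redex C (appˡ V hole t) a (lapp (C ⊚ A) bs s t) (λ ρ → lapp-⋖ ∅ bs)
    local C (seq {A} a t) _ (lam {s} _) _ =
      local-redex C (seqˡ V hole t) a (seq-c (C ⊚ A) t lam refl) (λ ρ → seq-value-⋖)
    local C (seq {A} a t) _ (con _) _ =
      local-redex C (seqˡ V hole t) a (seq-c (C ⊚ A) t con refl) (λ ρ → seq-value-⋖)
    local C (seq {A} a t) _ (letrec {bs = bs} {s} _ _) _ =
      local-redex C (seqˡ V hole t) a (lseq (C ⊚ A) bs s t) (λ ρ → lseq-⋖ ∅ bs)
    local C {r = r} {ρ} (case {A} a {K} alts) _ term (τ , m , x) =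
      go term (inside a (subst (λ s → ⟦ s ⟧ ρ τ m) (plug-⊚ A (caseˢ V K hole alts) r) x))
      where
      go : ∀ {r} → Terminal r → ∃₂ (⟦ case V K r alts ⟧ ρ) → Local C (plug (A ⊚ caseˢ V K hole alts) r)
      go (lam _) (_ , _ , _ , _ , _ , _ , _ , () , _)
      go (con {zero} {c = c} {[]} _) (_ , _ , _ , _ , _ , _ , _ , (_ , refl , _) , _) =
        local-redex C (caseˢ V K hole alts) a (case-c₀ (C ⊚ A) c alts) (λ ρ → case-c₀-⋖ c alts)
      go (con {suc _} {c = c} {ss} _) (_ , _ , _ , _ , _ , _ , _ , (_ , refl , _) , _) =
        local-redex C (caseˢ V K hole alts) a (case-c (C ⊚ A) c ss alts) (λ ρ → case-c-⋖ c ss alts)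
      go (letrec {bs = bs} {s} _ _) _ = local-redex C (caseˢ V K hole alts) a (lcase (C ⊚ A) bs s alts) (λ ρ → lcase-⋖ ∅ bs)

    -- Every strict frame pays for the cost of its term, so a saving at the head variable reaches
    -- the whole term and remains strict.
    Heads-⋖ : ∀ {A n x} {t : Tm A n} {ρ ρ′} → Heads t x → ρ ⊆ᵉ ρ′ → ρ x ≪ ρ′ x → t ∣ ρ ⋖ t ∣ ρ′
    Heads-⋖ var p q = mk⋖ ≤-refl (λ τ n (m , x , l) → let m′ , l′ , y = q τ m x in m′ , (m′ , y , ≤-refl) , <-≤-trans l′ l)
    Heads-⋖ (app {t = t} h)  p q = app-⋖ (⋖⇒◃ (Heads-⋖ h p q)) (mono t p)
    Heads-⋖ (seq {t = t} h)  p q = seq-⋖ (⋖⇒◃ (Heads-⋖ h p q)) (mono t p)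
    Heads-⋖ (case {alts = alts} h) p q = case-⋖ (⋖⇒◃ (Heads-⋖ h p q)) (λ e δ → monoᵃ alts p e ⊆ᵉ-refl)

    -- Replacing the binding y makes it strictly cheaper; so become the bindings on
    -- a head path to y, while the others merely do not become more expensive.

    module Path {k n} (F : Vec (LTm (k + n)) k) {ρ : Env n} {y : Fin k} {δ : Fin k → Pred} (F⊆δ : rec F ρ ⊆ᵉ δ)
                (closed : ∀ i → i ≢ y → ⟦ lookup F i ⟧ (δ ⧺ ρ) ⊆ δ i) (strict : rec F ρ y ≪ δ y) where

      _⇒_ : Fin k → Fin k → Set
      i ⇒ j = Heads (lookup F i) (j ↑ˡ n)

      env-⊆ : rec F ρ ⧺ ρ ⊆ᵉ δ ⧺ ρ
      env-⊆ = ⧺-mono F⊆δ ⊆ᵉ-refl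

      head-⋖ : ∀ {t : LTm (k + n)} {z} → Heads t (z ↑ˡ n) → rec F ρ z ≪ δ z → t ∣ rec F ρ ⧺ ρ ⋖ t ∣ δ ⧺ ρ
      head-⋖ {z = z} h p = Heads-⋖ h env-⊆ (λ τ m x →
        let m′ , l , w = p τ m (subst (λ d → d τ m) (⧺-↑ˡ (rec F ρ) ρ z) x) in
        m′ , l , subst (λ d → d τ m′) (sym (⧺-↑ˡ δ ρ z)) w)

      path-≪ : ∀ {z} → Star _⇒_ z y → rec F ρ z ≪ δ z
      path-≪ Star.ε = strict
      path-≪ {z} (h ◅ hs) with z Finₚ.≟ y
      ... | yes refl = strict
      ... | no z≢y   = λ τ m x →
        let m′ , l , w = ⋖⇒≪ (head-⋖ h (path-≪ hs)) τ m (rec-lookup⊆ F z τ m x) in m′ , l , closed z z≢y τ m′ w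

    Reach : ∀ {k n} (F : Vec (LTm (k + n)) k) (B : LTm (k + n)) → Fin k → Set
    Reach {n = n} F B y = ∃ λ z → Heads B (z ↑ˡ n) × Star (λ i j → Heads (lookup F i) (j ↑ˡ n)) z y

    letrec-strict : ∀ {k k′ n a b ρ} (F : Vec (LTm (suc k + n)) (suc k)) (F′ : Vec (LTm (suc k′ + n)) (suc k′)) {B B′} →
                    B ∣ rec F ρ ⧺ ρ ⋖ B′ ∣ rec F′ ρ ⧺ ρ → letrec a F B ∣ ρ ⋖ letrec b F′ B′ ∣ ρ
    letrec-strict F F′ p = mk⋖ ≤-refl (λ τ n (m , x , l) → let m′ , y , l′ = _∣_⋖_∣_.lt p τ m x in
      suc m′ , (m′ , y , ≤-refl) , <-≤-trans (s≤s l′) l)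

    module Update {k n} (F : Vec (LTm (suc k + n)) (suc k)) (y : Fin (suc k)) (q : LTm (suc k + n)) (ρ : Env n) where

      F′ : Vec (LTm (suc k + n)) (suc k)
      F′ = F [ y ]≔ q

      δ : Fin (suc k) → Pred
      δ = rec F′ ρ

      F′-y : lookup F′ y ≡ q
      F′-y = lookup∘updateAt y F

      F′-other : ∀ {i} → i ≢ y → lookup F′ i ≡ lookup F i
      F′-other {i} p = lookup∘updateAt′ i y p F

      kept-⊆ : ∀ {i} → i ≢ y → δ i ⊆ ⟦ lookup F i ⟧ (δ ⧺ ρ)
      kept-⊆ {i} p = ⊆-trans (rec-lookup⊆ F′ i) (⟦⟧-≡ (F′-other p))

      kept-⊇ : ∀ i → i ≢ y → ⟦ lookup F i ⟧ (δ ⧺ ρ) ⊆ δ i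
      kept-⊇ i p = ⊆-trans (⟦⟧-≡ (sym (F′-other p))) (rec-lookup⊇ F′ i)

      q-⊆ : ⟦ q ⟧ (δ ⧺ ρ) ⊆ δ y
      q-⊆ = ⊆-trans (⟦⟧-≡ (sym F′-y)) (rec-lookup⊇ F′ y)

      -- The saving is assumed in the new solution `δ`. As `δ` is then closed under the old
      -- bindings, it contains the old solution, and the saving travels from `y` along the head path
      -- to the body.
      update-⋖ : ∀ {a b B} → lookup F y ∣ δ ⧺ ρ ⋖ q ∣ δ ⧺ ρ → Reach F B y → letrec a F B ∣ ρ ⋖ letrec b F′ B ∣ ρ
      update-⋖ p (z , h , hs) = letrec-strict F F′ (Path.head-⋖ F F⊆δ kept-⊇ strict h (Path.path-≪ F F⊆δ kept-⊇ strict hs))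
        where
        F⊆δ : rec F ρ ⊆ᵉ δ
        F⊆δ = rec-least F (λ i → ⊆-trans (⊆-reflexive (binds-lookup F i)) (at-i i))
          where
          at-i : ∀ i → ⟦ lookup F i ⟧ (δ ⧺ ρ) ⊆ δ i
          at-i i with i Finₚ.≟ y
          ... | yes refl = ⊆-trans (⋖⇒⊆ p) q-⊆
          ... | no i≢y   = kept-⊇ i i≢y
        strict : rec F ρ y ≪ δ y
        strict τ m x = let m′ , l , w = ⋖⇒≪ p τ m (mono (lookup F y) (⧺-mono F⊆δ ⊆ᵉ-refl) τ m (rec-lookup⊆ F y τ m x)) in
          m′ , l , q-⊆ τ m′ w

    -- The chain is given in the old bindings `F` but has to be followed in a solution of changed
    -- ones, hence the inclusions along variable bindings as a premise.
    chain-post-⊆ : ∀ {k n} {F : Vec (LTm (k + n)) k} {δ : Fin k → Pred} →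
                   (∀ w {a z} → lookup F w ≡ var a (z ↑ˡ n) → δ w ⊆ δ z) → ∀ {x y} → Chain F x y → δ y ⊆ δ x
    chain-post-⊆ p []        = ⊆-refl
    chain-post-⊆ p (c ∷ʳ eq) = ⊆-trans (p _ eq) (chain-post-⊆ p c)

  -- Call-by-need: flattening of letrecs and splitting of shared constructors

  module NeedRestructuring where
    open Model 1 0
    open Substitution 1 0
    open Contexts 1 0
    open Strict 0
    open Need
    open Labels
    open NeedContraction
    open TermSubst (termSubst ∅) using (_/Var_; varLift)
    open Traversal {Label} varLift using (_/Vec_; _/Alts_)
    open Renaming ∅
    open NeedSoundness using (lookup-/Alts; plug-/Ctx)

    lookup-/Vec : ∀ {m n k} (ss : Vec (LTm m) k) (σ : Sub Fin m n) i → lookup (ss /Vec σ) i ≡ lookup ss i /Var σ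
    lookup-/Vec (s ∷ ss) σ zero    = refl
    lookup-/Vec (s ∷ ss) σ (suc i) = lookup-/Vec ss σ i

    -- The other half of Bekić's principle: the solution of the flattened bindings, cut into its two
    -- parts, bounds the nested ones. `bs₁′` stays a parameter because (llet-e) also changes one of
    -- the outer bindings.
    module Flattened {n k₁ k₂} (bs₁ : Vec (LTm (suc k₁ + n)) (suc k₁)) (bs₂ : Vec (LTm (suc k₂ + (suc k₁ + n))) (suc k₂))
                     (ρ : Env n) (bs₁′ : Vec (LTm ((suc k₂ + suc k₁) + n)) (suc k₁)) where

      σ : Sub Fin (suc k₁ + n) ((suc k₂ + suc k₁) + n)
      σ = insert (suc k₂) (suc k₁) n

      α : Sub Fin (suc k₂ + (suc k₁ + n)) ((suc k₂ + suc k₁) + n)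
      α = reassoc (suc k₂) (suc k₁) n

      es : Vec (LTm ((suc k₂ + suc k₁) + n)) (suc k₂ + suc k₁)
      es = (bs₂ /Vec α) ++ bs₁′

      ε : Fin (suc k₂ + suc k₁) → Pred
      ε = rec es ρ

      δ : Fin (suc k₁) → Pred
      δ j = ε (suc k₂ ↑ʳ j)

      δ′ : Fin (suc k₂) → Pred
      δ′ i = ε (i ↑ˡ suc k₁)

      ⊆-insert : δ ⧺ ρ ⊆ᵉ (ε ⧺ ρ) ∘ lookup σ
      ⊆-insert x = ⊆-reflexive (sym (⧺-lookup-insert (suc k₂) (suc k₁) ε ρ x))

      ⊆-assoc : δ′ ⧺ δ ⧺ ρ ⊆ᵉ (ε ⧺ ρ) ∘ lookup α
      ⊆-assoc x = ⊆-reflexive (sym (⧺-lookup-reassoc (suc k₂) (suc k₁) ε ρ x))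

      inner-⊆ : rec bs₂ (δ ⧺ ρ) ⊆ᵉ δ′
      inner-⊆ = rec-least bs₂ (λ i → ⊆-trans (ren-⊑ᵛ bs₂ ⊆-assoc i) (rec-++ˡ (bs₂ /Vec α) bs₁′ i))

      kept-⊆ : ∀ j → lookup bs₁′ j ≡ lookup (bs₁ /Vec σ) j → ⟦ lookup bs₁ j ⟧ (δ ⧺ ρ) ⊆ δ j
      kept-⊆ j eq = ⊆-trans (sem (ren-⊑ (lookup bs₁ j) ⊆-insert))
        (⊆-trans (⊆-reflexive (trans (cong (λ s → ⟦ s ⟧ (ε ⧺ ρ)) (trans (sym (lookup-/Vec bs₁ σ j)) (sym eq)))
                                     (sym (⟦⟧ᵛ-lookup bs₁′ (ε ⧺ ρ) j))))
          (rec-++ʳ (bs₂ /Vec α) bs₁′ j))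

      -- The charge of the letrec that disappears is what is saved.
      open-⋖ : ∀ {a} s → letrec a bs₂ s ∣ δ ⧺ ρ ⋖ s /Var α ∣ ε ⧺ ρ
      open-⋖ s = mk⋖ (weight≤ι (s /Var α)) (λ τ n (m , x , l) → m ,
        sem (ren-⊑ s ⊆-assoc) τ m (mono s (⧺-mono inner-⊆ ⊆ᵉ-refl) τ m x) , l)

    llet-in-⋖ : ∀ {n k₁ k₂ a b c} (bs₁ : Vec (LTm (suc k₁ + n)) (suc k₁)) (bs₂ : Vec (LTm (suc k₂ + (suc k₁ + n))) (suc k₂)) s ρ →
                letrec a bs₁ (letrec b bs₂ s) ∣ ρ ⋖
                letrec c ((bs₂ /Vec reassoc (suc k₂) (suc k₁) n) ++ (bs₁ /Vec insert (suc k₂) (suc k₁) n))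
                         (s /Var reassoc (suc k₂) (suc k₁) n) ∣ ρ
    llet-in-⋖ {n} {k₁} {k₂} {b = b} bs₁ bs₂ s ρ = letrec-strict bs₁ es
      (⊑-⋖-trans (⊑-mono (letrec b bs₂ s) (⧺-mono outer ⊆ᵉ-refl)) (open-⋖ s))
      where
      open Flattened bs₁ bs₂ ρ (bs₁ /Vec insert (suc k₂) (suc k₁) n)
      outer : rec bs₁ ρ ⊆ᵉ δ
      outer = rec-least bs₁ (λ j → ⊆-trans (⊆-reflexive (binds-lookup bs₁ j)) (kept-⊆ j refl))

    llet-e-⋖ : ∀ {n k₁ k₂ a b c} (bs₁ : Vec (LTm (suc k₁ + n)) (suc k₁)) y (bs₂ : Vec (LTm (suc k₂ + (suc k₁ + n))) (suc k₂)) s {B} ρ →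
               lookup bs₁ y ≡ letrec b bs₂ s → Reach bs₁ B y →
               letrec a bs₁ B ∣ ρ ⋖
               letrec c ((bs₂ /Vec reassoc (suc k₂) (suc k₁) n) ++
                         ((bs₁ /Vec insert (suc k₂) (suc k₁) n) [ y ]≔ (s /Var reassoc (suc k₂) (suc k₁) n)))
                        (B /Var insert (suc k₂) (suc k₁) n) ∣ ρ
    llet-e-⋖ {n} {k₁} {k₂} {b = b} bs₁ y bs₂ s {B} ρ eq (z , h , hs) = letrec-strict bs₁ es
      (⋖-⊑-trans (Path.head-⋖ bs₁ outer kept strict h (Path.path-≪ bs₁ outer kept strict hs)) (ren-⊑ B ⊆-insert))
      where
      bs₁′ = (bs₁ /Vec insert (suc k₂) (suc k₁) n) [ y ]≔ (s /Var reassoc (suc k₂) (suc k₁) n)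
      open Flattened bs₁ bs₂ ρ bs₁′
      kept : ∀ j → j ≢ y → ⟦ lookup bs₁ j ⟧ (δ ⧺ ρ) ⊆ δ j
      kept j p = kept-⊆ j (lookup∘updateAt′ j y p (bs₁ /Vec σ))
      here-⋖ : lookup bs₁ y ∣ δ ⧺ ρ ⋖ s /Var α ∣ ε ⧺ ρ
      here-⋖ = subst (λ t → t ∣ δ ⧺ ρ ⋖ s /Var α ∣ ε ⧺ ρ) (sym eq) (open-⋖ s)
      here-⊆ : ⟦ s /Var α ⟧ (ε ⧺ ρ) ⊆ δ y
      here-⊆ = ⊆-trans (⊆-reflexive (trans (cong (λ t → ⟦ t ⟧ (ε ⧺ ρ)) (sym (lookup∘updateAt y (bs₁ /Vec σ))))
                                           (sym (⟦⟧ᵛ-lookup bs₁′ (ε ⧺ ρ) y))))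
                       (rec-++ʳ (bs₂ /Vec α) bs₁′ y)
      outer : rec bs₁ ρ ⊆ᵉ δ
      outer = rec-least bs₁ (λ j → ⊆-trans (⊆-reflexive (binds-lookup bs₁ j)) (at-j j))
        where
        at-j : ∀ j → ⟦ lookup bs₁ j ⟧ (δ ⧺ ρ) ⊆ δ j
        at-j j with j Finₚ.≟ y
        ... | yes refl = ⊆-trans (⋖⇒⊆ here-⋖) here-⊆
        ... | no j≢y   = kept j j≢y
      strict : rec bs₁ ρ y ≪ δ y
      strict τ m x = let m′ , l , w = ⋖⇒≪ here-⋖ τ m (mono (lookup bs₁ y) (⧺-mono outer ⊆ᵉ-refl) τ m (rec-lookup⊆ bs₁ y τ m x)) in
        m′ , l , here-⊆ τ m′ w

    -- es is the result of splitting x₁ = c s₁ … sₖ; the entries of the old letrec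
    -- outside Kept may have been changed in addition.

    module Splitting {n k′ b K} (c : suc b ∈ arities K) (ss : Vec (LTm (k′ + n)) (suc b)) (bs : Vec (LTm (k′ + n)) k′)
                     {x₁ : Fin k′} (eq : lookup bs x₁ ≡ con S K c ss) (ρ : Env n)
                     (es : Vec (LTm ((suc b + k′) + n)) (suc b + k′)) (Kept : Fin k′ → Set)
                     (fields : ∀ i → lookup es (i ↑ˡ k′) ≡ lookup (ss /Vec insert (suc b) k′ n) i)
                     (shared : lookup es (suc b ↑ʳ x₁) ≡ con ∅ K c (ys (suc b)))
                     (others : ∀ j → Kept j → j ≢ x₁ → lookup es (suc b ↑ʳ j) ≡ lookup (bs /Vec insert (suc b) k′ n) j) where

      σ : Sub Fin (k′ + n) ((suc b + k′) + n)
      σ = insert (suc b) k′ n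

      ε : Fin (suc b + k′) → Pred
      ε = rec es ρ

      δ : Fin k′ → Pred
      δ j = ε (suc b ↑ʳ j)

      δ′ : Fin (suc b) → Pred
      δ′ i = ε (i ↑ˡ k′)

      ⊆-insert : δ ⧺ ρ ⊆ᵉ (ε ⧺ ρ) ∘ lookup σ
      ⊆-insert x = ⊆-reflexive (sym (⧺-lookup-insert (suc b) k′ ε ρ x))

      ys-lookup : ∀ i → lookup (ys (suc b) {k′} {n}) i ≡ var ∅ ((i ↑ˡ k′) ↑ˡ n)
      ys-lookup i = lookup∘tabulate (λ i → var ∅ ((i ↑ˡ k′) ↑ˡ n)) i

      ys-⟦⟧ : ∀ κ i → ⟦ ys (suc b) {k′} {n} ⟧ᵛ κ i ≡ ⟦ var ∅ ((i ↑ˡ k′) ↑ˡ n) ⟧ κ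
      ys-⟦⟧ κ i = trans (⟦⟧ᵛ-lookup (ys (suc b)) κ i) (cong (λ s → ⟦ s ⟧ κ) (ys-lookup i))

      ε-up : ∀ i {τ m m″} → m ≤ m″ → ε i τ m → ε i τ m″
      ε-up i = rec-up es i

      fields-⊆ : ⟦ ss ⟧ᵛ (δ ⧺ ρ) ⊆ᵉ δ′
      fields-⊆ i = ⊆-trans (ren-⊑ᵛ ss ⊆-insert i)
        (⊆-trans (⊆-reflexive (trans (⟦⟧ᵛ-lookup (ss /Vec σ) (ε ⧺ ρ) i) (cong (λ s → ⟦ s ⟧ (ε ⧺ ρ)) (sym (fields i)))))
          (rec-lookup⊇ es (i ↑ˡ k′)))

      -- The costs that a constructor token records for its fields must not rise on the way through
      -- the fresh variables; this is where `v = 0` is indispensable.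
      shared-⊆ : ⟦ lookup bs x₁ ⟧ (δ ⧺ ρ) ⊆ δ x₁
      shared-⊆ τ m x with subst (λ s → ⟦ s ⟧ (δ ⧺ ρ) τ m) eq x
      ... | Us , refl , p = rec-lookup⊇ es (suc b ↑ʳ x₁) _ m (subst (λ s → ⟦ s ⟧ (ε ⧺ ρ) _ m) (sym shared) (Us , refl , λ i κ l y →
        subst (λ d → d κ l) (sym (ys-⟦⟧ (ε ⧺ ρ) i))
          (l , subst (λ d → d κ l) (sym (⧺-↑ˡ ε ρ (i ↑ˡ k′))) (fields-⊆ i κ l (p i κ l y)) , ≤-refl)))

      kept-⊆ : ∀ j → Kept j → ⟦ lookup bs j ⟧ (δ ⧺ ρ) ⊆ δ j
      kept-⊆ j k with j Finₚ.≟ x₁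
      ... | yes refl = shared-⊆
      ... | no j≢x₁  = ⊆-trans (sem (ren-⊑ (lookup bs j) ⊆-insert))
        (⊆-trans (⟦⟧-≡ (trans (sym (lookup-/Vec bs σ j)) (sym (others j k j≢x₁))))
          (rec-lookup⊇ es (suc b ↑ʳ j)))

      -- Chains survive the split: `x₁` holds a constructor and so is not one of the variable
      -- bindings, and these are all kept.
      var-⊆ : (∀ w {a : Label} {z} → lookup bs w ≡ var a (z ↑ˡ n) → Kept w) →
              ∀ w {a z} → lookup bs w ≡ var a (z ↑ˡ n) → δ w ⊆ δ z
      var-⊆ vk w {a} {z} eqw τ m x
        with subst (λ s → ⟦ s ⟧ (ε ⧺ ρ) τ m)
               (trans (others w (vk w eqw) w≢x₁) (trans (lookup-/Vec bs σ w)
                 (trans (cong (_/Var σ) eqw) (cong (var ∅) (lookup-insert-↑ˡ (suc b) k′ n z)))))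
               (rec-lookup⊆ es (suc b ↑ʳ w) τ m x)
        where
        w≢x₁ : w ≢ x₁
        w≢x₁ refl with trans (sym eq) eqw
        ... | ()
      ... | m′ , y , l = ε-up (suc b ↑ʳ z) l (subst (λ d → d τ m′) (⧺-↑ˡ ε ρ (suc b ↑ʳ z)) y)

      module _ (vk : ∀ w {a : Label} {z} → lookup bs w ≡ var a (z ↑ˡ n) → Kept w) {xₘ} (ch : Chain bs x₁ xₘ)
               {D : LCtx [] (k′ + n)} (spine : IsV D) {a : Label} (alts : Alts Label (k′ + n) (arities K)) where

        redex : LTm (k′ + n)
        redex = case a K (occ V [] xₘ) alts

        new : LTm ((suc b + k′) + n)
        new = rebind b k′ n [] (All.lookup alts c)

        zs : Vec (LTm (suc b + ((suc b + k′) + n))) (suc b)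
        zs = ys (suc b) /Vec (embed [] ⊙ wk⋆ (suc b))

        zs-⊇ : ∀ i → δ′ i ⊆ rec zs (ε ⧺ ρ) i
        zs-⊇ i τ m x = rec-closed zs i τ m (ren-⊑ᵛ (ys (suc b)) renaming-⊆ i τ m
          (subst (λ d → d τ m) (sym (ys-⟦⟧ (ε ⧺ ρ) i)) (m , subst (λ d → d τ m) (sym (⧺-↑ˡ ε ρ (i ↑ˡ k′))) x , ≤-refl)))
          where
          renaming-⊆ : ε ⧺ ρ ⊆ᵉ (rec zs (ε ⧺ ρ) ⧺ ε ⧺ ρ) ∘ lookup (embed [] ⊙ wk⋆ (suc b))
          renaming-⊆ x = ⊆-reflexive (sym (trans (cong (rec zs (ε ⧺ ρ) ⧺ ε ⧺ ρ) (lookup-⊙ (embed []) (wk⋆ (suc b)) x))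
            (trans (⧺-lookup-wk⋆ (suc b) (rec zs (ε ⧺ ρ)) (ε ⧺ ρ) _) (cong (ε ⧺ ρ) (lookup-id x)))))

        -- The chain leads to the constructor applied to the fresh variables. Hence the field tokens
        -- that the alternative uses belong to these variables and, as indirections are free, also
        -- to the variables rebound around the alternative.
        redex-⋖ : redex ∣ δ ⧺ ρ ⋖ new ∣ ε ⧺ ρ
        redex-⋖ = mk⋖ ≤-refl go
          where
          go : ∀ τ n′ → ⟦ redex ⟧ (δ ⧺ ρ) τ n′ → ∃ λ c′ → ⟦ new ⟧ (ε ⧺ ρ) τ c′ × c′ < n′
          go τ n′ (_ , e , Us , m , cst , (m′ , x , _) , y , z)
            with subst (λ s → ⟦ s ⟧ (ε ⧺ ρ) (con K e Us) m′) shared (rec-lookup⊆ es (suc b ↑ʳ x₁) _ m′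
                   (chain-post-⊆ (var-⊆ vk) ch _ m′
                     (subst (λ d → d (con K e Us) m′) (trans (cong (δ ⧺ ρ) (lookup-id (xₘ ↑ˡ n))) (⧺-↑ˡ δ ρ xₘ)) x)))
          ... | _ , refl , p = suc m , (m , mono (t /Var (σ ↑⋆ suc b)) (⧺-mono Us⊆ ⊆ᵉ-refl) τ m
                  (subst (λ s → ⟦ s ⟧ ((λ i → ⟪ Us i ⟫) ⧺ ε ⧺ ρ) τ m) (lookup-/Alts alts σ c)
                    (subst (λ d → d τ m) (⟦⟧ᵃ-lookup (alts /Alts σ) (ε ⧺ ρ) c (λ i → ⟪ Us i ⟫))
                      (ren-⊑ᵃ alts ⊆-insert c (λ i → ⟪ Us i ⟫) τ m y))) , ≤-refl) ,
                  <-≤-trans (sm<cost (occ {n = n} V [] xₘ) cst m) z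
            where
            t = All.lookup alts c
            Us⊆ : ∀ i → ⟪ Us i ⟫ ⊆ rec zs (ε ⧺ ρ) i
            Us⊆ i κ l u with subst (λ d → d κ l) (ys-⟦⟧ (ε ⧺ ρ) i) (p i κ l u)
            ... | l′ , w , q = zs-⊇ i κ l (ε-up (i ↑ˡ k′) q (subst (λ d → d κ l′) (⧺-↑ˡ ε ρ (i ↑ˡ k′)) w))

        plug-redex-⋖ : plug D redex ∣ δ ⧺ ρ ⋖ plug (D /Ctx σ) new ∣ ε ⧺ ρ
        plug-redex-⋖ = spine-ren-⋖ spine ⊆-insert redex-⋖

  ↑ˡ≢↑ʳ : ∀ {k m} (i : Fin k) (j : Fin m) → i ↑ˡ m ≢ k ↑ʳ j
  ↑ˡ≢↑ʳ zero    j ()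
  ↑ˡ≢↑ʳ (suc i) j eq = ↑ˡ≢↑ʳ i j (Finₚ.suc-injective eq)

  lookup-ext : ∀ {A : Set} {k} {xs ys : Vec A k} → (∀ i → lookup xs i ≡ lookup ys i) → xs ≡ ys
  lookup-ext {xs = []}     {[]}     p = refl
  lookup-ext {xs = x ∷ xs} {y ∷ ys} p = cong₂ _∷_ (p zero) (lookup-ext (p ∘ suc))

  -- Call-by-need: one step, and terms without an outermost letrec

  module NeedAdequacy where
    open Model 1 0
    open Substitution 1 0
    open Contexts 1 0
    open Strict 0
    open Need
    open Labels
    open HeadVariables
    open NeedContraction
    open NeedRestructuring
    open TermSubst (termSubst ∅) using (_/Var_; varLift)
    open Traversal {Label} varLift using (_/Vec_; _/Alts_)
    open Renaming ∅

    module CaseSplit {n k b K} (c : suc b ∈ arities K) (ss : Vec (LTm (suc k + n)) (suc b))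
                     (F : Vec (LTm (suc k + n)) (suc k)) {x₁ xₘ : Fin (suc k)} (eq : lookup F x₁ ≡ con S K c ss)
                     (ch : Chain F x₁ xₘ) {D : LCtx [] (suc k + n)} (spine : IsV D) {a : Label}
                     (alts : Alts Label (suc k + n) (arities K)) (ρ : Env n) where

      private
        σ = insert (suc b) (suc k) n
        redex = case a K (occ {n = n} V [] xₘ) alts
        q = plug (D /Ctx σ) (rebind b (suc k) n [] (All.lookup alts c))
        F₁ = (F /Vec σ) [ x₁ ]≔ con ∅ K c (ys (suc b))

      case-in-⋖ : letrec V F (plug D redex) ∣ ρ ⋖ letrec ∅ (split c x₁ ss F) q ∣ ρ
      case-in-⋖ = letrec-strict F (split c x₁ ss F)
        (⊑-⋖-trans (⊑-mono (plug D redex) (⧺-mono F⊆δ ⊆ᵉ-refl)) (plug-redex-⋖ (λ _ _ → tt) ch spine alts))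
        where
        open Splitting c ss F eq ρ (split c x₁ ss F) (λ _ → ⊤) (Vecₚ.lookup-++ˡ (ss /Vec σ) F₁)
          (trans (Vecₚ.lookup-++ʳ (ss /Vec σ) F₁ x₁) (lookup∘updateAt x₁ (F /Vec σ)))
          (λ j _ p → trans (Vecₚ.lookup-++ʳ (ss /Vec σ) F₁ j) (lookup∘updateAt′ j x₁ p (F /Vec σ)))
          hiding (σ; redex)
        F⊆δ : rec F ρ ⊆ᵉ δ
        F⊆δ = rec-least F (λ j → ⊆-trans (⊆-reflexive (binds-lookup F j)) (kept-⊆ j tt))

      -- The binding `u` changes as well and is therefore not among the kept ones. It holds a case
      -- expression and not a variable, so no link of the chain is lost.
      case-e-⋖ : ∀ {u B} → u ≢ x₁ → lookup F u ≡ plug D redex → (∀ {a : Label} {z} → lookup F u ≢ var a z) → Reach F B u →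
                 letrec V F B ∣ ρ ⋖ letrec ∅ (split c x₁ ss F [ suc b ↑ʳ u ]≔ q) (B /Var σ) ∣ ρ
      case-e-⋖ {u} {B} u≢x₁ equ nonvar (z , h , hs) = letrec-strict F es
        (⋖-⊑-trans (Path.head-⋖ F F⊆δ kept-⊆ strict h (Path.path-≪ F F⊆δ kept-⊆ strict hs)) (ren-⊑ B ⊆-insert))
        where
        es = split c x₁ ss F [ suc b ↑ʳ u ]≔ q
        kept : ∀ i → i ≢ suc b ↑ʳ u → lookup es i ≡ lookup (split c x₁ ss F) i
        kept i p = lookup∘updateAt′ i (suc b ↑ʳ u) p (split c x₁ ss F)
        ≢ʳ : ∀ {j} → j ≢ u → suc b ↑ʳ j ≢ suc b ↑ʳ u
        ≢ʳ p e = p (Finₚ.↑ʳ-injective (suc b) _ _ e)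
        open Splitting c ss F eq ρ es (_≢ u)
          (λ i → trans (kept (i ↑ˡ suc k) (↑ˡ≢↑ʳ i u)) (Vecₚ.lookup-++ˡ (ss /Vec σ) F₁ i))
          (trans (kept (suc b ↑ʳ x₁) (≢ʳ (u≢x₁ ∘ sym)))
            (trans (Vecₚ.lookup-++ʳ (ss /Vec σ) F₁ x₁) (lookup∘updateAt x₁ (F /Vec σ))))
          (λ j p r → trans (kept (suc b ↑ʳ j) (≢ʳ p))
            (trans (Vecₚ.lookup-++ʳ (ss /Vec σ) F₁ j) (lookup∘updateAt′ j x₁ r (F /Vec σ))))
          hiding (σ; redex)
        at-u : lookup F u ∣ δ ⧺ ρ ⋖ q ∣ ε ⧺ ρ
        at-u = subst (λ s → s ∣ δ ⧺ ρ ⋖ q ∣ ε ⧺ ρ) (sym equ)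
          (plug-redex-⋖ (λ { w eqw refl → nonvar eqw }) ch spine alts)
        q-⊆ : ⟦ q ⟧ (ε ⧺ ρ) ⊆ δ u
        q-⊆ = ⊆-trans (⟦⟧-≡ (sym (lookup∘updateAt (suc b ↑ʳ u) (split c x₁ ss F))))
          (rec-lookup⊇ es (suc b ↑ʳ u))
        F⊆δ : rec F ρ ⊆ᵉ δ
        F⊆δ = rec-least F (λ j → ⊆-trans (⊆-reflexive (binds-lookup F j)) (at-j j))
          where
          at-j : ∀ j → ⟦ lookup F j ⟧ (δ ⧺ ρ) ⊆ δ j
          at-j j with j Finₚ.≟ u
          ... | yes refl = ⊆-trans (⋖⇒⊆ at-u) q-⊆
          ... | no j≢u   = kept-⊆ j j≢u
        strict : rec F ρ u ≪ δ u
        strict τ m x = let m′ , l , w = ⋖⇒≪ at-u τ m (mono (lookup F u) (⧺-mono F⊆δ ⊆ᵉ-refl) τ m (rec-lookup⊆ F u τ m x)) in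
          m′ , l , q-⊆ τ m′ w

    module _ {n k} (F : Vec (LTm (suc k + n)) (suc k)) (u : Fin (suc k)) (q : LTm (suc k + n)) (ρ : Env n) where
      open Update F u q ρ

      var-post : (∀ {a : Label} {z} → lookup F u ≢ var a z) → ∀ w {a : Label} {z} → lookup F w ≡ var a (z ↑ˡ n) → δ w ⊆ δ z
      var-post nonvar w {a} {z} eq τ m x
        with subst (λ s → ⟦ s ⟧ (δ ⧺ ρ) τ m) eq (kept-⊆ (λ { refl → nonvar eq }) τ m x)
      ... | m′ , y , l = rec-up F′ z l (subst (λ d → d τ m′) (⧺-↑ˡ δ ρ z) y)

    -- The cost stays and only the weight drops, from that of a variable to that of an abstraction.
    -- With `δ` left general, (cp-in) can use the old solution and (cp-e) the new one.
    cp-◃ : ∀ {k n} {δ : Fin k → Pred} {ρ : Env n} {x₁ xₘ a s} → δ xₘ ⊆ δ x₁ → δ x₁ ⊆ ⟦ lam a s ⟧ (δ ⧺ ρ) →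
           occ V [] xₘ ∣ δ ⧺ ρ ◃ lam ∅ s /Var embed [] ∣ δ ⧺ ρ
    cp-◃ {n = n} {δ} {ρ} {x₁} {xₘ} {s = s} p q = mk◃ (λ τ c (m , x , l) → m ,
      sem (ren-⊑ (lam ∅ s) {σ = embed []} (λ y → ⊆-reflexive (cong (δ ⧺ ρ) (sym (lookup-id y))))) τ m
        (q′ τ m (p τ m (subst (λ d → d τ m) (trans (cong (δ ⧺ ρ) (lookup-id (xₘ ↑ˡ n))) (⧺-↑ˡ δ ρ xₘ)) x))) ,
      +-mono-≤-< (+-mono-≤ l l) (s≤s z≤n))
      where
      q′ : δ x₁ ⊆ ⟦ lam ∅ s ⟧ (δ ⧺ ρ)
      q′ = ⊆-trans q (sem (lam-⊑ {a = ∅} {∅} {s} {s} (λ U → ⊆-refl)))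

    case-e₀-⋖ : ∀ {k n} {δ : Fin k → Pred} {ρ : Env n} {x₁ xₘ} {a l : Label} {K} (c : 0 ∈ arities K) alts →
                δ xₘ ⊆ δ x₁ → δ x₁ ⊆ ⟦ con {a = 0} l K c [] ⟧ (δ ⧺ ρ) →
                case a K (occ V [] xₘ) alts ∣ δ ⧺ ρ ⋖ All.lookup alts c ∣ δ ⧺ ρ
    case-e₀-⋖ {n = n} {δ} {ρ} {xₘ = xₘ} {a} {K = K} c alts p q = mk⋖ (weight≤ι (All.lookup alts c)) go
      where
      go : ∀ τ n′ → ⟦ case a K (occ V [] xₘ) alts ⟧ (δ ⧺ ρ) τ n′ → ∃ λ c′ → ⟦ All.lookup alts c ⟧ (δ ⧺ ρ) τ c′ × c′ < n′
      go τ n′ (_ , e , Us , m , i , (m′ , x , _) , y , z)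
        with q _ m′ (p _ m′ (subst (λ d → d (con K e Us) m′) (trans (cong (δ ⧺ ρ) (lookup-id (xₘ ↑ˡ n))) (⧺-↑ˡ δ ρ xₘ)) x))
      ... | _ , refl , _ = m , subst (λ d → d τ m) (⟦⟧ᵃ-lookup alts (δ ⧺ ρ) c (λ i → ⟪ Us i ⟫)) y ,
        <-≤-trans (m<cost (occ {n = n} V [] xₘ) i m) z

    data NeedStep {n} (s : Exp n) : Set₁ where
      answer : Answer s → NeedStep s
      -- (cp-in) at an empty spine does not lower the cost but yields an answer.
      last   : ∀ {s′} → s ⟶ s′ → Answer s′ → NeedStep s
      more   : ∀ {s′} → s ⟶ s′ → s ∣ ∅ᵉ ⋖ s′ ∣ ∅ᵉ → NeedStep s

    finish : ∀ {n} {s : Exp n} {l l′} → Labelling s l → forget l ≡ s → l ↦ l′ → l ∣ ∅ᵉ ⋖ l′ ∣ ∅ᵉ → NeedStep s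
    finish {l = l} {l′} lab refl r p = more (step lab r)
      (⊑-⋖-trans (relabel-⊒ _ l ⊆ᵉ-refl) (⋖-⊑-trans p (relabel-⊑ _ l′ ⊆ᵉ-refl)))

    data Elim {n} : Exp n → Set where
      app  : ∀ {s t} → Elim (app tt s t)
      seq  : ∀ {s t} → Elim (seq tt s t)
      case : ∀ {K s alts} → Elim (case tt K s alts)

    elim-nonhole : ∀ {n} {A : LCtx [] n} {r : LTm n} → Terminal r → Elim (forget (plug A r)) → ¬ IsHole A
    elim-nonhole (lam _)      () isHole
    elim-nonhole (con _)      () isHole
    elim-nonhole (letrec _ _) () isHole

    -- Without a letrec at the top, a variable at the focus would be free and have no token; so the
    -- descent ends at a redex in the innermost frame.
    elim-step : ∀ {n} {s : Exp n} → Elim s → Descent hole (start s) (unlabelled s) → ∃₂ (⟦ s ⟧ ∅ᵉ) → NeedStep s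
    elim-step {s = s} e d (τ , m , x) = go (Descent.focus d) (Descent.same d) (Descent.steps d)
      where
      A = Descent.A d
      sp : IsV A
      sp = Descent.spine d
      go : ∀ {r} → Focus r → forget (plug A r) ≡ forget (unlabelled s) → start s ⇝* plug A r → NeedStep s
      go (var y) eq st = ⊥-elim (proj₂ (proj₂ (Heads-inside (subst (λ s → Heads s y) (trans eq (forget-unlabelled s))
        (Heads-relabel⁺ (Heads-plugV sp))) x)))
      go {r} (terminal t) eq st =
        let eq′ = trans eq (forget-unlabelled s)
            l′ , rule , p = local hole (lastFrame sp) (elim-nonhole t (subst Elim (sym eq′) e)) t
              (τ , m , sem (relabel-⊒ _ (plug A r) ⊆ᵉ-refl) τ m (subst (λ s → ⟦ s ⟧ ∅ᵉ τ m) (sym eq′) x))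
        in finish (Finished-labelling st (Admissible.plugV Finished-admissible sp (Terminal-finished t))) eq′ rule (p ∅ᵉ)

    forget-var : ∀ {n} (t : LTm n) {x} → forget t ≡ var tt x → ∃ λ a → t ≡ var a x
    forget-var (var a x) refl = a , refl

  -- Call-by-need: the step of a letrec

  module LetrecStep {n k} (pbs : Vec (Exp (suc k + n)) (suc k)) (pbody : Exp (suc k + n)) where
    open Model 1 0
    open Contexts 1 0
    open Strict 0
    open Need
    open Labels
    open HeadVariables
    open NeedContraction
    open NeedRestructuring
    open NeedAdequacy
    open Search pbs pbody
    open TermSubst (termSubst ∅) using (_/Var_; varLift)

    lookup-relabelVec : ∀ {A B m j} (f : A → B) (bs : Vec (Tm A m) j) i → lookup (relabelVec f bs) i ≡ relabel f (lookup bs i)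
    lookup-relabelVec f (b ∷ bs) zero    = refl
    lookup-relabelVec f (b ∷ bs) (suc i) = lookup-relabelVec f bs i

    finished-clean : ∀ {m} {u : LTm m} → Clean u → Every Finished u
    finished-clean {u = u} = Every-map Dull-Finished u

    module Labelled (F : Vec (LTm (suc k + n)) (suc k)) (B : LTm (suc k + n))
                    (same : ∀ i → forget (lookup F i) ≡ lookup pbs i) (sameB : forget B ≡ pbody)
                    (lab : Labelling program (letrec V F B)) (x : ∃₂ (⟦ program ⟧ ∅ᵉ)) where

      forget-F : relabelVec (λ _ → tt) F ≡ pbs
      forget-F = lookup-ext (λ i → trans (lookup-relabelVec _ F i) (same i))

      forget-l : forget (letrec V F B) ≡ program
      forget-l = cong₂ (letrec tt) forget-F sameB

      inhabited : ∃₂ (⟦ letrec V F B ⟧ ∅ᵉ)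
      inhabited = let τ , m , y = x in τ , m , sem (relabel-⊒ _ (letrec V F B) ⊆ᵉ-refl) τ m
        (subst (λ s → ⟦ s ⟧ ∅ᵉ τ m) (sym forget-l) y)

      inhabited-B : ∃₂ (⟦ B ⟧ (rec F ∅ᵉ ⧺ ∅ᵉ))
      inhabited-B = let τ , _ , m , y , _ = inhabited in τ , m , y

      -- Labels do not affect denotations, so a token found at a Kleene stage of the program is one
      -- of the labelled binding in the solution of `F`.
      inhabited-F : ∀ i → ∃ (λ N → Stage N i) → ∃₂ (⟦ lookup F i ⟧ (rec F ∅ᵉ ⧺ ∅ᵉ))
      inhabited-F i (N , τ , m , y) = τ , m , rec-lookup⊆ F i τ m (pbs⊆F i τ m (N , y))
        where
        pbs⊆F : rec pbs ∅ᵉ ⊆ᵉ rec F ∅ᵉ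
        pbs⊆F = rec-least pbs (λ i → ⊆-trans (⊆-reflexive (trans (binds-lookup pbs i)
          (cong (λ s → ⟦ s ⟧ (rec F ∅ᵉ ⧺ ∅ᵉ)) (sym (same i)))))
          (⊆-trans (sem (relabel-⊒ _ (lookup F i) ⊆ᵉ-refl)) (rec-lookup⊇ F i)))

      chainF : ∀ {i j} → Chain pbs i j → Chain F i j
      chainF [] = []
      chainF (_∷ʳ_ {y = y} c eq) = chainF c ∷ʳ proj₂ (forget-var (lookup F y) (trans (same y) eq))

      headsF : ∀ {i j} → i ⇒ j → Heads (lookup F i) (j ↑ˡ n)
      headsF {i} {j} h = Heads-relabel⁻ (lookup F i) (subst (λ s → Heads s (j ↑ˡ n)) (sym (same i)) h)

      reachF : ∀ {i} → Reached i → Reach F B i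
      reachF (z , h , hs) = z , Heads-relabel⁻ B (subst (λ s → Heads s (z ↑ˡ n)) (sym sameB) h) , Star.map (λ {i} → headsF {i}) hs

      step-to : ∀ {l′} → letrec V F B ↦ l′ → letrec V F B ∣ ∅ᵉ ⋖ l′ ∣ ∅ᵉ → NeedStep program
      step-to = finish lab forget-l

      body-local : ∀ {s} → s ≡ B → Local (letrecᵇ V F hole) s → NeedStep program
      body-local refl (s′ , rule , p) = step-to rule (letrec-strict F F (p _))

      body-value : ∀ {r} → Terminal r → r ≡ B → NeedStep program
      body-value (lam {s} _) refl = answer (subst (λ b → Answer (letrec tt pbs b)) sameB (letrec-value pbs lam))
      body-value (con _) refl     = answer (subst (λ b → Answer (letrec tt pbs b)) sameB (letrec-value pbs con))
      body-value (letrec {bs = bs₂} {s} _ _) refl = step-to (llet-in F bs₂ s) (llet-in-⋖ F bs₂ s ∅ᵉ)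

      body-final : ∀ {A r} → IsV A → Terminal r → plug A r ≡ B → NeedStep program
      body-final {A} {r} a t eq with isHole? a
      ... | inj₁ refl = body-value t eq
      ... | inj₂ nh   = body-local eq (local (letrecᵇ V F hole) (lastFrame a) nh t
        (subst (λ s → ∃₂ (⟦ s ⟧ (rec F ∅ᵉ ⧺ ∅ᵉ))) (sym eq) inhabited-B))

      module Shared (cur xₘ : Fin (suc k)) (ch : Chain F cur xₘ) where

        κ : Env (suc k + n)
        κ = rec F ∅ᵉ ⧺ ∅ᵉ

        F-chain-⊆ : rec F ∅ᵉ xₘ ⊆ rec F ∅ᵉ cur
        F-chain-⊆ = chain-⊆ {bs = F} ch

        F-cur-⊆ : ∀ {u} → lookup F cur ≡ u → rec F ∅ᵉ cur ⊆ ⟦ u ⟧ κ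
        F-cur-⊆ eq = ⊆-trans (rec-lookup⊆ F cur) (⟦⟧-≡ eq)

        occ-⊆ : ∀ {u} → lookup F cur ≡ u → ∀ τ c → ⟦ occ {n = n} V [] xₘ ⟧ κ τ c → ∃ (⟦ u ⟧ κ τ)
        occ-⊆ eq τ c (m , x , _) = m , F-cur-⊆ eq τ m (F-chain-⊆ τ m
          (subst (λ d → d τ m) (trans (cong κ (lookup-id (xₘ ↑ˡ n))) (⧺-↑ˡ (rec F ∅ᵉ) ∅ᵉ xₘ)) x))

        module Constructor {a K} {c : a ∈ arities K} {ss} (eq : lookup F cur ≡ con S K c ss) where

          not-applied : ∀ t → ¬ ∃₂ (⟦ app V (occ V [] xₘ) t ⟧ κ)
          not-applied t (_ , _ , _ , _ , i , x , _) with occ-⊆ eq _ i x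
          ... | _ , _ , () , _

          case-type : ∀ {K′} alts → ∃₂ (⟦ case V K′ (occ V [] xₘ) alts ⟧ κ) → K′ ≡ K
          case-type alts (_ , _ , _ , _ , _ , _ , i , x , _) with occ-⊆ eq _ i x
          ... | _ , _ , refl , _ = refl

        rule : ∀ {b l′} → B ≡ b → letrec V F b ↦ l′ → letrec V F b ∣ ∅ᵉ ⋖ l′ ∣ ∅ᵉ → NeedStep program
        rule refl = step-to

        copy-in : ∀ {s D} → IsV D → B ≡ plug D (occ V [] xₘ) → lookup F cur ≡ lam S s → NeedStep program
        copy-in {s} {D} d eqB eq with isHole? d
        ... | inj₂ nh = rule eqB (cp-in F D eq ch) (letrec-strict F F
                (frame-⋖ (lastFrame d) nh (cp-◃ {x₁ = cur} {a = S} {s} F-chain-⊆ (F-cur-⊆ eq))))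
        ... | inj₁ refl = last (step lab (subst (λ b → letrec V F b ↦ letrec V F (lam ∅ s /Var embed [])) (sym eqB) (cp-in F hole eq ch)))
                (letrec-value _ lam)

        inside-B : ∀ {D s} → IsV D → B ≡ plug D s → ∃₂ (⟦ s ⟧ κ)
        inside-B d refl = inside d (proj₂ (proj₂ inhabited-B))

        con-in : ∀ {a K} {c : a ∈ arities K} {ss D} → LastFrame D → B ≡ plug D (occ V [] xₘ) → lookup F cur ≡ con S K c ss →
                 Chain pbs cur xₘ → NeedStep program
        -- The body is just a variable whose chain leads to a constructor, which is already an
        -- answer.
        con-in hole eqB eq chain = answer (subst (λ b → Answer (letrec tt pbs b))
          (trans (cong (var tt) (sym (lookup-id (xₘ ↑ˡ n)))) (trans (sym (cong forget eqB)) sameB))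
          (letrec-con pbs (trans (sym (same cur)) (cong forget eq)) chain))
        con-in (app {A} a t) eqB eq _ =
          ⊥-elim (Constructor.not-applied eq t (inside-B a (trans eqB (plug-⊚ A (appˡ V hole t) _))))
        con-in (seq {A} a t) eqB eq _ = rule (trans eqB (plug-⊚ A (seqˡ V hole t) _))
          (seq-in F A t eq ch) (letrec-strict F F (spine-⋖ a seq-value-⋖))
        con-in {ar} {c = c} {ss} (case {A} a {K} alts) eqB eq _
          with eqB′ ← trans eqB (plug-⊚ A (caseˢ V K hole alts) _)
          with refl ← Constructor.case-type eq alts (inside-B a eqB′) = by-arity c ss eq
          where
          by-arity : ∀ {ar} (c : ar ∈ arities K) ss → lookup F cur ≡ con S K c ss → NeedStep program
          by-arity {zero} c [] eq = rule eqB′ (case-in₀ F A c alts eq ch)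
            (letrec-strict F F (spine-⋖ a (case-e₀-⋖ {x₁ = cur} {l = S} c alts F-chain-⊆ (F-cur-⊆ eq))))
          by-arity {suc b} c ss eq = rule eqB′ (case-in F A c ss alts eq ch) (CaseSplit.case-in-⋖ c ss F eq ch a alts ∅ᵉ)

        -- A step in the binding `u` changes the solution, and `update-⋖` asks for the saving in the
        -- new one. Since `u` is not bound to a variable and differs from `cur`, the chain and the
        -- shared value are still available there.
        module InBinding (u : Fin (suc k)) (u≢cur : u ≢ cur) {D : LCtx [] (suc k + n)} (d : IsV D) (nh : ¬ IsHole D)
                         (equ : lookup F u ≡ plug D (occ V [] xₘ)) (stage : ∃ λ N → Stage N u) (reach : Reach F B u) where

          nonvar : ∀ {a : Label} {z} → lookup F u ≢ var a z
          nonvar {a} {z} eq = plug-nonvar d nh (trans (sym equ) eq)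
            where
            plug-nonvar : ∀ {D : LCtx [] (suc k + n)} → IsV D → ¬ IsHole D → ∀ {s} → plug D s ≢ var a z
            plug-nonvar hole       nh = contradiction isHole nh
            plug-nonvar (app _ _)  nh ()
            plug-nonvar (seq _ _)  nh ()
            plug-nonvar (case _ _) nh ()

          module _ (q : LTm (suc k + n)) where
            open Update F u q ∅ᵉ using (δ; kept-⊆; update-⋖)

            new-chain-⊆ : δ xₘ ⊆ δ cur
            new-chain-⊆ = chain-post-⊆ (var-post F u q ∅ᵉ nonvar) ch

            new-cur-⊆ : ∀ {s} → lookup F cur ≡ s → δ cur ⊆ ⟦ s ⟧ (δ ⧺ ∅ᵉ)
            new-cur-⊆ eq = ⊆-trans (kept-⊆ (u≢cur ∘ sym)) (⟦⟧-≡ eq)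

            update : ∀ {s} → lookup F u ≡ s → s ∣ δ ⧺ ∅ᵉ ⋖ q ∣ δ ⧺ ∅ᵉ → letrec V F B ↦ letrec V (F [ u ]≔ q) B →
                     NeedStep program
            update eq p r = step-to r (update-⋖ (subst (λ s → s ∣ δ ⧺ ∅ᵉ ⋖ q ∣ δ ⧺ ∅ᵉ) (sym eq) p) reach)

          copy-e : ∀ {s} → lookup F cur ≡ lam S s → NeedStep program
          copy-e {s} eq = update q equ
            (frame-⋖ (lastFrame d) nh (cp-◃ {x₁ = cur} {a = S} {s} (new-chain-⊆ q) (new-cur-⊆ q eq)))
            (cp-e F D B eq ch u≢cur equ)
            where q = plug D (lam ∅ s /Var embed [])

          inside-u : ∀ {D s} → IsV D → lookup F u ≡ plug D s → ∃₂ (⟦ s ⟧ κ)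
          inside-u {D} d eq = inside d (subst (λ s → ⟦ s ⟧ κ _ _) eq (proj₂ (proj₂ (inhabited-F u stage))))

          con-e : ∀ {a K} {c : a ∈ arities K} {ss D} → LastFrame D → ¬ IsHole D → lookup F u ≡ plug D (occ V [] xₘ) →
                  lookup F cur ≡ con S K c ss → NeedStep program
          con-e hole nh _ _ = contradiction isHole nh
          con-e (app {A} a t) _ equ eq =
            ⊥-elim (Constructor.not-applied eq t (inside-u a (trans equ (plug-⊚ A (appˡ V hole t) _))))
          con-e (seq {A} a t) _ equ eq = update (plug A t) equ′ (spine-⋖ a seq-value-⋖) (seq-e F A t B eq ch u≢cur equ′)
            where equ′ = trans equ (plug-⊚ A (seqˡ V hole t) _)
          con-e {c = c} {ss} (case {A} a {K} alts) _ equ eq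
            with equ′ ← trans equ (plug-⊚ A (caseˢ V K hole alts) _)
            with refl ← Constructor.case-type eq alts (inside-u a equ′) = by-arity c ss eq
            where
            by-arity : ∀ {ar} (c : ar ∈ arities K) ss → lookup F cur ≡ con S K c ss → NeedStep program
            by-arity {zero} c [] eq = update q equ′
              (spine-⋖ a (case-e₀-⋖ {x₁ = cur} {l = S} c alts (new-chain-⊆ q) (new-cur-⊆ q eq)))
              (case-e₀ F A c alts B eq ch u≢cur equ′)
              where q = plug A (All.lookup alts c)
            by-arity {suc b} c ss eq = step-to (case-e F A c ss alts B eq ch u≢cur equ′)
              (CaseSplit.case-e-⋖ c ss F eq ch a alts ∅ᵉ u≢cur equ′ nonvar reach)

      module Bound {cur xₘ} (chain : Chain pbs cur xₘ) (stage : ∃ λ N → Stage N cur) (reach : Reached cur)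
                   (ref : Reference F B cur xₘ) where
        open Shared cur xₘ (chainF chain)

        occ≡ : ∀ (D : LCtx [] (suc k + n)) → plug D (var V (xₘ ↑ˡ n)) ≡ plug D (occ V [] xₘ)
        occ≡ D = cong (λ y → plug D (var V y)) (sym (lookup-id (xₘ ↑ˡ n)))

        ≢cur : ∀ {u} → u ⇒⁺ cur → u ≢ cur
        ≢cur p refl = acyclic (proj₁ stage) (proj₂ stage) p

        copied : ∀ {s} → Reference F B cur xₘ → lookup F cur ≡ lam S s → NeedStep program
        copied (body {D} d eqB)              eq = copy-in d (trans eqB (occ≡ D)) eq
        copied (bind u {D} d nh equ p r st) eq = InBinding.copy-e u (≢cur p) d nh (trans equ (occ≡ D)) st (reachF r) eq

        inspected : ∀ {a K} {c : a ∈ arities K} {ss} → Reference F B cur xₘ → lookup F cur ≡ con S K c ss → NeedStep program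
        inspected (body {D} d eqB)              eq = con-in (lastFrame d) (trans eqB (occ≡ D)) eq chain
        inspected (bind u {D} d nh equ p r st) eq =
          InBinding.con-e u (≢cur p) d nh (trans equ (occ≡ D)) st (reachF r) (lastFrame d) nh (trans equ (occ≡ D)) eq

        bound-value : ∀ {r} → Terminal r → lookup F cur ≡ r → NeedStep program
        bound-value (letrec {bs = bs₂} {s} _ _) eq =
          step-to (llet-e F cur bs₂ s B eq) (llet-e-⋖ F cur bs₂ s ∅ᵉ eq (reachF reach))
        bound-value (lam _) eq = copied ref eq
        bound-value (con _) eq = inspected ref eq

        bound-local : ∀ {s} → lookup F cur ≡ s → Local (letrecᵉ V (entry F cur) B) s → NeedStep program
        bound-local refl (s′ , r , p) = step-to
          (subst₂ _↦_ (cong (λ bs → letrec V bs B) (trans (plugVec-entry F cur _) (Vecₚ.[]≔-lookup F cur)))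
                      (cong (λ bs → letrec V bs B) (plugVec-entry F cur s′)) r)
          (Update.update-⋖ F cur s′ ∅ᵉ (p _) (reachF reach))

        bound-final : ∀ {A r} → IsV A → Terminal r → lookup F cur ≡ plug A r → NeedStep program
        bound-final {A} {r} a t eq with isHole? a
        ... | inj₁ refl = bound-value t eq
        ... | inj₂ nh   = bound-local eq (local (letrecᵉ V (entry F cur) B) (lastFrame a) nh t
          (subst (λ s → ∃₂ (⟦ s ⟧ (rec F ∅ᵉ ⧺ ∅ᵉ))) eq (inhabited-F cur stage)))

    binding-step : Final → ∃₂ (⟦ program ⟧ ∅ᵉ) → NeedStep program
    binding-step f x = Labelled.Bound.bound-final F B same-F sameB lab x chain stage reach (ref-F ref) spine term (lookup∘updateAt cur lbs)
      where
      open Final f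
      F : Vec (LTm (suc k + n)) (suc k)
      F = lbs [ cur ]≔ plug A r
      same-F : ∀ i → forget (lookup F i) ≡ lookup pbs i
      same-F = lookup-≔-elim {bs = lbs} {P = λ i s → forget s ≡ lookup pbs i} same-cur (λ i _ → same i)
      lab : Labelling program (letrec V F B)
      lab = Finished-labelling steps ((λ ()) , Every-tabulate (lookup-≔-elim {bs = lbs} {P = λ _ → Every Finished}
        (Admissible.plugV Finished-admissible spine (Terminal-finished term)) (λ i _ → finished-clean (clean i))) , finished-clean cleanB)
      ref-F : ∀ {y} → Reference lbs B cur y → Reference F B cur y
      ref-F (body d eq) = body d eq
      ref-F (bind u d nh eq p r st) = bind u d nh
        (trans (lookup∘updateAt′ u cur (λ { refl → acyclic (proj₁ stage) (proj₂ stage) p }) lbs) eq) p r st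

    -- Demand first descends into the body. There it ends at a terminal focus, or it meets a head
    -- variable, which must be bound here because it has a token; the stage of that token starts the
    -- search among the bindings.
    letrec-step : ∃₂ (⟦ program ⟧ ∅ᵉ) → NeedStep program
    letrec-step x@(τ , m , m′ , y , _) = go (Descent.focus d) (Descent.same d) (Descent.steps d)
      where
      bs₀ : Vec (LTm (suc k + n)) (suc k)
      bs₀ = relabelVec (λ _ → ∅) pbs
      bs₀-lookup : ∀ i → lookup bs₀ i ≡ unlabelled (lookup pbs i)
      bs₀-lookup = lookup-relabelVec _ pbs
      bs₀-clean : Everyᵛ Dull bs₀
      bs₀-clean = unlabelled-cleanᵛ pbs
      bs₀-same : ∀ i → forget (lookup bs₀ i) ≡ lookup pbs i
      bs₀-same i = trans (cong forget (bs₀-lookup i)) (forget-unlabelled (lookup pbs i))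
      body₀ : LTm (suc k + n)
      body₀ = unlabelled pbody
      C : LCtx (suc k ∷ []) n
      C = letrecᵇ V bs₀ hole
      nonvar : Everyᵛ NonVar bs₀
      nonvar = Every-tabulate (λ i → NonVar-dull _ (Every-lookup bs₀-clean i))
      first : start program ⇝ letrec V bs₀ (body₀ ^ S)
      first = safe-step hole (λ p → p) (tt , nonvar , NonVar-dull body₀ (unlabelled-clean pbody)) (letrec bs₀ body₀)
      d : Descent C (letrec V bs₀ (body₀ ^ S)) body₀
      d = descend C (λ p → tt , nonvar , p) body₀ (proj₂ (unlabelled-clean pbody))
      A = Descent.A d
      sp : IsV A
      sp = Descent.spine d
      go : ∀ {r} → Focus r → forget (plug A r) ≡ forget body₀ → letrec V bs₀ (body₀ ^ S) ⇝* letrec V bs₀ (plug A r) →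
           NeedStep program
      go (terminal t) eq st = Labelled.body-final bs₀ _ bs₀-same (trans eq (forget-unlabelled pbody))
        (Finished-labelling (first ◅ st) ((λ ()) , Every-tabulate (λ i → finished-clean (Every-lookup bs₀-clean i)) ,
          Admissible.plugV Finished-admissible sp (Terminal-finished t)))
        x sp t refl
      go (var w) eq st with heads ← subst (λ s → Heads s w) (trans eq (forget-unlabelled pbody)) (Heads-relabel⁺ (Heads-plugV sp))
                       with bound w (Heads-inside heads y)
      ... | z , refl , σ , l , N , q = binding-step (search N {z} (σ , l , q) record
        { lbs = bs₀ ; B = plug A (var V (z ↑ˡ n))
        ; steps = first ◅ st ◅◅ (subst₂ (λ v v′ → letrec V bs₀ (plug A v) ⇝ letrec V (bs₀ [ z ]%= (_^ S)) (plug A v′))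
            (cong (var S) (lookup-id (z ↑ˡ n))) (cong (var V) (lookup-id (z ↑ˡ n)))
            (at hole (body bs₀ z A) (¬Fails (no-fail , Every-tabulate (λ i → dull (Every-lookup bs₀-clean i)) ,
              Admissible.plugV NoFail-admissible sp ((λ ()) , tt)))) ◅ Star.ε)
        ; clean = Every-lookup bs₀-clean
        ; cleanB = Admissible.plugV Dull-admissible sp (V-dull , tt)
        ; same = bs₀-same
        ; sameB = trans (same-plug sp V S (z ↑ˡ n)) (trans eq (forget-unlabelled pbody))
        ; status = λ i → inj₂ (trans (cong label (bs₀-lookup i)) (label-unlabelled (lookup pbs i)))
        ; chain = [] ; ref = body sp refl ; reach = z , heads , Star.ε }) x
        where
        dull : ∀ {m} {u : LTm m} → Clean u → Every NoFail u
        dull = Every-map (Admissible.on-dull NoFail-admissible) _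
        no-fail : ∀ {B} → NoFail (letrec V bs₀ B)
        no-fail (visited bs _ y C _ _ _ eq) = unclean C (sym eq) (Every-lookup bs₀-clean y)
        no-fail (self bs y C _ eq)          = unclean C (sym eq) (Every-lookup bs₀-clean y)

  -- Termination of call-by-need and equivalence of convergence

  module Need↓ where
    open Model 1 0
    open Strict 0
    open Need
    open Labels
    open NeedAdequacy

    private
      nonvar : ∀ {n} (s : Exp n) → Every NonVar (unlabelled s)
      nonvar s = NonVar-dull _ (unlabelled-clean s)

      nonvarᵃ : ∀ {n as} (alts : Alts ⊤ n as) → Everyᵃ NonVar (relabelAlts (λ _ → ∅) alts)
      nonvarᵃ alts = Every-mapᵃ (Admissible.on-dull NonVar-admissible) _ (unlabelled-cleanᵃ alts)

    need-step : ∀ {n} (s : Exp n) → ∃₂ (⟦ s ⟧ ∅ᵉ) → NeedStep s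
    need-step (var tt x)       (_ , _ , _ , () , _)
    need-step (lam tt s)       _ = answer (value lam)
    need-step (con tt K c ss)  _ = answer (value con)
    need-step (letrec tt bs t) x = LetrecStep.letrec-step bs t x
    need-step (app tt s t) x = elim-step app
      (wrap hole (appˡ V hole (unlabelled t))
        (safe-step hole (λ p → p) (tt , nonvar s , nonvar t) (app isT (unlabelled s) (unlabelled t)))
        (λ A → app A (unlabelled-clean t)) (cong (λ z → app tt z _))
        (descend (appˡ V hole (unlabelled t)) (λ p → tt , p , nonvar t) (unlabelled s) (proj₂ (unlabelled-clean s)))) x
    need-step (seq tt s t) x = elim-step seq
      (wrap hole (seqˡ V hole (unlabelled t))
        (safe-step hole (λ p → p) (tt , nonvar s , nonvar t) (seq isT (unlabelled s) (unlabelled t)))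
        (λ A → seq A (unlabelled-clean t)) (cong (λ z → seq tt z _))
        (descend (seqˡ V hole (unlabelled t)) (λ p → tt , p , nonvar t) (unlabelled s) (proj₂ (unlabelled-clean s)))) x
    need-step (case tt K s alts) x = elim-step case
      (wrap hole (caseˢ V K hole alts′)
        (safe-step hole (λ p → p) (tt , nonvar s , nonvarᵃ alts) (case isT (unlabelled s) alts′))
        (λ A → case A (unlabelled-cleanᵃ alts)) (cong (λ z → case tt K z _))
        (descend (caseˢ V K hole alts′) (λ p → tt , p , nonvarᵃ alts) (unlabelled s) (proj₂ (unlabelled-clean s)))) x
      where alts′ = relabelAlts (λ _ → ∅) alts

    -- The token is fixed and each step lowers its cost, except a `last` step, which arrives at an
    -- answer at once.
    need-↓ : ∀ {n} (s : Exp n) {τ m} → ⟦ s ⟧ ∅ᵉ τ m → ∃ λ u → Star _⟶_ s u × Answer u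
    need-↓ s {τ} {m} = <-rec (λ m → ∀ {s} → ⟦ s ⟧ ∅ᵉ τ m → ∃ λ u → Star _⟶_ s u × Answer u)
      (λ m ih x → go ih (need-step _ (τ , m , x)) x) m
      where
      go : ∀ {m s} → (∀ {m′} → m′ < m → ∀ {s} → ⟦ s ⟧ ∅ᵉ τ m′ → ∃ λ u → Star _⟶_ s u × Answer u) →
           NeedStep s → ⟦ s ⟧ ∅ᵉ τ m → ∃ λ u → Star _⟶_ s u × Answer u
      go ih (answer a)  x = _ , Star.ε , a
      go ih (last st a) x = _ , st ◅ Star.ε , a
      go ih (more st p) x with _∣_⋖_∣_.lt p τ _ x
      ... | m′ , y , l with ih l y
      ... | u , sts , a = u , st ◅ sts , a

  -- Soundness lives at the charges 0 and 0, termination of call-by-need at 1 and 0; `transfer`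
  -- connects the two models.
  name⇒need : ∀ {n} (s : Exp n) → Preorder._↓ Name._⟶_ Name.Answer s → Preorder._↓ Need._⟶_ Need.Answer s
  name⇒need s (u , sts , a) with Transfer.transfer 0 0 1 0 s (FreeSoundness.name-↓-inhabited sts a)
  ... | τ , m , x = Need↓.need-↓ s x

  -- The target charges are 1 and 1 here, because (gcp) in general saves nothing but the charge of
  -- the variable it replaces.
  need⇒name : ∀ {n} (s : Exp n) → Preorder._↓ Need._⟶_ Need.Answer s → Preorder._↓ Name._⟶_ Name.Answer s
  need⇒name s (u , sts , a) with Transfer.transfer 0 0 1 1 s (FreeSoundness.need-↓-inhabited sts a)
  ... | τ , m , x = NameAdequacy.name-↓ s x

-- Both preorders quantify over the same contexts and renamings, so it is enough that every term
-- converges in one calculus exactly when it converges in the other.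
theorem5p31 : (𝕊 : Signature) → let open Calculus 𝕊 in
    (n : ℕ) (s t : Exp n) → (s ≤name t) ⇔ (s ≤LR t)
theorem5p31 𝕊 n s t = mk⇔
  (λ s≤t {_} {_} C ρ inj p → name⇒need _ (s≤t C ρ inj (need⇒name _ p)))
  (λ s≤t {_} {_} C ρ inj p → need⇒name _ (s≤t C ρ inj (name⇒need _ p)))
  where open Proof 𝕊
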